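{- Let $p$ be a prime with $p\equiv 3\pmod 4$ and let $E\subseteq\mathbb{F}_p^2$ with $|E|\ll p^{8/5}$. Then \[|[E,E,0][E,E,0]|\gg |[E,E,0]|^{19/15}.\]
   Context: The Heisenberg group $H_2(\mathbb{F}_p)$ consists of the matrices \[[\mathbf{x},\mathbf{y},z]=\begin{bmatrix}1&\mathbf{x}&z\\ \mathbf{0}&I_2&\mathbf{y}^t\\ 0&\mathbf{0}&1\end{bmatrix},\qquad \mathbf{x},\mathbf{y}\in \mathbb{F}_p^2,\ z\in \mathbb{F}_p,\] with matrix multiplication, so $[\mathbf{x},\mathbf{y},z][\mathbf{x}',\mathbf{y}',z']=[\mathbf{x}+\mathbf{x}',\mathbf{y}+\mathbf{y}',z+z'+\mathbf{x}\cdot\mathbf{y}']$. $[E,E,0]=\{[\mathbf{x},\mathbf{y},0]:\mathbf{x},\mathbf{y}\in E\}$ and $[E,E,0][E,E,0]=\{mm':m,m'\in[E,E,0]\}$. $X\ll Y$ (equivalently $Y\gg X$) means $X\le CY$ for a constant $C>0$ independent of $p$ and $E$. -}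

module Defs where

open import Data.Nat using (ℕ; _+_; _*_; _<_; _%_; NonZero)
open import Data.Nat.Properties using (_≟_)
open import Data.Product using (_×_; _,_)
open import Data.Product.Properties using (≡-dec)
open import Data.List using (List; concatMap; deduplicate; [_])

-- Elements of F_p are represented by naturals 0 ≤ a < p (arithmetic mod p).
F2 : Set
F2 = ℕ × ℕ

InField : ℕ → F2 → Set
InField p (a , b) = (a < p) × (b < p)

Heis : Set
Heis = F2 × F2 × ℕ

_≟F2_ : (u v : F2) → _
_≟F2_ = ≡-dec _≟_ _≟_

_≟H_ : (u v : Heis) → _
_≟H_ = ≡-dec _≟F2_ (≡-dec _≟F2_ _≟_)

module _ (p : ℕ) .{{_ : NonZero p}} where

  addF2 : F2 → F2 → F2
  addF2 (a , b) (c , d) = ((a + c) % p , (b + d) % p)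

  dotF2 : F2 → F2 → ℕ
  dotF2 (a , b) (c , d) = (a * c + b * d) % p

  mulH : Heis → Heis → Heis
  mulH (x , y , z) (x' , y' , z') = (addF2 x x' , addF2 y y' , (z + z' + dotF2 x y') % p)

  EE0 : List F2 → List Heis
  EE0 E = deduplicate _≟H_ (concatMap (λ x → concatMap (λ y → [ (x , y , 0) ]) E) E)

  EE0EE0 : List F2 → List Heis
  EE0EE0 E = deduplicate _≟H_
    (concatMap (λ m → concatMap (λ m' → [ mulH m m' ]) (EE0 E)) (EE0 E))

{-# OPTIONS --safe #-}
module Submission where

-- Write N = |E|. For fixed x₀ the elements [x, y, 0][x₀, y′, 0] yield at least N Σ_x |x · E| products. If |x · E| ≤ d for
-- typical x, then, the form x · x being anisotropic for p ≡ 3 (mod 4), some N / 4d pairwise independent directions each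
-- cover E by d lines. With two of them as axes, an incidence (a, b) with a = sb + t = s′b′ + t′ becomes a meeting of
-- two isotropic lines y = βx − σ, z = βy + τ for the form y² − xz. Take a polynomial of minimal degree vanishing on
-- all these lines: along some line where its gradient does not vanish the contact with the meeting lines exceeds the degree,
-- so a differential equation holds identically, and as the degree is below p it confines the meeting lines to too few
-- parameters. With k ≈ N² / d³ of the directions this gives k N⁴ ≪ d⁸, hence N⁸ ≪ d¹⁵. The degree is of order kd, and it
-- is below p because counting the collisions x · y = x · y′ over all directions x yields N² ≪ p d² when 2d ≤ p.
-- When 2d > p, the hypothesis N⁵ ≪ p⁸ suffices.

open import Defs
open import Data.Nat as ℕ using (ℕ; zero; suc; z≤n; s≤s; NonZero)
import Data.Nat.Properties as ℕₚ
import Data.Nat.Divisibility as ℕᵈ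
import Data.Nat.DivMod as ℕᵐ
open import Data.Nat.Induction using (<-wellFounded)
open import Induction.WellFounded using (Acc; acc)
open import Data.Nat.Primality using (Prime; euclidsLemma; prime⇒nonZero; prime⇒nonTrivial)
open import Data.Nat.Coprimality using (prime⇒coprime; coprime-Bézout)
open import Data.Nat.GCD using (module Bézout)
open import Data.Integer using (ℤ; +_; -_; _+_; _*_; _-_; 0ℤ; 1ℤ; ∣_∣)
import Data.Integer.Properties as ℤₚ
import Data.Integer.DivMod as ℤᵈ
open import Data.Integer.Divisibility.Signed using (_∣_; divides; _∣?_; ∣m∣n⇒∣m+n; ∣n⇒∣m*n; ∣m⇒∣m*n; ∣⇒∣ᵤ; ∣ᵤ⇒∣)
open import Data.Integer.Tactic.RingSolver using (solve-∀)
import Data.Nat.Tactic.RingSolver as NatSolver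
open import Data.Product using (Σ; ∃-syntax; _×_; _,_; proj₁; proj₂)
open import Data.Product.Properties using (≡-dec)
open import Data.Sum using (_⊎_; inj₁; inj₂; [_,_]′)
open import Data.Empty using (⊥)
open import Data.Unit using (⊤; tt)
open import Data.Bool using (Bool; true; false; not)
open import Data.Vec using (Vec; []; _∷_)
open import Data.List using (List; []; _∷_; _++_; length; map; upTo; filter; concatMap; cartesianProduct; deduplicate; take; applyUpTo)
open import Data.Nat.ListAction using (sum)
import Data.Nat.ListAction.Properties as Listₚₐ
import Data.List.Properties as Listₚ
open import Data.List.Relation.Unary.All as All using (All; []; _∷_)
import Data.List.Relation.Unary.All.Properties as Allₚ
open import Data.List.Relation.Unary.Any as Any using (Any; here; there)
open import Data.List.Relation.Unary.AllPairs as AllPairs using (AllPairs; []; _∷_)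
import Data.List.Relation.Unary.AllPairs.Properties as AllPairsₚ
open import Data.List.Relation.Unary.Unique.Propositional using (Unique)
import Data.List.Relation.Unary.Unique.Propositional.Properties as Uniqueₚ
open import Data.List.Relation.Unary.Unique.DecPropositional.Properties using (deduplicate-!)
open import Data.List.Membership.Propositional using (_∈_; lose; find)
import Data.List.Membership.Propositional.Properties as ∈ₚ
open import Relation.Nullary using (¬_; Dec; yes; no; contradiction)
open import Relation.Nullary.Decidable using (¬?; _×-dec_; _⊎-dec_; decidable-stable)
open import Relation.Unary using (Decidable)
open import Relation.Binary using (DecidableEquality; tri<; tri≈; tri>)
open import Relation.Binary.PropositionalEquality using (_≡_; _≢_; refl; sym; trans; cong; cong₂; subst; subst₂)
open import Function using (id)

-- Two isotropic lines with `β ≠ β′` meet exactly when `βσ′ − σβ′ + τ′ − τ = 0`, so the lines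
-- meeting a given one lie in a plane of parameters. A second linear equation leaves a line in that
-- plane, and inside a product of ordinates and slopes such a line has at most `d + k` members. This
-- second equation is what the polynomial supplies. At a meeting with slope difference h the
-- gradient gives `h = −f/g`; contact of order two then eliminates h into `Hess`, and the derivative
-- of `Hess` on one line, read in the jet of the other, says `(g/f)″ = 0` there. So `g/f = −1/h` is
-- affine in the abscissa `x = (σ′ − σ)/h`, and multiplying by h makes this linear.
--
-- Zeros are counted along a line, so its meeting points must be distinct, yet all partners with
-- `s = s′` would meet it at abscissa 0. A parameter `ν` that changes the lines but not the meeting
-- equation separates most of them.
--
-- More slopes give a stronger bound, but both the choice of `ν` and the degree demand kd ≪ p; by N²
-- ≪ pd² this holds for k of order N² / d³.

by-cases : ∀ {A B : Set} → Dec A → (A → B) → (¬ A → B) → B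
by-cases (yes a) f g = f a
by-cases (no ¬a) f g = g ¬a

-- Congruences modulo a prime.

module Modular (p : ℕ) (p-prime : Prime p) where

  private instance
    p-nonZero : NonZero p
    p-nonZero = prime⇒nonZero p-prime

  infix 4 _≈0 _≉0

  _≈0 : ℤ → Set
  x ≈0 = + p ∣ x

  _≉0 : ℤ → Set
  x ≉0 = ¬ x ≈0

  _≈0? : Decidable _≈0
  x ≈0? = + p ∣? x

  1<p : 1 ℕ.< p
  1<p = ℕ.nonTrivial⇒n>1 p ⦃ prime⇒nonTrivial p-prime ⦄

  0≈0 : 0ℤ ≈0
  0≈0 = divides 0ℤ refl

  ≡0⇒≈0 : ∀ {x} → x ≡ 0ℤ → x ≈0
  ≡0⇒≈0 refl = 0≈0

  lin₁ : ∀ {e u} → u ≈0 → ∀ c → e ≡ c * u → e ≈0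
  lin₁ u c refl = ∣n⇒∣m*n c u

  lin₂ : ∀ {e u v} → u ≈0 → v ≈0 → ∀ c d → e ≡ c * u + d * v → e ≈0
  lin₂ u v c d refl = ∣m∣n⇒∣m+n (∣n⇒∣m*n c u) (∣n⇒∣m*n d v)

  lin₃ : ∀ {e u v w} → u ≈0 → v ≈0 → w ≈0 → ∀ c d f → e ≡ c * u + d * v + f * w → e ≈0
  lin₃ u v w c d f refl = ∣m∣n⇒∣m+n (lin₂ u v c d refl) (∣n⇒∣m*n f w)

  lin₄ : ∀ {e u v w z} → u ≈0 → v ≈0 → w ≈0 → z ≈0 → ∀ c d f g → e ≡ c * u + d * v + f * w + g * z → e ≈0
  lin₄ u v w z c d f g refl = ∣m∣n⇒∣m+n (lin₃ u v w c d f refl) (∣n⇒∣m*n g z)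

  *≈0⇒⊎ : ∀ x y → x * y ≈0 → x ≈0 ⊎ y ≈0
  *≈0⇒⊎ x y xy with euclidsLemma ∣ x ∣ ∣ y ∣ p-prime (subst (p ℕᵈ.∣_) (ℤₚ.abs-* x y) (∣⇒∣ᵤ xy))
  ... | inj₁ a = inj₁ (∣ᵤ⇒∣ a)
  ... | inj₂ b = inj₂ (∣ᵤ⇒∣ b)

  cancelˡ : ∀ x {y} → x ≉0 → x * y ≈0 → y ≈0
  cancelˡ x {y} x≉ xy with *≈0⇒⊎ x y xy
  ... | inj₁ a = contradiction a x≉
  ... | inj₂ b = b

  *≉0 : ∀ {x y} → x ≉0 → y ≉0 → x * y ≉0
  *≉0 {x} x≉ y≉ xy = y≉ (cancelˡ x x≉ xy)

  -‿flip : ∀ x y → (x - y) ≈0 → (y - x) ≈0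
  -‿flip x y xy = lin₁ xy (- 1ℤ) (eq x y)
    where eq : ∀ x y → y - x ≡ - 1ℤ * (x - y)
          eq = solve-∀

  ≈0-cong : ∀ x y → (x - y) ≈0 → y ≈0 → x ≈0
  ≈0-cong x y xy y≈0 = lin₂ xy y≈0 1ℤ 1ℤ (eq x y)
    where eq : ∀ x y → x ≡ 1ℤ * (x - y) + 1ℤ * y
          eq = solve-∀

  small≉0 : ∀ {n} → 0 ℕ.< n → n ℕ.< p → + n ≉0
  small≉0 {suc n} _ n<p pn = ℕₚ.<⇒≱ n<p (ℕᵈ.∣⇒≤ (∣⇒∣ᵤ pn))

  1≉0 : 1ℤ ≉0
  1≉0 = small≉0 (s≤s z≤n) 1<p

  ordered≉0 : ∀ {m n} → m ℕ.< n → n ℕ.< p → (+ n - + m) ≉0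
  ordered≉0 {m} {n} m<n n<p = subst _≉0
    (sym (trans (ℤₚ.m-n≡m⊖n n m) (ℤₚ.⊖-≥ (ℕₚ.<⇒≤ m<n))))
    (small≉0 (ℕₚ.m<n⇒0<n∸m m<n) (ℕₚ.≤-<-trans (ℕₚ.m∸n≤m n m) n<p))

  ≈⇒≡ : ∀ {m n} → m ℕ.< p → n ℕ.< p → (+ m - + n) ≈0 → m ≡ n
  ≈⇒≡ {m} {n} m<p n<p m≈n with ℕₚ.<-cmp m n
  ... | tri< m<n _ _ = contradiction (-‿flip (+ m) (+ n) m≈n) (ordered≉0 m<n n<p)
  ... | tri≈ _ m≡n _ = m≡n
  ... | tri> _ _ n<m = contradiction m≈n (ordered≉0 n<m m<p)

  res : ℤ → ℕ
  res x = x ℤᵈ.%ℕ p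

  res<p : ∀ x → res x ℕ.< p
  res<p x = ℤᵈ.n%ℕd<d x p

  x≈res : ∀ x → (x - + res x) ≈0
  x≈res x = divides (x ℤᵈ./ℕ p) (trans (cong (_- + res x) (ℤᵈ.a≡a%ℕn+[a/ℕn]*n x p)) (eq (+ res x) _))
    where eq : ∀ a b → (a + b) - a ≡ b
          eq = solve-∀

  res-cong : ∀ {x y} → (x - y) ≈0 → res x ≡ res y
  res-cong {x} {y} x≈y = ≈⇒≡ (res<p x) (res<p y)
    (lin₃ x≈y (x≈res x) (x≈res y) 1ℤ (- 1ℤ) 1ℤ (eq x y (+ res x) (+ res y)))
    where eq : ∀ x y a b → a - b ≡ 1ℤ * (x - y) + - 1ℤ * (x - a) + 1ℤ * (y - b)
          eq = solve-∀

  res-injective : ∀ {x y} → res x ≡ res y → (x - y) ≈0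
  res-injective {x} {y} eq = lin₂ (x≈res x) (subst (λ r → (y - + r) ≈0) (sym eq) (x≈res y)) 1ℤ (- 1ℤ) (lem x y (+ res x))
    where lem : ∀ x y a → x - y ≡ 1ℤ * (x - a) + - 1ℤ * (y - a)
          lem = solve-∀

  inverse : ∀ x → x ≉0 → ∃[ y ] (x * y - 1ℤ) ≈0
  inverse x x≉0 = from (res x) refl
    where
    open Bézout using (+-; -+)
    from : ∀ r → r ≡ res x → ∃[ y ] (x * y - 1ℤ) ≈0
    from zero r≡ = contradiction (≈0-cong x 0ℤ (subst (λ r → (x - + r) ≈0) (sym r≡) (x≈res x)) 0≈0) x≉0
    from r@(suc _) r≡ with coprime-Bézout (prime⇒coprime p-prime (subst (ℕ._< p) (sym r≡) (res<p x)))
    ... | +- a b eq = - + b , lin₂ (subst (λ r → (x - + r) ≈0) (sym r≡) (x≈res x)) (divides 1ℤ (sym (ℤₚ.*-identityˡ _))) (- + b) (- + a) (lem x (+ r) (+ a) (+ b) (+ p) eq′)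
        where
        eq′ : 1ℤ + + b * + r ≡ + a * + p
        eq′ = trans (sym (trans (ℤₚ.pos-+ 1 (b ℕ.* r)) (cong (λ z → 1ℤ + z) (ℤₚ.pos-* b r)))) (trans (cong +_ eq) (ℤₚ.pos-* a p))
        lem′ : ∀ x r a b p → x * - b - 1ℤ ≡ - b * (x - r) + - a * p + (a * p - (1ℤ + b * r))
        lem′ = solve-∀
        lem : ∀ x r a b p → 1ℤ + b * r ≡ a * p → x * - b - 1ℤ ≡ - b * (x - r) + - a * p
        lem x r a b p e = trans (lem′ x r a b p) (trans (cong (λ z → - b * (x - r) + - a * p + (a * p - z)) e)
          (trans (cong (λ z → - b * (x - r) + - a * p + z) (ℤₚ.+-inverseʳ (a * p))) (ℤₚ.+-identityʳ _)))
    ... | -+ a b eq = + b , lin₂ (subst (λ r → (x - + r) ≈0) (sym r≡) (x≈res x)) (divides 1ℤ (sym (ℤₚ.*-identityˡ _))) (+ b) (+ a) (lem x (+ r) (+ a) (+ b) (+ p) eq′)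
        where
        eq′ : 1ℤ + + a * + p ≡ + b * + r
        eq′ = trans (sym (trans (ℤₚ.pos-+ 1 (a ℕ.* p)) (cong (λ z → 1ℤ + z) (ℤₚ.pos-* a p)))) (trans (cong +_ eq) (ℤₚ.pos-* b r))
        lem′ : ∀ x r a b p → x * b - 1ℤ ≡ b * (x - r) + a * p + (b * r - (1ℤ + a * p))
        lem′ = solve-∀
        lem : ∀ x r a b p → 1ℤ + a * p ≡ b * r → x * b - 1ℤ ≡ b * (x - r) + a * p
        lem x r a b p e = trans (lem′ x r a b p) (trans (cong (λ z → b * (x - r) + a * p + (b * r - z)) e)
          (trans (cong (λ z → b * (x - r) + a * p + z) (ℤₚ.+-inverseʳ (b * r))) (ℤₚ.+-identityʳ _)))

  -- Junk value 0 at 0.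
  reciprocal : ℤ → ℤ
  reciprocal y = by-cases (y ≈0?) (λ _ → 0ℤ) (λ y≉0 → proj₁ (inverse y y≉0))

  reciprocal-spec : ∀ y → y ≉0 → (y * reciprocal y - 1ℤ) ≈0
  reciprocal-spec y y≉0 = go (y ≈0?)
    where
    go : (d : Dec (y ≈0)) → (y * by-cases d (λ _ → 0ℤ) (λ y≉0 → proj₁ (inverse y y≉0)) - 1ℤ) ≈0
    go (yes y≈0) = contradiction y≈0 y≉0
    go (no y≉0′) = proj₂ (inverse y y≉0′)

-- Polynomials in one variable with formal derivatives.

-- Coefficient vectors, constant term first.
ev : ∀ {n} → Vec ℤ n → ℤ → ℤ
ev []      x = 0ℤ
ev (c ∷ v) x = c + x * ev v x

ev′ : ∀ {n} → Vec ℤ n → ℤ → ℤ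
ev′ []      x = 0ℤ
ev′ (c ∷ v) x = ev v x + x * ev′ v x

zeroᵥ : ∀ n → Vec ℤ n
zeroᵥ zero    = []
zeroᵥ (suc n) = 0ℤ ∷ zeroᵥ n

lincombᵥ : ∀ {n} → ℤ → ℤ → Vec ℤ n → Vec ℤ n → Vec ℤ n
lincombᵥ a b []      []      = []
lincombᵥ a b (c ∷ v) (d ∷ w) = a * c + b * d ∷ lincombᵥ a b v w

snoc0 : ∀ {n} → Vec ℤ n → Vec ℤ (suc n)
snoc0 []      = 0ℤ ∷ []
snoc0 (c ∷ v) = c ∷ snoc0 v

pad : ∀ m {n} → Vec ℤ n → Vec ℤ (m ℕ.+ n)
pad zero    v = v
pad (suc m) v = snoc0 (pad m v)

-- One slot more than the degree requires; the slack keeps the length a plain sum.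
mulᵥ : ∀ {m n} → Vec ℤ m → Vec ℤ n → Vec ℤ (m ℕ.+ n)
mulᵥ {n = n} []          w = zeroᵥ n
mulᵥ {suc m} (c ∷ v) w = lincombᵥ c 1ℤ (pad (suc m) w) (0ℤ ∷ mulᵥ v w)

derivᵥ : ∀ {n} → Vec ℤ n → Vec ℤ n
derivᵥ []      = []
derivᵥ (c ∷ v) = lincombᵥ 1ℤ 1ℤ (snoc0 v) (0ℤ ∷ derivᵥ v)

ev-zeroᵥ : ∀ n x → ev (zeroᵥ n) x ≡ 0ℤ
ev-zeroᵥ zero    x = refl
ev-zeroᵥ (suc n) x = trans (cong (λ z → 0ℤ + x * z) (ev-zeroᵥ n x)) (eq x)
  where eq : ∀ x → 0ℤ + x * 0ℤ ≡ 0ℤ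
        eq = solve-∀

ev′-zeroᵥ : ∀ n x → ev′ (zeroᵥ n) x ≡ 0ℤ
ev′-zeroᵥ zero    x = refl
ev′-zeroᵥ (suc n) x = trans (cong₂ (λ y z → y + x * z) (ev-zeroᵥ n x) (ev′-zeroᵥ n x)) (eq x)
  where eq : ∀ x → 0ℤ + x * 0ℤ ≡ 0ℤ
        eq = solve-∀

ev-lincombᵥ : ∀ {n} a b (v w : Vec ℤ n) x → ev (lincombᵥ a b v w) x ≡ a * ev v x + b * ev w x
ev-lincombᵥ a b []      []      x = eq a b
  where eq : ∀ a b → 0ℤ ≡ a * 0ℤ + b * 0ℤ
        eq = solve-∀
ev-lincombᵥ a b (c ∷ v) (d ∷ w) x =
  trans (cong (λ z → a * c + b * d + x * z) (ev-lincombᵥ a b v w x)) (eq a b c d x (ev v x) (ev w x))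
  where eq : ∀ a b c d x y z → a * c + b * d + x * (a * y + b * z) ≡ a * (c + x * y) + b * (d + x * z)
        eq = solve-∀

ev′-lincombᵥ : ∀ {n} a b (v w : Vec ℤ n) x → ev′ (lincombᵥ a b v w) x ≡ a * ev′ v x + b * ev′ w x
ev′-lincombᵥ a b []      []      x = eq a b
  where eq : ∀ a b → 0ℤ ≡ a * 0ℤ + b * 0ℤ
        eq = solve-∀
ev′-lincombᵥ a b (c ∷ v) (d ∷ w) x =
  trans (cong₂ (λ y z → y + x * z) (ev-lincombᵥ a b v w x) (ev′-lincombᵥ a b v w x))
        (eq a b (ev v x) (ev w x) x (ev′ v x) (ev′ w x))
  where eq : ∀ a b c d x y z → (a * c + b * d) + x * (a * y + b * z) ≡ a * (c + x * y) + b * (d + x * z)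
        eq = solve-∀

ev-snoc0 : ∀ {n} (v : Vec ℤ n) x → ev (snoc0 v) x ≡ ev v x
ev-snoc0 []      x = ev-zeroᵥ 1 x
ev-snoc0 (c ∷ v) x = cong (λ z → c + x * z) (ev-snoc0 v x)

ev′-snoc0 : ∀ {n} (v : Vec ℤ n) x → ev′ (snoc0 v) x ≡ ev′ v x
ev′-snoc0 []      x = ev′-zeroᵥ 1 x
ev′-snoc0 (c ∷ v) x = cong₂ (λ y z → y + x * z) (ev-snoc0 v x) (ev′-snoc0 v x)

ev-pad : ∀ m {n} (v : Vec ℤ n) x → ev (pad m v) x ≡ ev v x
ev-pad zero    v x = refl
ev-pad (suc m) v x = trans (ev-snoc0 (pad m v) x) (ev-pad m v x)

ev′-pad : ∀ m {n} (v : Vec ℤ n) x → ev′ (pad m v) x ≡ ev′ v x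
ev′-pad zero    v x = refl
ev′-pad (suc m) v x = trans (ev′-snoc0 (pad m v) x) (ev′-pad m v x)

ev-mulᵥ : ∀ {m n} (v : Vec ℤ m) (w : Vec ℤ n) x → ev (mulᵥ v w) x ≡ ev v x * ev w x
ev-mulᵥ {n = n} [] w x = ev-zeroᵥ n x
ev-mulᵥ {suc m} (c ∷ v) w x =
  trans (ev-lincombᵥ c 1ℤ (pad (suc m) w) (0ℤ ∷ mulᵥ v w) x)
  (trans (cong₂ (λ y z → c * y + 1ℤ * (0ℤ + x * z)) (ev-pad (suc m) w x) (ev-mulᵥ v w x))
         (eq c x (ev v x) (ev w x)))
  where eq : ∀ c x y z → c * z + 1ℤ * (0ℤ + x * (y * z)) ≡ (c + x * y) * z
        eq = solve-∀

ev′-mulᵥ : ∀ {m n} (v : Vec ℤ m) (w : Vec ℤ n) x → ev′ (mulᵥ v w) x ≡ ev′ v x * ev w x + ev v x * ev′ w x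
ev′-mulᵥ {n = n} [] w x = trans (ev′-zeroᵥ n x) (eq (ev w x) (ev′ w x))
  where eq : ∀ a b → 0ℤ ≡ 0ℤ * a + 0ℤ * b
        eq = solve-∀
ev′-mulᵥ {suc m} (c ∷ v) w x =
  trans (ev′-lincombᵥ c 1ℤ (pad (suc m) w) (0ℤ ∷ mulᵥ v w) x)
  (trans (cong₂ (λ y z → c * y + 1ℤ * z) (ev′-pad (suc m) w x)
           (cong₂ (λ y z → y + x * z) (ev-mulᵥ v w x) (ev′-mulᵥ v w x)))
         (eq c x (ev v x) (ev w x) (ev′ v x) (ev′ w x)))
  where eq : ∀ c x y z y′ z′ → c * z′ + 1ℤ * (y * z + x * (y′ * z + y * z′)) ≡ (y + x * y′) * z + (c + x * y) * z′
        eq = solve-∀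

ev-derivᵥ : ∀ {n} (v : Vec ℤ n) x → ev (derivᵥ v) x ≡ ev′ v x
ev-derivᵥ []      x = refl
ev-derivᵥ (c ∷ v) x =
  trans (ev-lincombᵥ 1ℤ 1ℤ (snoc0 v) (0ℤ ∷ derivᵥ v) x)
  (trans (cong₂ (λ y z → 1ℤ * y + 1ℤ * (0ℤ + x * z)) (ev-snoc0 v x) (ev-derivᵥ v x)) (eq x (ev v x) (ev′ v x)))
  where eq : ∀ x y z → 1ℤ * y + 1ℤ * (0ℤ + x * z) ≡ y + x * z
        eq = solve-∀

-- Polynomial functions with n coefficients, carried along with their formal derivative.
record Poly (n : ℕ) (u u′ : ℤ → ℤ) : Set where
  constructor poly
  field
    coeffs : Vec ℤ n
    value  : ∀ x → u x ≡ ev coeffs x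
    deriv  : ∀ x → u′ x ≡ ev′ coeffs x

open Poly

Poly-ev : ∀ {n} (v : Vec ℤ n) → Poly n (ev v) (ev′ v)
Poly-ev v = poly v (λ _ → refl) (λ _ → refl)

Poly-cong : ∀ {n u u′ w w′} → Poly n u u′ → (∀ x → w x ≡ u x) → (∀ x → w′ x ≡ u′ x) → Poly n w w′
Poly-cong P e e′ = poly (coeffs P) (λ x → trans (e x) (value P x)) (λ x → trans (e′ x) (deriv P x))

Poly-const : ∀ {n} c → Poly (suc n) (λ _ → c) (λ _ → 0ℤ)
Poly-const {n} c = poly (c ∷ zeroᵥ n)
  (λ x → sym (trans (cong (λ z → c + x * z) (ev-zeroᵥ n x)) (eq c x)))
  (λ x → sym (trans (cong₂ (λ y z → y + x * z) (ev-zeroᵥ n x) (ev′-zeroᵥ n x)) (eq 0ℤ x)))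
  where eq : ∀ c x → c + x * 0ℤ ≡ c
        eq = solve-∀

Poly-linear : ∀ a b → Poly 2 (λ x → a + x * b) (λ _ → b)
Poly-linear a b = poly (a ∷ b ∷ []) (λ x → eq a b x) (λ x → eq′ b x)
  where eq : ∀ a b x → a + x * b ≡ a + x * (b + x * 0ℤ)
        eq = solve-∀
        eq′ : ∀ b x → b ≡ (b + x * 0ℤ) + x * (0ℤ + x * 0ℤ)
        eq′ = solve-∀

Poly-lincomb : ∀ {n u u′ w w′} a b → Poly n u u′ → Poly n w w′ →
               Poly n (λ x → a * u x + b * w x) (λ x → a * u′ x + b * w′ x)
Poly-lincomb a b P Q = poly (lincombᵥ a b (coeffs P) (coeffs Q))
  (λ x → trans (cong₂ (λ y z → a * y + b * z) (value P x) (value Q x)) (sym (ev-lincombᵥ a b (coeffs P) (coeffs Q) x)))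
  (λ x → trans (cong₂ (λ y z → a * y + b * z) (deriv P x) (deriv Q x)) (sym (ev′-lincombᵥ a b (coeffs P) (coeffs Q) x)))

Poly-* : ∀ {m n u u′ w w′} → Poly m u u′ → Poly n w w′ →
         Poly (m ℕ.+ n) (λ x → u x * w x) (λ x → u′ x * w x + u x * w′ x)
Poly-* P Q = poly (mulᵥ (coeffs P) (coeffs Q))
  (λ x → trans (cong₂ _*_ (value P x) (value Q x)) (sym (ev-mulᵥ (coeffs P) (coeffs Q) x)))
  (λ x → trans (cong₂ _+_ (cong₂ _*_ (deriv P x) (value Q x)) (cong₂ _*_ (value P x) (deriv Q x)))
               (sym (ev′-mulᵥ (coeffs P) (coeffs Q) x)))

Poly-deriv : ∀ {n u u′} → Poly n u u′ → ∃[ u″ ] Poly n u′ u″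
Poly-deriv P = ev′ (derivᵥ (coeffs P)) ,
  poly (derivᵥ (coeffs P)) (λ x → trans (deriv P x) (sym (ev-derivᵥ (coeffs P) x))) (λ _ → refl)

-- Synthetic division by `x − r`: by Horner's rule the coefficients of the quotient are the values
-- at r of the tails.
quotᵥ : ∀ {n} → ℤ → Vec ℤ (suc n) → Vec ℤ n
quotᵥ r (c ∷ [])        = []
quotᵥ r (c ∷ v@(_ ∷ _)) = ev v r ∷ quotᵥ r v

ev-quotᵥ : ∀ {n} r (v : Vec ℤ (suc n)) x → ev v x ≡ (x - r) * ev (quotᵥ r v) x + ev v r
ev-quotᵥ r (c ∷ [])        x = eq c x r
  where eq : ∀ c x r → c + x * 0ℤ ≡ (x - r) * 0ℤ + (c + r * 0ℤ)
        eq = solve-∀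
ev-quotᵥ r (c ∷ v@(_ ∷ _)) x =
  trans (cong (λ z → c + x * z) (ev-quotᵥ r v x)) (eq c x r (ev (quotᵥ r v) x) (ev v r))
  where eq : ∀ c x r q s → c + x * ((x - r) * q + s) ≡ (x - r) * (s + x * q) + (c + r * s)
        eq = solve-∀

ev′-quotᵥ : ∀ {n} r (v : Vec ℤ (suc n)) x →
            ev′ v x ≡ ev (quotᵥ r v) x + (x - r) * ev′ (quotᵥ r v) x
ev′-quotᵥ r (c ∷ [])        x = eq x r
  where eq : ∀ x r → 0ℤ + x * 0ℤ ≡ 0ℤ + (x - r) * 0ℤ
        eq = solve-∀
ev′-quotᵥ r (c ∷ v@(_ ∷ _)) x =
  trans (cong₂ (λ y z → y + x * z) (ev-quotᵥ r v x) (ev′-quotᵥ r v x))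
        (eq x r (ev (quotᵥ r v) x) (ev v r) (ev′ (quotᵥ r v) x))
  where eq : ∀ x r q s q′ → ((x - r) * q + s) + x * (q + (x - r) * q′) ≡ (s + x * q) + (x - r) * (q + x * q′)
        eq = solve-∀

-- Root counting and Wronskians in characteristic p.

module Roots (p : ℕ) (p-prime : Prime p) where
  open Modular p p-prime

  data All≈0 : ∀ {n} → Vec ℤ n → Set where
    []  : All≈0 []
    _∷_ : ∀ {n c} {v : Vec ℤ n} → c ≈0 → All≈0 v → All≈0 (c ∷ v)

  Incongruent : List ℤ → Set
  Incongruent = AllPairs (λ x y → (y - x) ≉0)

  All≈0⇒ev≈0 : ∀ {n} {v : Vec ℤ n} → All≈0 v → ∀ x → ev v x ≈0
  All≈0⇒ev≈0 []       x = 0≈0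
  All≈0⇒ev≈0 (_∷_ {c = c} {v} c≈0 vs) x = lin₂ c≈0 (All≈0⇒ev≈0 vs x) 1ℤ x (eq c x (ev v x))
    where eq : ∀ c x y → c + x * y ≡ 1ℤ * c + x * y
          eq = solve-∀

  All≈0⇒ev′≈0 : ∀ {n} {v : Vec ℤ n} → All≈0 v → ∀ x → ev′ v x ≈0
  All≈0⇒ev′≈0 []       x = 0≈0
  All≈0⇒ev′≈0 (_∷_ {v = v} c≈0 vs) x = lin₂ (All≈0⇒ev≈0 vs x) (All≈0⇒ev′≈0 vs x) 1ℤ x (eq x (ev v x) (ev′ v x))
    where eq : ∀ x y z → y + x * z ≡ 1ℤ * y + x * z
          eq = solve-∀

  quotᵥ-All≈0 : ∀ {n} r (v : Vec ℤ (suc n)) → All≈0 (quotᵥ r v) → ev v r ≈0 → All≈0 v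
  quotᵥ-All≈0 r (c ∷ [])        []       c≈0 = lin₁ c≈0 1ℤ (eq c r) ∷ []
    where eq : ∀ c r → c ≡ 1ℤ * (c + r * 0ℤ)
          eq = solve-∀
  quotᵥ-All≈0 r (c ∷ v@(_ ∷ _)) (q ∷ qs) c≈0 = lin₂ c≈0 q 1ℤ (- r) (eq c r (ev v r)) ∷ quotᵥ-All≈0 r v qs q
    where eq : ∀ c r y → c ≡ 1ℤ * (c + r * y) + - r * y
          eq = solve-∀

  roots⇒All≈0 : ∀ {n} (v : Vec ℤ n) {xs} → n ℕ.≤ length xs → Incongruent xs → All (λ x → ev v x ≈0) xs → All≈0 v
  roots⇒All≈0 {zero}  []  _ _ _ = []
  roots⇒All≈0 {suc n} v {r ∷ xs} (s≤s n≤) (r# ∷ xs#) (vr ∷ vxs) =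
    quotᵥ-All≈0 r v (roots⇒All≈0 (quotᵥ r v) n≤ xs# (All.zipWith divide (r# , vxs))) vr
    where
    eq : ∀ x r q e → (x - r) * q ≡ 1ℤ * ((x - r) * q + e) + - 1ℤ * e
    eq = solve-∀
    divide : ∀ {x} → (x - r) ≉0 × ev v x ≈0 → ev (quotᵥ r v) x ≈0
    divide {x} (x≠r , vx) = cancelˡ (x - r) x≠r
      (lin₂ (subst _≈0 (ev-quotᵥ r v x) vx) vr 1ℤ (- 1ℤ) (eq x r (ev (quotᵥ r v) x) (ev v r)))

  module _ {n u u′} (P : Poly n u u′) {xs} (n≤ : n ℕ.≤ length xs) (xs# : Incongruent xs)
           (u≈0 : All (λ x → u x ≈0) xs) where

    private
      cs≈0 : All≈0 (coeffs P)
      cs≈0 = roots⇒All≈0 (coeffs P) n≤ xs# (All.map (λ {x} → subst _≈0 (value P x)) u≈0)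

    roots⇒value≈0 : ∀ x → u x ≈0
    roots⇒value≈0 x = subst _≈0 (sym (value P x)) (All≈0⇒ev≈0 cs≈0 x)

    roots⇒deriv≈0 : ∀ x → u′ x ≈0
    roots⇒deriv≈0 x = subst _≈0 (sym (deriv P x)) (All≈0⇒ev′≈0 cs≈0 x)

  others : ℤ → List ℤ
  others r = applyUpTo (λ i → r + + suc i) (ℕ.pred p)

  length-others : ∀ r → length (others r) ≡ ℕ.pred p
  length-others r = Listₚ.length-applyUpTo (λ i → r + + suc i) (ℕ.pred p)

  private
    suc<p : ∀ {i} → i ℕ.< ℕ.pred p → suc i ℕ.< p
    suc<p {i} i< = subst (suc i ℕ.<_) (ℕₚ.suc-pred p ⦃ prime⇒nonZero p-prime ⦄) (s≤s i<)

  others# : ∀ r → Incongruent (others r)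
  others# r = AllPairsₚ.applyUpTo⁺₁ _ _ λ {i} {j} i<j j< →
    subst _≉0 (eq r (+ suc i) (+ suc j)) (ordered≉0 (s≤s i<j) (suc<p j<))
    where eq : ∀ r x y → y - x ≡ (r + y) - (r + x)
          eq = solve-∀

  others≢ : ∀ r → All (λ x → (x - r) ≉0) (others r)
  others≢ r = Allₚ.applyUpTo⁺₁ _ _ λ {i} i< → subst _≉0 (eq r (+ suc i)) (small≉0 (s≤s z≤n) (suc<p i<))
    where eq : ∀ r x → x ≡ (r + x) - r
          eq = solve-∀

  -- c counts the factors x − r already divided out of K; the order of vanishing cannot reach p, so W forces K = 0.
  wronskian-vanishes : ∀ {n m M M′} (K : Vec ℤ n) → Poly m M M′ → ∀ c r → M r ≉0 → 1 ℕ.≤ c →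
    c ℕ.+ n ℕ.≤ p → n ℕ.+ m ℕ.+ 2 ℕ.< p →
    (∀ x → (+ c * (ev K x * M x) + (x - r) * (ev′ K x * M x - ev K x * M′ x)) ≈0) → All≈0 K
  wronskian-vanishes [] _ _ _ _ _ _ _ _ = []
  wronskian-vanishes {suc n} {m} {M} {M′} K PM c r Mr 1≤c c+n≤p size W =
    quotᵥ-All≈0 r K (wronskian-vanishes Q PM (suc c) r Mr (s≤s z≤n) (subst (ℕ._≤ p) (ℕₚ.+-suc c n) c+n≤p)
      (ℕₚ.<-trans (ℕₚ.+-monoˡ-< 2 (ℕₚ.+-monoˡ-< m ℕₚ.≤-refl)) size) B≈0) Kr
    where
    Q = quotᵥ r K
    c<p : c ℕ.< p
    c<p = ℕₚ.<-≤-trans (ℕₚ.m<m+n c (s≤s z≤n)) c+n≤p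
    eqr : ∀ c k m k′ m′ r → c * (k * m) ≡ 1ℤ * (c * (k * m) + (r - r) * (k′ * m - k * m′))
    eqr = solve-∀
    Kr : ev K r ≈0
    Kr = [ (λ c≈0 → contradiction c≈0 (small≉0 1≤c c<p)) , (λ KM → [ id , (λ m → contradiction m Mr) ]′ (*≈0⇒⊎ (ev K r) (M r) KM)) ]′
      (*≈0⇒⊎ (+ c) (ev K r * M r) (lin₁ (W r) 1ℤ (eqr (+ c) (ev K r) (M r) (ev′ K r) (M′ r) r)))
    B : ℤ → ℤ
    B x = + suc c * (ev Q x * M x) + (x - r) * (ev′ Q x * M x - ev Q x * M′ x)
    Q″ = derivᵥ Q
    M″ = Poly-deriv PM
    BPoly : Poly (2 ℕ.+ (n ℕ.+ m)) B _
    BPoly = Poly-cong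
      (Poly-lincomb (+ suc c) 1ℤ (Poly-* (Poly-linear 1ℤ 0ℤ) (Poly-* (Poly-ev Q) PM))
        (Poly-* (Poly-linear (- r) 1ℤ)
          (Poly-lincomb 1ℤ (- 1ℤ) (Poly-* (Poly-cong (Poly-ev Q″) (λ x → sym (ev-derivᵥ Q x)) (λ _ → refl)) PM)
                                  (Poly-* (Poly-ev Q) (proj₂ M″)))))
      (λ x → eq x r (+ suc c) (ev Q x) (M x) (ev′ Q x) (M′ x)) (λ _ → refl)
      where eq : ∀ x r c q m q′ m′ → c * (q * m) + (x - r) * (q′ * m - q * m′) ≡
                   c * ((1ℤ + x * 0ℤ) * (q * m)) + 1ℤ * ((- r + x * 1ℤ) * (1ℤ * (q′ * m) + - 1ℤ * (q * m′)))
            eq = solve-∀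
    -- `W` is `(x − r) B` up to a multiple of `ev K r`, so `B` vanishes away from r. Root counting
    -- over the p - 1 other residues then yields its vanishing at r as well.
    away : ∀ {x} → (x - r) ≉0 → B x ≈0
    away {x} x≠r = cancelˡ (x - r) x≠r
      (lin₂ (subst _≈0 (cong₂ (λ k k′ → + c * (k * M x) + (x - r) * (k′ * M x - k * M′ x)) (ev-quotᵥ r K x) (ev′-quotᵥ r K x)) (W x)) Kr 1ℤ (- (+ c * M x) + (x - r) * M′ x) (eq x r (+ c) (ev Q x) (M x) (ev′ Q x) (M′ x) (ev K r)))
      where eq : ∀ x r c q m q′ m′ e → (x - r) * ((1ℤ + c) * (q * m) + (x - r) * (q′ * m - q * m′)) ≡
                   1ℤ * (c * (((x - r) * q + e) * m) + (x - r) * ((q + (x - r) * q′) * m - ((x - r) * q + e) * m′)) + (- (c * m) + (x - r) * m′) * e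
            eq = solve-∀
    B≈0 : ∀ x → B x ≈0
    B≈0 = roots⇒value≈0 BPoly {others r}
      (subst (2 ℕ.+ (n ℕ.+ m) ℕ.≤_) (sym (length-others r))
        (ℕₚ.<⇒≤pred (ℕₚ.<-trans (ℕₚ.≤-reflexive (cong suc (ℕₚ.+-comm 2 (n ℕ.+ m)))) size)))
      (others# r) (All.map away (others≢ r))

-- Polynomials in three variables and their partial derivatives.

data Axis : Set where
  X Y Z : Axis

Point : Set
Point = Axis → ℤ

⟨_,_,_⟩ : ℤ → ℤ → ℤ → Point
⟨ a , b , c ⟩ X = a
⟨ a , b , c ⟩ Y = b
⟨ a , b , c ⟩ Z = c

Σ₃ : (Axis → ℤ) → ℤ
Σ₃ f = f X + f Y + f Z

Σ₃-cong : ∀ {f g} → (∀ i → f i ≡ g i) → Σ₃ f ≡ Σ₃ g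
Σ₃-cong e = cong₂ _+_ (cong₂ _+_ (e X) (e Y)) (e Z)

-- Tri n: polynomials of degree < n in three variables; node c f stands for c + x·f X + y·f Y + z·f Z.
data Tri : ℕ → Set where
  O    : Tri 0
  node : ∀ {n} → ℤ → (Axis → Tri n) → Tri (suc n)

eval : ∀ {n} → Tri n → Point → ℤ
eval O          v = 0ℤ
eval (node c f) v = c + Σ₃ (λ i → v i * eval (f i) v)

lc : ∀ {n} → ℤ → ℤ → Tri n → Tri n → Tri n
lc a b O          O          = O
lc a b (node c f) (node d g) = node (a * c + b * d) (λ i → lc a b (f i) (g i))

zeroₜ : ∀ n → Tri n
zeroₜ zero    = O
zeroₜ (suc n) = node 0ℤ (λ _ → zeroₜ n)

up : ∀ {n} → Tri n → Tri (suc n)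
up O          = node 0ℤ (λ _ → O)
up (node c f) = node c (λ i → up (f i))

δ : Axis → ∀ {n} → Tri (suc n) → Tri n
δ i {zero}  (node c f) = O
δ i {suc n} (node c f) = lc 1ℤ 1ℤ (f i) (node 0ℤ (λ j → δ i (f j)))

-- Padded back to the type of the argument, so that derivatives of all orders can be combined
-- linearly. The true drop in degree stays visible in `δ`.
∂ : Axis → ∀ {n} → Tri n → Tri n
∂ i {zero}  F = O
∂ i {suc n} F = up (δ i F)

∇ : ∀ {n} → Point → Tri n → Tri n
∇ u F = lc 1ℤ 1ℤ (lc (u X) (u Y) (∂ X F) (∂ Y F)) (lc (u Z) 0ℤ (∂ Z F) (∂ Z F))

infix 4 _≐_

-- Nodes contain functions, so propositional equality would require extensionality. The relation
-- compares representations, which are redundant: xy may occur below X as well as below Y.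
_≐_ : ∀ {n} → Tri n → Tri n → Set
O        ≐ O        = ⊤
node c f ≐ node d g = c ≡ d × (∀ i → f i ≐ g i)

≐-refl : ∀ {n} (F : Tri n) → F ≐ F
≐-refl O          = tt
≐-refl (node c f) = refl , λ i → ≐-refl (f i)

≐-sym : ∀ {n} {F G : Tri n} → F ≐ G → G ≐ F
≐-sym {F = O}        {O}        _       = tt
≐-sym {F = node _ _} {node _ _} (c , f) = sym c , λ i → ≐-sym (f i)

≐-trans : ∀ {n} {F G H : Tri n} → F ≐ G → G ≐ H → F ≐ H
≐-trans {F = O}        {O}        {O}        _       _       = tt
≐-trans {F = node _ _} {node _ _} {node _ _} (c , f) (d , g) = trans c d , λ i → ≐-trans (f i) (g i)

≐₀ : (F G : Tri 0) → F ≐ G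
≐₀ O O = tt

eval-≐ : ∀ {n} {F G : Tri n} → F ≐ G → ∀ v → eval F v ≡ eval G v
eval-≐ {F = O}        {O}        _       v = refl
eval-≐ {F = node _ _} {node _ _} (c , f) v = cong₂ _+_ c (Σ₃-cong λ i → cong (v i *_) (eval-≐ (f i) v))

lc-cong : ∀ {n} a b {F F′ G G′ : Tri n} → F ≐ F′ → G ≐ G′ → lc a b F G ≐ lc a b F′ G′
lc-cong a b {O}        {O}        {O}        {O}        _       _       = tt
lc-cong a b {node _ _} {node _ _} {node _ _} {node _ _} (c , f) (d , g) =
  cong₂ (λ c d → a * c + b * d) c d , λ i → lc-cong a b (f i) (g i)

up-cong : ∀ {n} {F G : Tri n} → F ≐ G → up F ≐ up G
up-cong {F = O}        {O}        _       = refl , λ _ → tt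
up-cong {F = node _ _} {node _ _} (c , f) = c , λ i → up-cong (f i)

up-lc : ∀ {n} a b (F G : Tri n) → up (lc a b F G) ≐ lc a b (up F) (up G)
up-lc a b O          O          = eq a b , λ _ → tt
  where eq : ∀ a b → 0ℤ ≡ a * 0ℤ + b * 0ℤ
        eq = solve-∀
up-lc a b (node c f) (node d g) = refl , λ i → up-lc a b (f i) (g i)

lc-interchange : ∀ {n} a b c d (F G H K : Tri n) →
                 lc a b (lc c d F G) (lc c d H K) ≐ lc c d (lc a b F H) (lc a b G K)
lc-interchange a b c d O O O O = tt
lc-interchange a b c d (node w f) (node x g) (node y h) (node z k) =
  eq a b c d w x y z , λ i → lc-interchange a b c d (f i) (g i) (h i) (k i)
  where eq : ∀ a b c d w x y z → a * (c * w + d * x) + b * (c * y + d * z) ≡ c * (a * w + b * y) + d * (a * x + b * z)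
        eq = solve-∀

lc-swap : ∀ {n} (F G H K : Tri n) → F ≐ G → H ≐ K → lc 1ℤ 1ℤ F H ≐ lc 1ℤ 1ℤ K G
lc-swap O O O O _ _ = tt
lc-swap (node _ f) (node c g) (node _ h) (node d k) (refl , e) (refl , e′) =
  eq c d , λ i → lc-swap (f i) (g i) (h i) (k i) (e i) (e′ i)
  where eq : ∀ c d → 1ℤ * c + 1ℤ * d ≡ 1ℤ * d + 1ℤ * c
        eq = solve-∀

δ-cong : ∀ i {n} {F G : Tri (suc n)} → F ≐ G → δ i F ≐ δ i G
δ-cong i {zero}  {node _ _} {node _ _} _       = tt
δ-cong i {suc n} {node _ _} {node _ _} (c , f) = lc-cong 1ℤ 1ℤ (f i) (refl , λ j → δ-cong i (f j))

δ-lc : ∀ i {n} a b (F G : Tri (suc n)) → δ i (lc a b F G) ≐ lc a b (δ i F) (δ i G)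
δ-lc i {zero}  a b (node c f) (node d g) = tt
δ-lc i {suc n} a b (node c f) (node d g) = ≐-trans
  (lc-cong 1ℤ 1ℤ (≐-refl (lc a b (f i) (g i))) (eq a b , λ j → δ-lc i a b (f j) (g j)))
  (lc-interchange 1ℤ 1ℤ a b (f i) (g i) (node 0ℤ (λ j → δ i (f j))) (node 0ℤ (λ j → δ i (g j))))
  where eq : ∀ a b → 0ℤ ≡ a * 0ℤ + b * 0ℤ
        eq = solve-∀

δ-up : ∀ i {n} (F : Tri (suc n)) → δ i (up F) ≐ up (δ i F)
δ-up i {zero}  (node c f) with f i
... | O = refl , λ _ → ≐₀ _ _
δ-up i {suc n} (node c f) = ≐-trans
  (lc-cong 1ℤ 1ℤ (≐-refl (up (f i))) (refl , λ j → δ-up i (f j)))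
  (≐-sym (up-lc 1ℤ 1ℤ (f i) (node 0ℤ (λ j → δ i (f j)))))

δ-comm : ∀ i j {n} (F : Tri (suc (suc n))) → δ i (δ j F) ≐ δ j (δ i F)
δ-comm i j {zero}  (node c f) with f i | f j
... | node _ _ | node _ _ = tt
δ-comm i j {suc n} (node c f) = ≐-trans
  (δ-lc i 1ℤ 1ℤ (f j) (node 0ℤ (λ k → δ j (f k))))
  (≐-trans (step (δ i (f j)) (δ j (f i)) (node 0ℤ (λ k → δ i (δ j (f k)))) (node 0ℤ (λ k → δ j (δ i (f k)))) (refl , λ k → δ-comm i j (f k)))
  (≐-sym (δ-lc j 1ℤ 1ℤ (f i) (node 0ℤ (λ k → δ i (f k))))))
  where
  step : ∀ {n} (A B C D : Tri n) → C ≐ D → lc 1ℤ 1ℤ A (lc 1ℤ 1ℤ B C) ≐ lc 1ℤ 1ℤ B (lc 1ℤ 1ℤ A D)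
  step O O O O _ = tt
  step (node a f) (node b g) (node c h) (node _ k) (refl , e) = eq a b c , λ i → step (f i) (g i) (h i) (k i) (e i)
    where eq : ∀ a b c → 1ℤ * a + 1ℤ * (1ℤ * b + 1ℤ * c) ≡ 1ℤ * b + 1ℤ * (1ℤ * a + 1ℤ * c)
          eq = solve-∀

∂-cong : ∀ i {n} {F G : Tri n} → F ≐ G → ∂ i F ≐ ∂ i G
∂-cong i {zero}  _ = tt
∂-cong i {suc n} e = up-cong (δ-cong i e)

∂-lc : ∀ i {n} a b (F G : Tri n) → ∂ i (lc a b F G) ≐ lc a b (∂ i F) (∂ i G)
∂-lc i {zero}  a b F G = tt
∂-lc i {suc n} a b F G = ≐-trans (up-cong (δ-lc i a b F G)) (up-lc a b (δ i F) (δ i G))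

∂-comm : ∀ i j {n} (F : Tri n) → ∂ i (∂ j F) ≐ ∂ j (∂ i F)
∂-comm i j {zero}        F = tt
∂-comm i j {suc zero}    (node c f) = refl , λ _ → tt
∂-comm i j {suc (suc n)} F = up-cong (≐-trans (δ-up i (δ j F))
  (≐-trans (up-cong (δ-comm i j F)) (≐-sym (δ-up j (δ i F)))))

eval-lc : ∀ {n} a b (F G : Tri n) v → eval (lc a b F G) v ≡ a * eval F v + b * eval G v
eval-lc a b O          O          v = eq a b
  where eq : ∀ a b → 0ℤ ≡ a * 0ℤ + b * 0ℤ
        eq = solve-∀
eval-lc a b (node c f) (node d g) v = trans
  (cong (λ s → a * c + b * d + s) (Σ₃-cong (λ i → cong (v i *_) (eval-lc a b (f i) (g i) v))))
  (eq a b c d (v X) (v Y) (v Z) (eval (f X) v) (eval (f Y) v) (eval (f Z) v) (eval (g X) v) (eval (g Y) v) (eval (g Z) v))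
  where eq : ∀ a b c d x y z f₁ f₂ f₃ g₁ g₂ g₃ →
             a * c + b * d + (x * (a * f₁ + b * g₁) + y * (a * f₂ + b * g₂) + z * (a * f₃ + b * g₃)) ≡
             a * (c + (x * f₁ + y * f₂ + z * f₃)) + b * (d + (x * g₁ + y * g₂ + z * g₃))
        eq = solve-∀

eval-up : ∀ {n} (F : Tri n) v → eval (up F) v ≡ eval F v
eval-up O          v = eq (v X) (v Y) (v Z)
  where eq : ∀ x y z → 0ℤ + (x * 0ℤ + y * 0ℤ + z * 0ℤ) ≡ 0ℤ
        eq = solve-∀
eval-up (node c f) v = cong (λ s → c + s) (Σ₃-cong λ i → cong (v i *_) (eval-up (f i) v))

eval-∂-node : ∀ i {n} c (f : Axis → Tri n) v →
              eval (∂ i (node c f)) v ≡ eval (f i) v + Σ₃ (λ j → v j * eval (∂ i (f j)) v)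
eval-∂-node i {zero}  c f v with f i
... | O = eq (v X) (v Y) (v Z)
  where eq : ∀ x y z → 0ℤ + (x * 0ℤ + y * 0ℤ + z * 0ℤ) ≡ 0ℤ + (x * 0ℤ + y * 0ℤ + z * 0ℤ)
        eq x y z = refl
eval-∂-node i {suc n} c f v = trans (eval-up (δ i (node c f)) v)
  (trans (eval-lc 1ℤ 1ℤ (f i) (node 0ℤ (λ j → δ i (f j))) v)
  (trans (cong (λ s → 1ℤ * eval (f i) v + 1ℤ * (0ℤ + s)) (Σ₃-cong λ j → cong (v j *_) (sym (eval-up (δ i (f j)) v))))
         (eq (eval (f i) v) (Σ₃ (λ j → v j * eval (∂ i (f j)) v)))))
  where eq : ∀ a s → 1ℤ * a + 1ℤ * (0ℤ + s) ≡ a + s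
        eq = solve-∀

eval-∇ : ∀ {n} u (F : Tri n) v → eval (∇ u F) v ≡ Σ₃ (λ i → u i * eval (∂ i F) v)
eval-∇ u F v = trans (eval-lc 1ℤ 1ℤ (lc (u X) (u Y) (∂ X F) (∂ Y F)) (lc (u Z) 0ℤ (∂ Z F) (∂ Z F)) v)
  (trans (cong₂ (λ a b → 1ℤ * a + 1ℤ * b) (eval-lc (u X) (u Y) (∂ X F) (∂ Y F) v) (eval-lc (u Z) 0ℤ (∂ Z F) (∂ Z F) v))
         (eq (u X) (u Y) (u Z) (eval (∂ X F) v) (eval (∂ Y F) v) (eval (∂ Z F) v)))
  where eq : ∀ x y z a b c → 1ℤ * (x * a + y * b) + 1ℤ * (z * c + 0ℤ * c) ≡ x * a + y * b + z * c
        eq = solve-∀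

∂-∇ : ∀ i {n} u (F : Tri n) → ∂ i (∇ u F) ≐ ∇ u (∂ i F)
∂-∇ i u F = ≐-trans (∂-lc i 1ℤ 1ℤ _ _) (lc-cong 1ℤ 1ℤ
  (≐-trans (∂-lc i (u X) (u Y) _ _) (lc-cong (u X) (u Y) (∂-comm i X F) (∂-comm i Y F)))
  (≐-trans (∂-lc i (u Z) 0ℤ _ _) (lc-cong (u Z) 0ℤ (∂-comm i Z F) (∂-comm i Z F))))

eval-∇∇ : ∀ {n} u w (F : Tri n) v → eval (∇ u (∇ w F)) v ≡ Σ₃ (λ i → u i * Σ₃ (λ j → w j * eval (∂ j (∂ i F)) v))
eval-∇∇ u w F v = trans (eval-∇ u (∇ w F) v)
  (Σ₃-cong λ i → cong (u i *_) (trans (eval-≐ (∂-∇ i w F) v) (eval-∇ w (∂ i F) v)))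

eval-∇∇∇ : ∀ {n} u w t (F : Tri n) v → eval (∇ u (∇ w (∇ t F))) v ≡
           Σ₃ (λ i → u i * Σ₃ (λ j → w j * Σ₃ (λ k → t k * eval (∂ k (∂ j (∂ i F))) v)))
eval-∇∇∇ u w t F v = trans (eval-∇∇ u w (∇ t F) v)
  (Σ₃-cong λ i → cong (u i *_) (Σ₃-cong λ j → cong (w j *_)
    (trans (eval-≐ (≐-trans (∂-cong j (∂-∇ i t F)) (∂-∇ j t (∂ i F))) v) (eval-∇ t (∂ j (∂ i F)) v))))

Poly-restrict : ∀ {n} (F : Tri n) (v u : Point) →
  Poly n (λ x → eval F (λ i → v i + x * u i)) (λ x → eval (∇ u F) (λ i → v i + x * u i))
Poly-restrict O v u = poly [] (λ _ → refl) (λ _ → refl)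
Poly-restrict {suc n} (node c f) v u = Poly-cong
  (Poly-lincomb 1ℤ 1ℤ (Poly-const c)
    (Poly-lincomb 1ℤ 1ℤ (Poly-lincomb 1ℤ 1ℤ (times X) (times Y)) (times Z)))
  (λ x → eq (v X) (v Y) (v Z) x (u X) (u Y) (u Z) c (A X x) (A Y x) (A Z x))
  (λ x → trans (eval-∇ u (node c f) (pt x))
     (trans (Σ₃-cong λ i → cong (u i *_) (eval-∂-node i c f (pt x)))
     (trans (eq′ (v X) (v Y) (v Z) x (u X) (u Y) (u Z) (A X x) (A Y x) (A Z x)
         (B X X x) (B X Y x) (B X Z x) (B Y X x) (B Y Y x) (B Y Z x) (B Z X x) (B Z Y x) (B Z Z x))
       (cong₂ (λ p q → 1ℤ * 0ℤ + 1ℤ * (1ℤ * p + 1ℤ * q))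
         (cong₂ (λ p q → 1ℤ * p + 1ℤ * q) (dfold X x) (dfold Y x)) (dfold Z x)))))
  where
  pt : ℤ → Point
  pt x i = v i + x * u i
  A : Axis → ℤ → ℤ
  A i x = eval (f i) (pt x)
  B : Axis → Axis → ℤ → ℤ
  B i j x = eval (∂ i (f j)) (pt x)
  times : ∀ i → Poly (suc n) (λ x → v i * A i x + u i * (x * A i x)) (λ x → v i * eval (∇ u (f i)) (pt x) + u i * (A i x + x * eval (∇ u (f i)) (pt x)))
  times i = Poly-lincomb (v i) (u i)
    (poly (snoc0 (coeffs R)) (λ x → trans (value R x) (sym (ev-snoc0 (coeffs R) x)))
                             (λ x → trans (deriv R x) (sym (ev′-snoc0 (coeffs R) x))))
    (poly (0ℤ ∷ coeffs R) (λ x → trans (cong (x *_) (value R x)) (sym (ℤₚ.+-identityˡ _)))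
                          (λ x → cong₂ (λ a b → a + x * b) (value R x) (deriv R x)))
    where R = Poly-restrict (f i) v u
  dfold : ∀ j x → v j * Σ₃ (λ i → u i * B i j x) + u j * (A j x + x * Σ₃ (λ i → u i * B i j x)) ≡
                  v j * eval (∇ u (f j)) (pt x) + u j * (A j x + x * eval (∇ u (f j)) (pt x))
  dfold j x = cong (λ d → v j * d + u j * (A j x + x * d)) (sym (eval-∇ u (f j) (pt x)))
  eq : ∀ v₁ v₂ v₃ x u₁ u₂ u₃ c a₁ a₂ a₃ →
       c + ((v₁ + x * u₁) * a₁ + (v₂ + x * u₂) * a₂ + (v₃ + x * u₃) * a₃) ≡
       1ℤ * c + 1ℤ * (1ℤ * (1ℤ * (v₁ * a₁ + u₁ * (x * a₁)) + 1ℤ * (v₂ * a₂ + u₂ * (x * a₂))) + 1ℤ * (v₃ * a₃ + u₃ * (x * a₃)))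
  eq = solve-∀
  eq′ : ∀ v₁ v₂ v₃ x u₁ u₂ u₃ a₁ a₂ a₃ b₁₁ b₁₂ b₁₃ b₂₁ b₂₂ b₂₃ b₃₁ b₃₂ b₃₃ →
       u₁ * (a₁ + ((v₁ + x * u₁) * b₁₁ + (v₂ + x * u₂) * b₁₂ + (v₃ + x * u₃) * b₁₃)) +
       u₂ * (a₂ + ((v₁ + x * u₁) * b₂₁ + (v₂ + x * u₂) * b₂₂ + (v₃ + x * u₃) * b₂₃)) +
       u₃ * (a₃ + ((v₁ + x * u₁) * b₃₁ + (v₂ + x * u₂) * b₃₂ + (v₃ + x * u₃) * b₃₃)) ≡
       1ℤ * 0ℤ + 1ℤ * (1ℤ * (1ℤ * (v₁ * (u₁ * b₁₁ + u₂ * b₂₁ + u₃ * b₃₁) + u₁ * (a₁ + x * (u₁ * b₁₁ + u₂ * b₂₁ + u₃ * b₃₁))) +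
                             1ℤ * (v₂ * (u₁ * b₁₂ + u₂ * b₂₂ + u₃ * b₃₂) + u₂ * (a₂ + x * (u₁ * b₁₂ + u₂ * b₂₂ + u₃ * b₃₂)))) +
                       1ℤ * (v₃ * (u₁ * b₁₃ + u₂ * b₂₃ + u₃ * b₃₃) + u₃ * (a₃ + x * (u₁ * b₁₃ + u₂ * b₂₃ + u₃ * b₃₃))))
  eq′ = solve-∀

-- Interpolation: a nonzero polynomial vanishing at given points.

AllPairs-∈ : ∀ {A : Set} {R S : A → A → Set} {xs} → AllPairs R xs → (∀ {x y} → x ∈ xs → y ∈ xs → R x y → S x y) → AllPairs S xs
AllPairs-∈ []         f = []
AllPairs-∈ (Rx ∷ Rxs) f = All.tabulate (λ y∈ → f (here refl) (there y∈) (All.lookup Rx y∈)) ∷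
  AllPairs-∈ Rxs (λ x∈ y∈ → f (there x∈) (there y∈))

AllPairs-cartesianProduct : ∀ {A B : Set} {R : A → A → Set} {S : B → B → Set} {xs ys} →
  AllPairs R xs → AllPairs S ys →
  AllPairs (λ u v → R (proj₁ u) (proj₁ v) ⊎ (proj₁ u ≡ proj₁ v × S (proj₂ u) (proj₂ v))) (cartesianProduct xs ys)
AllPairs-cartesianProduct [] _ = []
AllPairs-cartesianProduct {xs = x ∷ xs} {ys} (Rx ∷ Rxs) Sys = AllPairsₚ.++⁺
  (AllPairsₚ.map⁺ (AllPairs.map (λ s → inj₂ (refl , s)) Sys))
  (AllPairs-cartesianProduct Rxs Sys)
  (Allₚ.map⁺ (All.tabulate λ _ → All.tabulate λ z∈ → inj₁ (All.lookup Rx (proj₁ (∈ₚ.∈-cartesianProduct⁻ xs ys z∈)))))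

length-cartesianProduct : ∀ {A B : Set} (xs : List A) (ys : List B) →
  length (cartesianProduct xs ys) ≡ length xs ℕ.* length ys
length-cartesianProduct []       ys = refl
length-cartesianProduct (x ∷ xs) ys = trans (Listₚ.length-++ (map (x ,_) ys))
  (cong₂ ℕ._+_ (Listₚ.length-map _ ys) (length-cartesianProduct xs ys))

only : Axis → ∀ {n} → Tri n → Axis → Tri n
only X F X = F
only Y F Y = F
only Z F Z = F
only _ {n} _ _ = zeroₜ n

times : Axis → ℤ → ∀ {n} → Tri n → Tri (suc n)
times i a F = lc 1ℤ (- a) (node 0ℤ (only i F)) (up F)

eval-zeroₜ : ∀ n v → eval (zeroₜ n) v ≡ 0ℤ
eval-zeroₜ zero    v = refl
eval-zeroₜ (suc n) v = trans (cong (λ s → 0ℤ + s) (Σ₃-cong λ i → cong (v i *_) (eval-zeroₜ n v))) (eq (v X) (v Y) (v Z))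
  where eq : ∀ x y z → 0ℤ + (x * 0ℤ + y * 0ℤ + z * 0ℤ) ≡ 0ℤ
        eq = solve-∀

eval-times : ∀ i a {n} (F : Tri n) v → eval (times i a F) v ≡ (v i - a) * eval F v
eval-times i a {n} F v = trans (eval-lc 1ℤ (- a) (node 0ℤ (only i F)) (up F) v) (trans (cong₂ (λ s t → 1ℤ * s + - a * t) (left i) (eval-up F v)) (eq (v i) a (eval F v)))
  where
  eq : ∀ x a f → 1ℤ * (x * f) + - a * f ≡ (x - a) * f
  eq = solve-∀
  z = eval-zeroₜ n v
  eqX : ∀ x y z f → 0ℤ + (x * f + y * 0ℤ + z * 0ℤ) ≡ x * f
  eqX = solve-∀
  eqY : ∀ x y z f → 0ℤ + (x * 0ℤ + y * f + z * 0ℤ) ≡ y * f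
  eqY = solve-∀
  eqZ : ∀ x y z f → 0ℤ + (x * 0ℤ + y * 0ℤ + z * f) ≡ z * f
  eqZ = solve-∀
  left : ∀ i → eval (node 0ℤ (only i F)) v ≡ v i * eval F v
  left X = trans (cong₂ (λ s t → 0ℤ + (v X * eval F v + v Y * s + v Z * t)) z z) (eqX (v X) (v Y) (v Z) (eval F v))
  left Y = trans (cong₂ (λ s t → 0ℤ + (v X * s + v Y * eval F v + v Z * t)) z z) (eqY (v X) (v Y) (v Z) (eval F v))
  left Z = trans (cong₂ (λ s t → 0ℤ + (v X * s + v Y * t + v Z * eval F v)) z z) (eqZ (v X) (v Y) (v Z) (eval F v))

-- The Newton polynomial with roots 0, 1, ... below the minimum of m and i. The bound m is separate
-- from i so that all members of the basis get one type.
falling : ℕ → ℕ → ℤ → ℤ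
falling zero    i x = 1ℤ
falling (suc m) i x with m ℕ.<? i
... | yes _ = (x - + m) * falling m i x
... | no  _ = falling m i x

newton : Axis → ∀ m → ℕ → ∀ {n} → Tri n → Tri (m ℕ.+ n)
newton ax zero    i F = F
newton ax (suc m) i F with m ℕ.<? i
... | yes _ = times ax (+ m) (newton ax m i F)
... | no  _ = up (newton ax m i F)

eval-newton : ∀ ax m i {n} (F : Tri n) v → eval (newton ax m i F) v ≡ falling m i (v ax) * eval F v
eval-newton ax zero    i F v = sym (ℤₚ.*-identityˡ _)
eval-newton ax (suc m) i F v with m ℕ.<? i
... | yes _ = trans (eval-times ax (+ m) (newton ax m i F) v)
  (trans (cong ((v ax - + m) *_) (eval-newton ax m i F v)) (sym (ℤₚ.*-assoc (v ax - + m) _ _)))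
... | no  _ = trans (eval-up (newton ax m i F) v) (eval-newton ax m i F v)

module Vanishing (p : ℕ) (p-prime : Prime p) where
  open Modular p p-prime

  falling≈0 : ∀ m {i} j → j ℕ.< m → j ℕ.< i → falling m i (+ j) ≈0
  falling≈0 (suc m) {i} j j<m j<i with m ℕ.<? i | ℕₚ.m≤n⇒m<n∨m≡n (ℕₚ.≤-pred j<m)
  ... | yes _ | inj₁ j<m′ = ∣n⇒∣m*n (+ j - + m) (falling≈0 m j j<m′ j<i)
  ... | yes _ | inj₂ refl = ∣m⇒∣m*n _ (≡0⇒≈0 (ℤₚ.+-inverseʳ (+ j)))
  ... | no  _ | inj₁ j<m′ = falling≈0 m j j<m′ j<i
  ... | no m≮i | inj₂ refl = contradiction j<i m≮i

  falling≉0 : ∀ m {i} → i ℕ.< p → falling m i (+ i) ≉0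
  falling≉0 zero    _ = 1≉0
  falling≉0 (suc m) {i} i<p with m ℕ.<? i
  ... | yes m<i = *≉0 (ordered≉0 m<i i<p) (falling≉0 m i<p)
  ... | no  _   = falling≉0 m i<p

  lincomb≈0 : ∀ {n} a b (F G : Tri n) R → eval F R ≈0 → eval G R ≈0 → eval (lc a b F G) R ≈0
  lincomb≈0 a b F G R f g = lin₂ f g a b (eval-lc a b F G R)

  module _ {n : ℕ} where

    private
      Entry : Set
      Entry = Tri n × Point

    _kills_ : Entry → Point → Set
    (f , _) kills Q = eval f Q ≈0

    -- Linear independence witnessed by evaluation: every polynomial is nonzero at its own point and
    -- vanishes at the points of the entries before it.
    Triangular : List Entry → Set
    Triangular L = All (λ e → ¬ e kills proj₂ e) L × AllPairs (λ d e → e kills proj₂ d) L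

    -- Eliminating with the last entry not killing Q keeps the earlier points killed.
    record Eliminated (L : List Entry) (Q : Point) : Set where
      field
        pivot      : Tri n
        pivot≉0    : eval pivot Q ≉0
        rest       : List Entry
        size       : length L ≡ suc (length rest)
        triangular : Triangular rest
        rest-kills : All (_kills Q) rest
        closed     : ∀ R → All (_kills R) L → eval pivot R ≈0 × All (_kills R) rest

    eliminate : ∀ L Q → Triangular L → All (_kills Q) L ⊎ Eliminated L Q
    eliminate [] Q _ = inj₁ []
    eliminate ((f , P) ∷ L) Q (fP ∷ diag , upper ∷ uppers) with eliminate L Q (diag , uppers)
    ... | inj₁ LQ with eval f Q ≈0?
    ...   | yes fQ = inj₁ (fQ ∷ LQ)
    ...   | no  fQ = inj₂ record
            { pivot = f ; pivot≉0 = fQ ; rest = L ; size = refl ; triangular = diag , uppers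
            ; rest-kills = LQ ; closed = λ { R (a ∷ b) → a , b } }
    eliminate ((f , P) ∷ L) Q (fP ∷ diag , upper ∷ uppers) | inj₂ E = inj₂ record
      { pivot = g ; pivot≉0 = E.pivot≉0 ; rest = (f₁ , P) ∷ E.rest ; size = cong suc E.size
      ; triangular = f₁P ∷ proj₁ E.triangular , proj₂ (E.closed P upper) ∷ proj₂ E.triangular
      ; rest-kills = ≡0⇒≈0 (trans (eval-lc gQ (- fQ) f g Q) (eq fQ gQ)) ∷ E.rest-kills
      ; closed = λ { R (a ∷ b) → proj₁ (E.closed R b) , lincomb≈0 gQ (- fQ) f g R a (proj₁ (E.closed R b)) ∷ proj₂ (E.closed R b) } }
      where
      module E = Eliminated E
      g  = E.pivot
      gQ = eval g Q
      fQ = eval f Q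
      f₁ = lc gQ (- fQ) f g
      eq : ∀ x y → y * x + - x * y ≡ 0ℤ
      eq = solve-∀
      eq′ : ∀ a b c d → a * c ≡ 1ℤ * (a * c + - b * d) + b * d
      eq′ = solve-∀
      f₁P : eval f₁ P ≉0
      f₁P h = *≉0 E.pivot≉0 fP (lin₂ (subst _≈0 (eval-lc gQ (- fQ) f g P) h) (proj₁ (E.closed P upper)) 1ℤ fQ (eq′ gQ fQ (eval f P) (eval g P)))

    -- Each point costs at most one entry, so with fewer points than entries something is left. The
    -- last component replaces the statement that the result is a combination of `L`: it is what
    -- carries the points already treated through the recursion.
    annihilator : ∀ Qs L → Triangular L → length Qs ℕ.< length L →
      Σ (Tri n × Point) λ (F , P) → eval F P ≉0 × All (λ Q → eval F Q ≈0) Qs × (∀ R → All (_kills R) L → eval F R ≈0)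
    annihilator [] ((f , P) ∷ L) (fP ∷ _ , _) _ = (f , P) , fP , [] , λ { R (a ∷ _) → a }
    annihilator (Q ∷ Qs) L tri lt with eliminate L Q tri
    ... | inj₁ LQ with annihilator Qs L tri (ℕₚ.<-trans (ℕₚ.n<1+n _) lt)
    ...   | FP , a , b , c = FP , a , c Q LQ ∷ b , c
    annihilator (Q ∷ Qs) L tri lt | inj₂ E
      with annihilator Qs (Eliminated.rest E) (Eliminated.triangular E)
             (ℕₚ.≤-pred (subst (suc (length Qs) ℕ.<_) (Eliminated.size E) lt))
    ... | FP , a , b , c = FP , a , c Q (Eliminated.rest-kills E) ∷ b , λ R LR → c R (proj₂ (Eliminated.closed E R LR))

  newtonBasis : ∀ m → List (Tri (m ℕ.+ (m ℕ.+ (m ℕ.+ 1))) × Point)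
  newtonBasis m = map (λ (i , j , k) → newton X m i (newton Y m j (newton Z m k (node 1ℤ (λ _ → O)))) , ⟨ + i , + j , + k ⟩)
    (cartesianProduct (upTo m) (cartesianProduct (upTo m) (upTo m)))

  private
    eval-basis : ∀ m i j k v → eval (newton X m i (newton Y m j (newton Z m k (node 1ℤ (λ _ → O))))) v ≡
      falling m i (v X) * (falling m j (v Y) * falling m k (v Z))
    eval-basis m i j k v = trans (eval-newton X m i _ v) (cong (falling m i (v X) *_)
      (trans (eval-newton Y m j _ v) (cong (falling m j (v Y) *_)
        (trans (eval-newton Z m k _ v) (trans (cong (falling m k (v Z) *_) (eq (v X) (v Y) (v Z))) (ℤₚ.*-identityʳ _))))))
      where eq : ∀ x y z → 1ℤ + (x * 0ℤ + y * 0ℤ + z * 0ℤ) ≡ 1ℤ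
            eq = solve-∀

    upTo< : ∀ {m i} → i ∈ upTo m → i ℕ.< m
    upTo< = ∈ₚ.∈-upTo⁻

  -- The lattice points are listed lexicographically. At the first coordinate where an earlier point
  -- is smaller, the Newton factor of the later polynomial vanishes; `m ≤ p` keeps the diagonal
  -- values nonzero.
  newtonBasis-triangular : ∀ m → m ℕ.≤ p → Triangular (newtonBasis m)
  newtonBasis-triangular m m≤p =
    Allₚ.map⁺ (All.tabulate λ {(i , j , k)} e∈ →
      let i∈ , jk∈ = ∈ₚ.∈-cartesianProduct⁻ (upTo m) _ e∈
          j∈ , k∈  = ∈ₚ.∈-cartesianProduct⁻ (upTo m) (upTo m) jk∈
      in subst _≉0 (sym (eval-basis m i j k _))
        (*≉0 (falling≉0 m (bound i∈)) (*≉0 (falling≉0 m (bound j∈)) (falling≉0 m (bound k∈))))) ,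
    AllPairsₚ.map⁺ (AllPairs-∈ lexi λ {(i , j , k)} {(i′ , j′ , k′)} e∈ _ lex →
      let i∈ , jk∈ = ∈ₚ.∈-cartesianProduct⁻ (upTo m) _ e∈
          j∈ , k∈  = ∈ₚ.∈-cartesianProduct⁻ (upTo m) (upTo m) jk∈
      in subst _≈0 (sym (eval-basis m i′ j′ k′ _)) (kill lex (upTo< i∈) (upTo< j∈) (upTo< k∈)))
    where
    bound : ∀ {i} → i ∈ upTo m → i ℕ.< p
    bound i∈ = ℕₚ.<-≤-trans (upTo< i∈) m≤p
    incr : AllPairs ℕ._<_ (upTo m)
    incr = AllPairsₚ.applyUpTo⁺₁ id m (λ i<j _ → i<j)
    lexi = AllPairs-cartesianProduct incr (AllPairs-cartesianProduct incr incr)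
    kill : ∀ {i j k i′ j′ k′} → i ℕ.< i′ ⊎ (i ≡ i′ × (j ℕ.< j′ ⊎ (j ≡ j′ × k ℕ.< k′))) → i ℕ.< m → j ℕ.< m → k ℕ.< m →
           falling m i′ (+ i) * (falling m j′ (+ j) * falling m k′ (+ k)) ≈0
    kill (inj₁ i<)                      a b c = ∣m⇒∣m*n _ (falling≈0 m _ a i<)
    kill {i′ = i′} (inj₂ (refl , inj₁ j<))        a b c = ∣n⇒∣m*n (falling m i′ _) (∣m⇒∣m*n _ (falling≈0 m _ b j<))
    kill {i′ = i′} {j′} (inj₂ (refl , inj₂ (refl , k<))) a b c = ∣n⇒∣m*n (falling m i′ _) (∣n⇒∣m*n (falling m j′ _) (falling≈0 m _ c k<))

  length-newtonBasis : ∀ m → length (newtonBasis m) ≡ m ℕ.* (m ℕ.* m)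
  length-newtonBasis m = trans (Listₚ.length-map _ (cartesianProduct (upTo m) (cartesianProduct (upTo m) (upTo m))))
    (trans (length-cartesianProduct (upTo m) (cartesianProduct (upTo m) (upTo m)))
      (cong₂ ℕ._*_ (Listₚ.length-upTo m) (trans (length-cartesianProduct (upTo m) (upTo m)) (cong₂ ℕ._*_ (Listₚ.length-upTo m) (Listₚ.length-upTo m)))))

  vanishing-polynomial : ∀ m (Qs : List Point) → m ℕ.≤ p → length Qs ℕ.< m ℕ.* (m ℕ.* m) →
    Σ (Tri (m ℕ.+ (m ℕ.+ (m ℕ.+ 1))) × Point) λ (F , P) → eval F P ≉0 × All (λ Q → eval F Q ≈0) Qs
  vanishing-polynomial m Qs m≤p lt
    with annihilator Qs (newtonBasis m) (newtonBasis-triangular m m≤p) (subst (length Qs ℕ.<_) (sym (length-newtonBasis m)) lt)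
  ... | FP , a , b , _ = FP , a , b

-- Isotropic lines and the change of slope in derivatives.

-- A line {(x, y, z) : y = βx − σ, z = βy + τ}, isotropic for the form y² − xz.
record Line : Set where
  constructor line
  field β σ τ : ℤ

open Line

direction : ℤ → Point
direction b = ⟨ 1ℤ , b , b * b ⟩

base : Line → Point
base (line β σ τ) = ⟨ 0ℤ , - σ , τ - β * σ ⟩

pt : Line → ℤ → Point
pt ℓ x i = base ℓ i + x * direction (β ℓ) i

-- 𝐃 (b + h) = 𝐃 b + h 𝐄 b + h² 𝐙 is the derivative in the isotropic direction of slope b + h.
𝐃 𝐄 : ℤ → ∀ {n} → Tri n → Tri n
𝐃 b = ∇ (direction b)
𝐄 b = ∇ ⟨ 0ℤ , 1ℤ , + 2 * b ⟩

𝐙 : ∀ {n} → Tri n → Tri n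
𝐙 = ∇ ⟨ 0ℤ , 0ℤ , 1ℤ ⟩

Bilinear : Point → Point → (xx xy xz yy yz zz : ℤ) → ℤ
Bilinear u v xx xy xz yy yz zz =
  u X * (v X * xx + v Y * xy + v Z * xz) + u Y * (v X * xy + v Y * yy + v Z * yz) + u Z * (v X * xz + v Y * yz + v Z * zz)

Trilinear : Point → Point → Point → (xxx xxy xxz xyy xyz xzz yyy yyz yzz zzz : ℤ) → ℤ
Trilinear u v w xxx xxy xxz xyy xyz xzz yyy yyz yzz zzz =
  u X * (v X * (w X * xxx + w Y * xxy + w Z * xxz) + v Y * (w X * xxy + w Y * xyy + w Z * xyz) + v Z * (w X * xxz + w Y * xyz + w Z * xzz)) +
  u Y * (v X * (w X * xxy + w Y * xyy + w Z * xyz) + v Y * (w X * xyy + w Y * yyy + w Z * yyz) + v Z * (w X * xyz + w Y * yyz + w Z * yzz)) +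
  u Z * (v X * (w X * xxz + w Y * xyz + w Z * xzz) + v Y * (w X * xyz + w Y * yyz + w Z * yzz) + v Z * (w X * xzz + w Y * yzz + w Z * zzz))

module Jet {n} (F : Tri n) (v : Point) where

  ∂₂ : Axis → Axis → ℤ
  ∂₂ i j = eval (∂ j (∂ i F)) v

  ∂₃ : Axis → Axis → Axis → ℤ
  ∂₃ i j k = eval (∂ k (∂ j (∂ i F))) v

  ∂₂-sym : ∀ i j → ∂₂ i j ≡ ∂₂ j i
  ∂₂-sym i j = eval-≐ (∂-comm j i F) v

  eval-∇∇-sym : ∀ u w → eval (∇ u (∇ w F)) v ≡ Bilinear u w (∂₂ X X) (∂₂ X Y) (∂₂ X Z) (∂₂ Y Y) (∂₂ Y Z) (∂₂ Z Z)
  eval-∇∇-sym u w = trans (eval-∇∇ u w F v) (go ∂₂ ∂₂-sym)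
    where
    go : (t : Axis → Axis → ℤ) → (∀ i j → t i j ≡ t j i) →
         Σ₃ (λ i → u i * Σ₃ (λ j → w j * t i j)) ≡ Bilinear u w (t X X) (t X Y) (t X Z) (t Y Y) (t Y Z) (t Z Z)
    go t s rewrite s Y X | s Z X | s Z Y = refl

  eval-∇∇∇-sym : ∀ u w s → eval (∇ u (∇ w (∇ s F))) v ≡
    Trilinear u w s (∂₃ X X X) (∂₃ X X Y) (∂₃ X X Z) (∂₃ X Y Y) (∂₃ X Y Z) (∂₃ X Z Z) (∂₃ Y Y Y) (∂₃ Y Y Z) (∂₃ Y Z Z) (∂₃ Z Z Z)
  eval-∇∇∇-sym u w s = trans (eval-∇∇∇ u w s F v)
    (go ∂₃ (λ i j k → eval-≐ (∂-cong k (∂-comm j i F)) v) (λ i j k → eval-≐ (∂-comm k j (∂ i F)) v))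
    where
    go : (t : Axis → Axis → Axis → ℤ) → (∀ i j k → t i j k ≡ t j i k) → (∀ i j k → t i j k ≡ t i k j) →
         Σ₃ (λ i → u i * Σ₃ (λ j → w j * Σ₃ (λ k → s k * t i j k))) ≡
         Trilinear u w s (t X X X) (t X X Y) (t X X Z) (t X Y Y) (t X Y Z) (t X Z Z) (t Y Y Y) (t Y Y Z) (t Y Z Z) (t Z Z Z)
    go t s₁₂ s₂₃
      rewrite s₁₂ Z Y X | s₂₃ Y Z X | s₂₃ Y Y X | s₁₂ Y X Y | s₁₂ Y X Z | s₁₂ Z X Y | s₂₃ X Z Y
            | s₁₂ Y X X | s₂₃ X Y X | s₁₂ Z X X | s₂₃ X Z X | s₂₃ Z Z X | s₁₂ Z X Z | s₁₂ Z Y Y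
            | s₂₃ Y Z Y | s₂₃ Z Z Y | s₁₂ Z Y Z = refl

private
  -- A triple in Church encoding: the multilinear forms below unfold to plain ring expressions in
  -- the coefficients of a symmetric tensor.
  Covector : Set
  Covector = (ℤ → ℤ → ℤ → ℤ) → ℤ

  shift₁ : ∀ b c x y z →
    let h = c - b in
    1ℤ * x + c * y + c * c * z ≡
    (1ℤ * x + b * y + b * b * z) + h * (0ℤ * x + 1ℤ * y + + 2 * b * z) + h * h * (0ℤ * x + 0ℤ * y + 1ℤ * z)
  shift₁ = solve-∀

  shift₁′ : ∀ b c x y z →
    let h = c - b in
    0ℤ * x + 1ℤ * y + + 2 * c * z ≡ (0ℤ * x + 1ℤ * y + + 2 * b * z) + + 2 * h * (0ℤ * x + 0ℤ * y + 1ℤ * z)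
  shift₁′ = solve-∀

  shift₂ : ∀ b c xx xy xz yy yz zz →
    let h = c - b
        d : ℤ → Covector
        d = λ t k → k 1ℤ t (t * t)
        e : ℤ → Covector
        e = λ t k → k 0ℤ 1ℤ (+ 2 * t)
        z : Covector
        z = λ k → k 0ℤ 0ℤ 1ℤ
        B : Covector → Covector → ℤ
        B = λ u v → u λ u₁ u₂ u₃ → v λ v₁ v₂ v₃ →
          u₁ * (v₁ * xx + v₂ * xy + v₃ * xz) + u₂ * (v₁ * xy + v₂ * yy + v₃ * yz) + u₃ * (v₁ * xz + v₂ * yz + v₃ * zz)
    in B (d c) (d c) ≡ B (d b) (d b) + h * (+ 2 * B (d b) (e b) + h * (B (e b) (e b) + + 2 * B (d b) z) + + 2 * h * h * B (e b) z + h * h * h * B z z)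
  shift₂ = solve-∀

  shift₂′ : ∀ b c xx xy xz yy yz zz →
    let h = c - b
        d : ℤ → Covector
        d = λ t k → k 1ℤ t (t * t)
        e : ℤ → Covector
        e = λ t k → k 0ℤ 1ℤ (+ 2 * t)
        z : Covector
        z = λ k → k 0ℤ 0ℤ 1ℤ
        B : Covector → Covector → ℤ
        B = λ u v → u λ u₁ u₂ u₃ → v λ v₁ v₂ v₃ →
          u₁ * (v₁ * xx + v₂ * xy + v₃ * xz) + u₂ * (v₁ * xy + v₂ * yy + v₃ * yz) + u₃ * (v₁ * xz + v₂ * yz + v₃ * zz)
    in B (d c) (d c) - h * B (d c) (e c) + h * h * B (d c) z ≡ B (d b) (d b) + h * B (d b) (e b) + h * h * B (d b) z
  shift₂′ = solve-∀

  shift₂″ : ∀ b c xx xy xz yy yz zz →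
    let h = c - b
        d : ℤ → Covector
        d = λ t k → k 1ℤ t (t * t)
        e : ℤ → Covector
        e = λ t k → k 0ℤ 1ℤ (+ 2 * t)
        z : Covector
        z = λ k → k 0ℤ 0ℤ 1ℤ
        B : Covector → Covector → ℤ
        B = λ u v → u λ u₁ u₂ u₃ → v λ v₁ v₂ v₃ →
          u₁ * (v₁ * xx + v₂ * xy + v₃ * xz) + u₂ * (v₁ * xy + v₂ * yy + v₃ * yz) + u₃ * (v₁ * xz + v₂ * yz + v₃ * zz)
    in B (d c) (e c) ≡ B (d b) (e b) + h * (B (e b) (e b) + + 2 * B (d b) z) + + 3 * h * h * B (e b) z + + 2 * h * h * h * B z z
  shift₂″ = solve-∀

  shift₃ : ∀ b c xxx xxy xxz xyy xyz xzz yyy yyz yzz zzz →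
    let h = c - b
        d : ℤ → Covector
        d = λ t k → k 1ℤ t (t * t)
        e : ℤ → Covector
        e = λ t k → k 0ℤ 1ℤ (+ 2 * t)
        z : Covector
        z = λ k → k 0ℤ 0ℤ 1ℤ
        T : Covector → Covector → Covector → ℤ
        T = λ u v w → u λ u₁ u₂ u₃ → v λ v₁ v₂ v₃ → w λ w₁ w₂ w₃ →
          (u₁ * (v₁ * (w₁ * xxx + w₂ * xxy + w₃ * xxz) + v₂ * (w₁ * xxy + w₂ * xyy + w₃ * xyz) + v₃ * (w₁ * xxz + w₂ * xyz + w₃ * xzz)) +
          u₂ * (v₁ * (w₁ * xxy + w₂ * xyy + w₃ * xyz) + v₂ * (w₁ * xyy + w₂ * yyy + w₃ * yyz) + v₃ * (w₁ * xyz + w₂ * yyz + w₃ * yzz)) +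
          u₃ * (v₁ * (w₁ * xxz + w₂ * xyz + w₃ * xzz) + v₂ * (w₁ * xyz + w₂ * yyz + w₃ * yzz) + v₃ * (w₁ * xzz + w₂ * yzz + w₃ * zzz)))
    in T (d c) (d c) (d c) - h * T (d c) (d c) (e c) + h * h * T (d c) (d c) z ≡
       T (d b) (d b) (d b) + h * (+ 2 * T (d b) (d b) (e b) + h * (T (d b) (e b) (e b) + + 2 * T (d b) (d b) z)
         + + 2 * h * h * T (d b) (e b) z + h * h * h * T (d b) z z)
  shift₃ = solve-∀

module Shift {n} (F : Tri n) (v : Point) (b c : ℤ) where
  open Jet F v

  private
    h = c - b
    d = direction
    e : ℤ → Point
    e t = ⟨ 0ℤ , 1ℤ , + 2 * t ⟩
    z : Point
    z = ⟨ 0ℤ , 0ℤ , 1ℤ ⟩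
    ∂₁ : Axis → ℤ
    ∂₁ i = eval (∂ i F) v
    s₂ : ∀ u w → eval (∇ u (∇ w F)) v ≡ Bilinear u w (∂₂ X X) (∂₂ X Y) (∂₂ X Z) (∂₂ Y Y) (∂₂ Y Z) (∂₂ Z Z)
    s₂ = eval-∇∇-sym
    s₃ = eval-∇∇∇-sym

  𝐃-shift : eval (𝐃 c F) v ≡ eval (𝐃 b F) v + h * eval (𝐄 b F) v + h * h * eval (𝐙 F) v
  𝐃-shift = transport (eval-∇ (d c) F v) (eval-∇ (d b) F v) (eval-∇ (e b) F v) (eval-∇ z F v)
    (shift₁ b c (∂₁ X) (∂₁ Y) (∂₁ Z))
    where
    transport : ∀ {w x y z w′ x′ y′ z′} → w ≡ w′ → x ≡ x′ → y ≡ y′ → z ≡ z′ →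
      w′ ≡ x′ + h * y′ + h * h * z′ → w ≡ x + h * y + h * h * z
    transport refl refl refl refl e = e

  𝐄-shift : eval (𝐄 c F) v ≡ eval (𝐄 b F) v + + 2 * h * eval (𝐙 F) v
  𝐄-shift = transport (eval-∇ (e c) F v) (eval-∇ (e b) F v) (eval-∇ z F v) (shift₁′ b c (∂₁ X) (∂₁ Y) (∂₁ Z))
    where
    transport : ∀ {w x y w′ x′ y′} → w ≡ w′ → x ≡ x′ → y ≡ y′ → w′ ≡ x′ + + 2 * h * y′ → w ≡ x + + 2 * h * y
    transport refl refl refl e = e

  𝐃𝐃-shift : eval (𝐃 c (𝐃 c F)) v ≡ eval (𝐃 b (𝐃 b F)) v + h * (+ 2 * eval (𝐃 b (𝐄 b F)) v
    + h * (eval (𝐄 b (𝐄 b F)) v + + 2 * eval (𝐃 b (𝐙 F)) v) + + 2 * h * h * eval (𝐄 b (𝐙 F)) v + h * h * h * eval (𝐙 (𝐙 F)) v)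
  𝐃𝐃-shift = transport (s₂ (d c) (d c)) (s₂ (d b) (d b)) (s₂ (d b) (e b)) (s₂ (e b) (e b)) (s₂ (d b) z) (s₂ (e b) z) (s₂ z z)
    (shift₂ b c (∂₂ X X) (∂₂ X Y) (∂₂ X Z) (∂₂ Y Y) (∂₂ Y Z) (∂₂ Z Z))
    where
    transport : ∀ {t u v w x y z t′ u′ v′ w′ x′ y′ z′} →
      t ≡ t′ → u ≡ u′ → v ≡ v′ → w ≡ w′ → x ≡ x′ → y ≡ y′ → z ≡ z′ →
      t′ ≡ u′ + h * (+ 2 * v′ + h * (w′ + + 2 * x′) + + 2 * h * h * y′ + h * h * h * z′) →
      t ≡ u + h * (+ 2 * v + h * (w + + 2 * x) + + 2 * h * h * y + h * h * h * z)
    transport refl refl refl refl refl refl refl e = e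

  -- Since `𝐃 b = 𝐃 c − h 𝐄 c + h² 𝐙`, both sides are the mixed derivative in the slopes b and c,
  -- with either factor expanded about the other slope.
  𝐃𝐃-mixed : eval (𝐃 c (𝐃 c F)) v - h * eval (𝐃 c (𝐄 c F)) v + h * h * eval (𝐃 c (𝐙 F)) v ≡
             eval (𝐃 b (𝐃 b F)) v + h * eval (𝐃 b (𝐄 b F)) v + h * h * eval (𝐃 b (𝐙 F)) v
  𝐃𝐃-mixed = transport (s₂ (d c) (d c)) (s₂ (d c) (e c)) (s₂ (d c) z) (s₂ (d b) (d b)) (s₂ (d b) (e b)) (s₂ (d b) z)
    (shift₂′ b c (∂₂ X X) (∂₂ X Y) (∂₂ X Z) (∂₂ Y Y) (∂₂ Y Z) (∂₂ Z Z))
    where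
    transport : ∀ {u v w x y z u′ v′ w′ x′ y′ z′} → u ≡ u′ → v ≡ v′ → w ≡ w′ → x ≡ x′ → y ≡ y′ → z ≡ z′ →
      u′ - h * v′ + h * h * w′ ≡ x′ + h * y′ + h * h * z′ → u - h * v + h * h * w ≡ x + h * y + h * h * z
    transport refl refl refl refl refl refl e = e

  𝐃𝐄-shift : eval (𝐃 c (𝐄 c F)) v ≡ eval (𝐃 b (𝐄 b F)) v + h * (eval (𝐄 b (𝐄 b F)) v + + 2 * eval (𝐃 b (𝐙 F)) v)
    + + 3 * h * h * eval (𝐄 b (𝐙 F)) v + + 2 * h * h * h * eval (𝐙 (𝐙 F)) v
  𝐃𝐄-shift = transport (s₂ (d c) (e c)) (s₂ (d b) (e b)) (s₂ (e b) (e b)) (s₂ (d b) z) (s₂ (e b) z) (s₂ z z)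
    (shift₂″ b c (∂₂ X X) (∂₂ X Y) (∂₂ X Z) (∂₂ Y Y) (∂₂ Y Z) (∂₂ Z Z))
    where
    transport : ∀ {u v w x y z u′ v′ w′ x′ y′ z′} → u ≡ u′ → v ≡ v′ → w ≡ w′ → x ≡ x′ → y ≡ y′ → z ≡ z′ →
      u′ ≡ v′ + h * (w′ + + 2 * x′) + + 3 * h * h * y′ + + 2 * h * h * h * z′ →
      u ≡ v + h * (w + + 2 * x) + + 3 * h * h * y + + 2 * h * h * h * z
    transport refl refl refl refl refl refl e = e

  -- Both sides are the derivative once in slope b and twice in slope c. On the left everything is
  -- differentiated along c, on the right along b, which links derivatives along two meeting lines.
  𝐃𝐃𝐃-mixed : eval (𝐃 c (𝐃 c (𝐃 c F))) v - h * eval (𝐃 c (𝐃 c (𝐄 c F))) v + h * h * eval (𝐃 c (𝐃 c (𝐙 F))) v ≡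
    eval (𝐃 b (𝐃 b (𝐃 b F))) v + h * (+ 2 * eval (𝐃 b (𝐃 b (𝐄 b F))) v
      + h * (eval (𝐃 b (𝐄 b (𝐄 b F))) v + + 2 * eval (𝐃 b (𝐃 b (𝐙 F))) v)
      + + 2 * h * h * eval (𝐃 b (𝐄 b (𝐙 F))) v + h * h * h * eval (𝐃 b (𝐙 (𝐙 F))) v)
  𝐃𝐃𝐃-mixed = transport (s₃ (d c) (d c) (d c)) (s₃ (d c) (d c) (e c)) (s₃ (d c) (d c) z) (s₃ (d b) (d b) (d b))
    (s₃ (d b) (d b) (e b)) (s₃ (d b) (e b) (e b)) (s₃ (d b) (d b) z) (s₃ (d b) (e b) z) (s₃ (d b) z z)
    (shift₃ b c (∂₃ X X X) (∂₃ X X Y) (∂₃ X X Z) (∂₃ X Y Y) (∂₃ X Y Z) (∂₃ X Z Z) (∂₃ Y Y Y) (∂₃ Y Y Z) (∂₃ Y Z Z) (∂₃ Z Z Z))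
    where
    transport : ∀ {r s t u v w x y z r′ s′ t′ u′ v′ w′ x′ y′ z′} →
      r ≡ r′ → s ≡ s′ → t ≡ t′ → u ≡ u′ → v ≡ v′ → w ≡ w′ → x ≡ x′ → y ≡ y′ → z ≡ z′ →
      r′ - h * s′ + h * h * t′ ≡ u′ + h * (+ 2 * v′ + h * (w′ + + 2 * x′) + + 2 * h * h * y′ + h * h * h * z′) →
      r - h * s + h * h * t ≡ u + h * (+ 2 * v + h * (w + + 2 * x) + + 2 * h * h * y + h * h * h * z)
    transport refl refl refl refl refl refl refl refl refl e = e

-- Elimination of the slope difference at a meeting point.

-- Hess vanishes where F has a second isotropic direction of contact of order two; Hess′ is its derivative along the line.
Hess : (f g p r q w : ℤ) → ℤ
Hess f g p r q w = (- + 2) * ((g * g) * (g * p)) + 1ℤ * (1ℤ * ((f * g) * (g * r)) + 1ℤ * ((- + 2) * ((f * f) * (g * q)) + 1ℤ * ((f * f) * (f * w))))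

Hess′ : (f g p r q w g₁ p₁ r₁ q₁ w₁ : ℤ) → ℤ
Hess′ f g p r q w g₁ p₁ r₁ q₁ w₁ =
  (- + 2) * ((g₁ * g + g * g₁) * (g * p) + (g * g) * (g₁ * p + g * p₁)) +
  1ℤ * (1ℤ * ((p * g + f * g₁) * (g * r) + (f * g) * (g₁ * r + g * r₁)) +
    1ℤ * ((- + 2) * ((p * f + f * p) * (g * q) + (f * f) * (g₁ * q + g * q₁)) +
      1ℤ * ((p * f + f * p) * (f * w) + (f * f) * (p * w + f * w₁))))

-- Equal to `−f³ (g/f)″` with the denominators cleared.
Ode : (f g f₁ g₁ f₂ g₂ : ℤ) → ℤ
Ode f g f₁ g₁ f₂ g₂ = 1ℤ * ((f₂ * g) * f) + 1ℤ * ((- 1ℤ) * ((f * g₂) * f) + (- + 2) * (1ℤ * ((f₁ * f₁) * g) + (- 1ℤ) * ((f₁ * g₁) * f)))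

module Collision (p : ℕ) (p-prime : Prime p) where
  open Modular p p-prime

  -- The value `h = −f/g` is put into the second relation, which is then multiplied by `−g³`.
  -- Written as an ideal membership, this includes the case `g ≈ 0`.
  Hess≈0 : ∀ h f g p r q w → (f + h * g) ≈0 → (+ 2 * p + h * r + + 2 * h * h * q + h * h * h * w) ≈0 →
           Hess f g p r q w ≈0
  Hess≈0 h f g p r q w R₁ R₂ = lin₂ R₁ R₂ (g * g * r - + 2 * g * q * (f - h * g) + w * (f * f - f * h * g + h * h * g * g)) (- (g * g * g))
    (eq h f g p r q w)
    where
    eq : ∀ h f g p r q w → (- + 2) * ((g * g) * (g * p)) + 1ℤ * (1ℤ * ((f * g) * (g * r)) + 1ℤ * ((- + 2) * ((f * f) * (g * q)) + 1ℤ * ((f * f) * (f * w)))) ≡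
         (g * g * r - + 2 * g * q * (f - h * g) + w * (f * f - f * h * g + h * h * g * g)) * (f + h * g)
         + - (g * g * g) * (+ 2 * p + h * r + + 2 * h * h * q + h * h * h * w)
    eq = solve-∀

  private
    F-split : ∀ F f h g → F ≡ 1ℤ * (F - (f + + 2 * h * g)) + 1ℤ * (f + h * g) + h * g
    F-split = solve-∀
    F-shift : ∀ F f h g → F - h * g ≡ 1ℤ * (F - (f + + 2 * h * g)) + 1ℤ * (f + h * g)
    F-shift = solve-∀
    isolate : ∀ a c m → a ≡ 1ℤ * (a + c * m) + - c * m
    isolate = solve-∀
    swap-last : ∀ h S R c → h * S + R * c ≡ h * S + c * R
    swap-last h S R c = cong (λ z → h * S + z) (ℤₚ.*-comm R c)

    tail≡ : ∀ h g k P′ F₁ S′ S R c → h * S ≡ - h * g * P′ + + 2 * S′ * k - R * c → F₁ ≡ S′ →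
            h * S + R * c ≡ - h * g * P′ + + 2 * F₁ * k
    tail≡ h g k P′ F₁ S′ S R c e refl = trans (cong (_+ R * c) e) (cancel (- h * g * P′ + + 2 * F₁ * k) (R * c))
      where cancel : ∀ a b → a - b + b ≡ a
            cancel = solve-∀

    Ode-split : ∀ F g F₁ G₁ F₂ G₂ → Ode F g F₁ G₁ F₂ G₂ ≡ (F₂ * F - + 2 * F₁ * F₁) * g + (- (G₂ * F) + + 2 * F₁ * G₁) * F
    Ode-split F g F₁ G₁ F₂ G₂ = eq F g F₁ G₁ F₂ G₂
      where
      eq : ∀ f g f₁ g₁ f₂ g₂ → 1ℤ * ((f₂ * g) * f) + 1ℤ * ((- 1ℤ) * ((f * g₂) * f) + (- + 2) * (1ℤ * ((f₁ * f₁) * g) + (- 1ℤ) * ((f₁ * g₁) * f)))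
           ≡ (f₂ * f - + 2 * f₁ * f₁) * g + (- (g₂ * f) + + 2 * f₁ * g₁) * f
      eq = solve-∀

    Ode-reduce : ∀ F g F₁ G₁ F₂ G₂ h k P′ → Ode F g F₁ G₁ F₂ G₂ ≡
        (F₂ * g - G₂ * (F + h * g) + + 2 * F₁ * G₁) * (F - h * g)
        + g * (h * g) * (F₂ - h * G₂ + P′) + g * (- + 2 * F₁) * (F₁ - h * G₁ + k)
        + g * (- h * g * P′ + + 2 * F₁ * k)
    Ode-reduce F g F₁ G₁ F₂ G₂ h k P′ = eq F g F₁ G₁ F₂ G₂ h k P′
      where
      eq : ∀ f g f₁ g₁ f₂ g₂ h k P′ →
        1ℤ * ((f₂ * g) * f) + 1ℤ * ((- 1ℤ) * ((f * g₂) * f) + (- + 2) * (1ℤ * ((f₁ * f₁) * g) + (- 1ℤ) * ((f₁ * g₁) * f))) ≡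
        (f₂ * g - g₂ * (f + h * g) + + 2 * f₁ * g₁) * (f - h * g)
        + g * (h * g) * (f₂ - h * g₂ + P′) + g * (- + 2 * f₁) * (f₁ - h * g₁ + k)
        + g * (- h * g * P′ + + 2 * f₁ * k)
      eq = solve-∀

    reduction : ∀ F g F₁ G₁ F₂ G₂ h k P′ T → T ≡ - h * g * P′ + + 2 * F₁ * k →
      (F - h * g) ≈0 → (F₂ - h * G₂ + P′) ≈0 → (F₁ - h * G₁ + k) ≈0 → T ≈0 → Ode F g F₁ G₁ F₂ G₂ ≈0
    reduction F g F₁ G₁ F₂ G₂ h k P′ T T≡ a b c t = lin₄ a b c (subst _≈0 T≡ t) (F₂ * g - G₂ * (F + h * g) + + 2 * F₁ * G₁) (g * (h * g)) (g * (- + 2 * F₁)) g (Ode-reduce F g F₁ G₁ F₂ G₂ h k P′)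

  module _ (h f g p r q w g₁ p₁ r₁ q₁ w₁ F F₁ F₂ G₁ G₂ : ℤ) where

    private
      -- Lower-case parameters are the jet on the line of slope b, capital ones that on the line of
      -- slope c; `g` belongs to both, as `𝐙` does not depend on the slope. `R` is the relation of
      -- second order, `P′` its derivative along the first line with h held fixed, and `S` is what
      -- remains of `Hess′` after division by `g²` modulo `f + h g`.
      s₁ s₂ s₃ s₄ S S′ R P′ : ℤ
      s₁ = + 3 * g₁ * p + g * p₁
      s₂ = p * r - + 2 * h * g₁ * r - h * g * r₁
      s₃ = - + 2 * h * p * q + h * h * g₁ * q + h * h * g * q₁
      s₄ = + 3 * h * h * p * w - h * h * h * g * w₁
      S  = - + 2 * s₁ + s₂ - + 2 * s₃ + s₄
      S′ = p + h * r + + 3 * h * h * q + + 2 * h * h * h * w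
      R  = + 2 * p + h * r + + 2 * h * h * q + h * h * h * w
      P′ = + 2 * p₁ + h * r₁ + + 2 * h * h * q₁ + h * h * h * w₁

      c₂ c₃ c₄ : ℤ
      c₂ = + 2 * g * g₁ * r + g * g * r₁
      c₃ = + 2 * p * g * q + (g₁ * q + g * q₁) * (f - h * g)
      c₄ = + 3 * p * w * (f - h * g) + w₁ * (f * f - f * h * g + h * h * g * g)

      factor : Hess′ f g p r q w g₁ p₁ r₁ q₁ w₁ ≡ (g * g) * S + (c₂ - + 2 * c₃ + c₄) * (f + h * g)
      factor = trans
        (cong₂ (λ x y → (- + 2) * x + 1ℤ * y) (eq₁ g p g₁ p₁)
          (cong₂ (λ x y → 1ℤ * x + 1ℤ * y) (eq₂ h f g p r g₁ r₁)
            (cong₂ (λ x y → (- + 2) * x + 1ℤ * y) (eq₃ h f g p q g₁ q₁) (eq₄ h f g p w w₁))))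
        (eq₅ (g * g) (f + h * g) s₁ s₂ s₃ s₄ c₂ c₃ c₄)
        where
        eq₁ : ∀ g p g₁ p₁ → (g₁ * g + g * g₁) * (g * p) + (g * g) * (g₁ * p + g * p₁) ≡ g * g * (+ 3 * g₁ * p + g * p₁)
        eq₁ = solve-∀
        eq₂ : ∀ h f g p r g₁ r₁ → (p * g + f * g₁) * (g * r) + (f * g) * (g₁ * r + g * r₁) ≡
          g * g * (p * r - + 2 * h * g₁ * r - h * g * r₁) + (+ 2 * g * g₁ * r + g * g * r₁) * (f + h * g)
        eq₂ = solve-∀
        eq₃ : ∀ h f g p q g₁ q₁ → (p * f + f * p) * (g * q) + (f * f) * (g₁ * q + g * q₁) ≡
          g * g * (- + 2 * h * p * q + h * h * g₁ * q + h * h * g * q₁) + (+ 2 * p * g * q + (g₁ * q + g * q₁) * (f - h * g)) * (f + h * g)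
        eq₃ = solve-∀
        eq₄ : ∀ h f g p w w₁ → (p * f + f * p) * (f * w) + (f * f) * (p * w + f * w₁) ≡
          g * g * (+ 3 * h * h * p * w - h * h * h * g * w₁) + (+ 3 * p * w * (f - h * g) + w₁ * (f * f - f * h * g + h * h * g * g)) * (f + h * g)
        eq₄ = solve-∀
        eq₅ : ∀ k m s₁ s₂ s₃ s₄ c₂ c₃ c₄ →
          (- + 2) * (k * s₁) + 1ℤ * (1ℤ * (k * s₂ + c₂ * m) + 1ℤ * ((- + 2) * (k * s₃ + c₃ * m) + 1ℤ * (k * s₄ + c₄ * m)))
          ≡ k * (- + 2 * s₁ + s₂ - + 2 * s₃ + s₄) + (c₂ - + 2 * c₃ + c₄) * m
        eq₅ = solve-∀

      combine : ∀ h g p r q w g₁ p₁ r₁ q₁ w₁ →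
        h * (- + 2 * (+ 3 * g₁ * p + g * p₁) + (p * r - + 2 * h * g₁ * r - h * g * r₁)
          - + 2 * (- + 2 * h * p * q + h * h * g₁ * q + h * h * g * q₁) + (+ 3 * h * h * p * w - h * h * h * g * w₁)) ≡
        - h * g * (+ 2 * p₁ + h * r₁ + + 2 * h * h * q₁ + h * h * h * w₁)
        + + 2 * (p + h * r + + 3 * h * h * q + + 2 * h * h * h * w) * (p + h * g₁)
        - (+ 2 * p + h * r + + 2 * h * h * q + h * h * h * w) * (p + + 4 * h * g₁)
      combine = solve-∀

    -- At a meeting point the jet (F, F₁, F₂, G₁, G₂) on one line is tied to the jet on the other one.
    ode-at-meeting : h ≉0 → (f + h * g) ≈0 → R ≈0 → Hess′ f g p r q w g₁ p₁ r₁ q₁ w₁ ≈0 →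
      (F - (f + + 2 * h * g)) ≈0 → F₁ ≡ S′ → (h * (F₁ - h * G₁ + (p + h * g₁))) ≈0 → (h * (F₂ - h * G₂ + P′)) ≈0 →
      Ode F g F₁ G₁ F₂ G₂ ≈0
    -- If `g ≈ 0`, then `F ≈ 0` too, and `Ode` lies in the ideal of `F` and `g`. Otherwise `H′`
    -- gives `S ≈ 0`; by `combine`, `h S` agrees modulo `R` with the remainder of `Ode` after
    -- reduction by `F ≈ h g`, `A` and `C`.
    ode-at-meeting h≉0 R₁ R₂ H′ F≈ F₁≡ A C = by-cases (g ≈0?) zero-case nonzero-case
      where
      S≈0 : g ≉0 → S ≈0
      S≈0 g≉0 = cancelˡ (g * g) (*≉0 g≉0 g≉0)
        (lin₂ (subst _≈0 factor H′) R₁ 1ℤ (- (c₂ - + 2 * c₃ + c₄)) (isolate (g * g * S) (c₂ - + 2 * c₃ + c₄) (f + h * g)))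
      zero-case : g ≈0 → Ode F g F₁ G₁ F₂ G₂ ≈0
      zero-case g≈0 = lin₂ g≈0 (lin₃ F≈ R₁ g≈0 1ℤ 1ℤ h (F-split F f h g)) (F₂ * F - + 2 * F₁ * F₁) (- (G₂ * F) + + 2 * F₁ * G₁) (Ode-split F g F₁ G₁ F₂ G₂)
      nonzero-case : g ≉0 → Ode F g F₁ G₁ F₂ G₂ ≈0
      nonzero-case g≉0 = reduction F g F₁ G₁ F₂ G₂ h (p + h * g₁) P′ (h * S + R * (p + + 4 * h * g₁))
        (tail≡ h g (p + h * g₁) P′ F₁ S′ S R (p + + 4 * h * g₁) (combine h g p r q w g₁ p₁ r₁ q₁ w₁) F₁≡)
        (lin₂ F≈ R₁ 1ℤ 1ℤ (F-shift F f h g))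
        (cancelˡ h {F₂ - h * G₂ + P′} h≉0 C) (cancelˡ h {F₁ - h * G₁ + (p + h * g₁)} h≉0 A) (lin₂ (S≈0 g≉0) R₂ h (p + + 4 * h * g₁) (swap-last h S R (p + + 4 * h * g₁)))

-- The coefficient of h² in the second derivative in slope `b + h`.
𝐑 : ℤ → ∀ {n} → Tri n → Tri n
𝐑 b F = lc 1ℤ (+ 2) (𝐄 b (𝐄 b F)) (𝐃 b (𝐙 F))

eval-𝐑 : ∀ b {n} (F : Tri n) v → eval (𝐄 b (𝐄 b F)) v + + 2 * eval (𝐃 b (𝐙 F)) v ≡ eval (𝐑 b F) v
eval-𝐑 b F v = sym (trans (eval-lc 1ℤ (+ 2) (𝐄 b (𝐄 b F)) (𝐃 b (𝐙 F)) v)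
  (cong (λ z → z + + 2 * eval (𝐃 b (𝐙 F)) v) (ℤₚ.*-identityˡ (eval (𝐄 b (𝐄 b F)) v))))

∇-lc : ∀ u {n} a b (F G : Tri n) v → eval (∇ u (lc a b F G)) v ≡ a * eval (∇ u F) v + b * eval (∇ u G) v
∇-lc u a b F G v = trans (eval-∇ u (lc a b F G) v)
  (trans (Σ₃-cong λ i → cong (u i *_) (trans (eval-≐ (∂-lc i a b F G) v) (eval-lc a b (∂ i F) (∂ i G) v)))
  (trans (eq (u X) (u Y) (u Z) a b (eval (∂ X F) v) (eval (∂ Y F) v) (eval (∂ Z F) v) (eval (∂ X G) v) (eval (∂ Y G) v) (eval (∂ Z G) v))
         (cong₂ (λ s t → a * s + b * t) (sym (eval-∇ u F v)) (sym (eval-∇ u G v)))))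
  where
  eq : ∀ x y z a b f₁ f₂ f₃ g₁ g₂ g₃ → x * (a * f₁ + b * g₁) + y * (a * f₂ + b * g₂) + z * (a * f₃ + b * g₃) ≡
       a * (x * f₁ + y * f₂ + z * f₃) + b * (x * g₁ + y * g₂ + z * g₃)
  eq = solve-∀

eval-𝐃𝐑 : ∀ b {n} (F : Tri n) v → eval (𝐃 b (𝐄 b (𝐄 b F))) v + + 2 * eval (𝐃 b (𝐃 b (𝐙 F))) v ≡ eval (𝐃 b (𝐑 b F)) v
eval-𝐃𝐑 b F v = sym (trans (∇-lc (direction b) 1ℤ (+ 2) (𝐄 b (𝐄 b F)) (𝐃 b (𝐙 F)) v)
  (cong (λ z → z + + 2 * eval (𝐃 b (𝐃 b (𝐙 F))) v) (ℤₚ.*-identityˡ (eval (𝐃 b (𝐄 b (𝐄 b F))) v))))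

-- The bracketing and the factors `1ℤ` in `Hess` and `Hess′` are those produced by `Poly-lincomb`
-- and `Poly-*`, so value and derivative agree by definition.
Poly-Hess : ∀ {n f g p r q w g₁ p₁ r₁ q₁ w₁} → Poly n f p → Poly n g g₁ → Poly n p p₁ → Poly n r r₁ → Poly n q q₁ → Poly n w w₁ →
  Poly (n ℕ.+ n ℕ.+ (n ℕ.+ n)) (λ x → Hess (f x) (g x) (p x) (r x) (q x) (w x))
    (λ x → Hess′ (f x) (g x) (p x) (r x) (q x) (w x) (g₁ x) (p₁ x) (r₁ x) (q₁ x) (w₁ x))
Poly-Hess f g p r q w = Poly-lincomb (- + 2) 1ℤ (Poly-* (Poly-* g g) (Poly-* g p))
  (Poly-lincomb 1ℤ 1ℤ (Poly-* (Poly-* f g) (Poly-* g r))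
    (Poly-lincomb (- + 2) 1ℤ (Poly-* (Poly-* f f) (Poly-* g q)) (Poly-* (Poly-* f f) (Poly-* f w))))

Poly-Ode : ∀ {n f g f₁ g₁ f₂ g₂ f₃ g₃} → Poly n f f₁ → Poly n g g₁ → Poly n f₁ f₂ → Poly n g₁ g₂ → Poly n f₂ f₃ → Poly n g₂ g₃ →
  ∃[ u′ ] Poly (n ℕ.+ n ℕ.+ n) (λ x → Ode (f x) (g x) (f₁ x) (g₁ x) (f₂ x) (g₂ x)) u′
Poly-Ode f g f₁ g₁ f₂ g₂ = _ , Poly-lincomb 1ℤ 1ℤ (Poly-* (Poly-* f₂ g) f)
  (Poly-lincomb (- 1ℤ) (- + 2) (Poly-* (Poly-* f g₂) f)
    (Poly-lincomb 1ℤ (- 1ℤ) (Poly-* (Poly-* f₁ f₁) g) (Poly-* (Poly-* f₁ g₁) f)))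

-- The polynomial method on a rich configuration of isotropic lines.

filter-cover : ∀ {A : Set} {P Q : A → Set} (P? : Decidable P) (Q? : Decidable Q) (xs : List A) →
               All (λ x → P x ⊎ Q x) xs → length xs ℕ.≤ length (filter P? xs) ℕ.+ length (filter Q? xs)
filter-cover P? Q? [] [] = z≤n
filter-cover P? Q? (x ∷ xs) (pq ∷ pqs) with P? x | Q? x | filter-cover P? Q? xs pqs
... | yes _ | yes _ | ih = s≤s (ℕₚ.≤-trans ih (ℕₚ.+-monoʳ-≤ _ (ℕₚ.n≤1+n _)))
... | yes _ | no  _ | ih = s≤s ih
... | no  _ | yes _ | ih = ℕₚ.≤-trans (s≤s ih) (ℕₚ.≤-reflexive (sym (ℕₚ.+-suc _ _)))
... | no ¬p | no ¬q | ih with pq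
...   | inj₁ a = contradiction a ¬p
...   | inj₂ a = contradiction a ¬q

module LineConfiguration (p : ℕ) (p-prime : Prime p) where
  open Modular p p-prime
  open Roots p p-prime
  open Collision p p-prime

  private
    sum-≈ : ∀ c x y z x′ y′ z′ → (x - x′) ≈0 → (y - y′) ≈0 → (z - z′) ≈0 →
            ((c + (x + y + z)) - (c + (x′ + y′ + z′))) ≈0
    sum-≈ c x y z x′ y′ z′ x≈ y≈ z≈ = lin₃ x≈ y≈ z≈ 1ℤ 1ℤ 1ℤ (eq c x y z x′ y′ z′)
      where
      eq : ∀ c x y z x′ y′ z′ → (c + (x + y + z)) - (c + (x′ + y′ + z′)) ≡ 1ℤ * (x - x′) + 1ℤ * (y - y′) + 1ℤ * (z - z′)
      eq = solve-∀

    product-≈ : ∀ a b c d → (a - c) ≈0 → (b - d) ≈0 → (a * b - c * d) ≈0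
    product-≈ a b c d a≈ b≈ = lin₂ a≈ b≈ b c (eq a b c d)
      where
      eq : ∀ a b c d → a * b - c * d ≡ b * (a - c) + c * (b - d)
      eq = solve-∀

    eval-node : ∀ {n} c (f : Axis → Tri n) v → eval (node c f) v ≡ c + (v X * eval (f X) v + v Y * eval (f Y) v + v Z * eval (f Z) v)
    eval-node c f v = refl

  eval-≈ : ∀ {n} (F : Tri n) {v w} → (∀ i → (v i - w i) ≈0) → (eval F v - eval F w) ≈0
  eval-≈ O          e = 0≈0
  eval-≈ (node c f) {v} {w} e = subst₂ (λ s t → (s - t) ≈0) (sym (eval-node c f v)) (sym (eval-node c f w))
    (sum-≈ c (v X * eval (f X) v) (v Y * eval (f Y) v) (v Z * eval (f Z) v) (w X * eval (f X) w) (w Y * eval (f Y) w) (w Z * eval (f Z) w)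
      (term X) (term Y) (term Z))
    where
    term : ∀ i → (v i * eval (f i) v - w i * eval (f i) w) ≈0
    term i = product-≈ (v i) (eval (f i) v) (w i) (eval (f i) w) (e i) (eval-≈ (f i) e)

  eval-≈0 : ∀ {n} (F : Tri n) {v w} → (∀ i → (v i - w i) ≈0) → eval F v ≈0 → eval F w ≈0
  eval-≈0 F {v} {w} e Fv = lin₂ (eval-≈ F e) Fv (- 1ℤ) 1ℤ (eq (eval F v) (eval F w))
    where eq : ∀ a b → b ≡ - 1ℤ * (a - b) + 1ℤ * a
          eq = solve-∀

  -- Wrapped so that both sides remain recoverable by unification when congruences are composed.
  record _~_ (x y : ℤ) : Set where
    constructor cong~
    field difference≈0 : (x - y) ≈0

  open _~_

  *~ : ∀ {a c b d} → a ~ c → b ~ d → (a * b) ~ (c * d)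
  *~ {a} {c} {b} {d} (cong~ a≈) (cong~ b≈) = cong~ (product-≈ a b c d a≈ b≈)

  lc~ : ∀ a b {x x′ y y′} → x ~ x′ → y ~ y′ → (a * x + b * y) ~ (a * x′ + b * y′)
  lc~ a b {x} {x′} {y} {y′} (cong~ x≈) (cong~ y≈) = cong~ (lin₂ x≈ y≈ a b (eq a b x x′ y y′))
    where
    eq : ∀ a b x x′ y y′ → (a * x + b * y) - (a * x′ + b * y′) ≡ a * (x - x′) + b * (y - y′)
    eq = solve-∀

  Ode~ : ∀ {f f′ g g′ f₁ f₁′ g₁ g₁′ f₂ f₂′ g₂ g₂′} → f ~ f′ → g ~ g′ → f₁ ~ f₁′ → g₁ ~ g₁′ → f₂ ~ f₂′ → g₂ ~ g₂′ →
         Ode f g f₁ g₁ f₂ g₂ ~ Ode f′ g′ f₁′ g₁′ f₂′ g₂′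
  Ode~ f g f₁ g₁ f₂ g₂ = lc~ 1ℤ 1ℤ (*~ (*~ f₂ g) f)
    (lc~ (- 1ℤ) (- + 2) (*~ (*~ f g₂) f) (lc~ 1ℤ (- 1ℤ) (*~ (*~ f₁ f₁) g) (*~ (*~ f₁ g₁) f)))

  ~≈0 : ∀ {x y} → x ~ y → x ≈0 → y ≈0
  ~≈0 {x} {y} (cong~ x≈y) = ≈0-cong y x (-‿flip x y x≈y)

  -- The two congruences compare y and z at the abscissa x.
  Meets : Line → Line → ℤ → Set
  Meets ℓ ℓ′ x = (β ℓ′ - β ℓ) ≉0
    × ((β ℓ′ - β ℓ) * x - (σ ℓ′ - σ ℓ)) ≈0
    × ((β ℓ′ - β ℓ) * (β ℓ * x - σ ℓ) + (τ ℓ′ - τ ℓ)) ≈0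

  private
    pt-Y : ∀ ℓ x → pt ℓ x Y ≡ - σ ℓ + x * β ℓ
    pt-Y ℓ x = refl

    pt-Z : ∀ ℓ x → pt ℓ x Z ≡ (τ ℓ - β ℓ * σ ℓ) + x * (β ℓ * β ℓ)
    pt-Z ℓ x = refl

    y-identity : ∀ b s b′ s′ x → (- s + x * b) - (- s′ + x * b′) ≡ - 1ℤ * ((b′ - b) * x - (s′ - s))
    y-identity = solve-∀

    z-identity : ∀ b s t b′ s′ t′ x → (t - b * s + x * (b * b)) - (t′ - b′ * s′ + x * (b′ * b′)) ≡
                 - b′ * ((b′ - b) * x - (s′ - s)) + - 1ℤ * ((b′ - b) * (b * x - s) + (t′ - t))
    z-identity = solve-∀

  meets⇒pt≈ : ∀ ℓ ℓ′ {x} → Meets ℓ ℓ′ x → ∀ i → (pt ℓ x i - pt ℓ′ x i) ≈0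
  meets⇒pt≈ ℓ ℓ′ {x} m X = ≡0⇒≈0 (ℤₚ.+-inverseʳ (0ℤ + x * 1ℤ))
  meets⇒pt≈ ℓ ℓ′ {x} m Y = subst₂ (λ a b → (a - b) ≈0) (sym (pt-Y ℓ x)) (sym (pt-Y ℓ′ x))
    (lin₁ (proj₁ (proj₂ m)) (- 1ℤ) (y-identity (β ℓ) (σ ℓ) (β ℓ′) (σ ℓ′) x))
  meets⇒pt≈ ℓ ℓ′ {x} m Z = subst₂ (λ a b → (a - b) ≈0) (sym (pt-Z ℓ x)) (sym (pt-Z ℓ′ x))
    (lin₂ (proj₁ (proj₂ m)) (proj₂ (proj₂ m)) (- β ℓ′) (- 1ℤ) (z-identity (β ℓ) (σ ℓ) (τ ℓ) (β ℓ′) (σ ℓ′) (τ ℓ′) x))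

  meets-sym : ∀ ℓ ℓ′ {x} → Meets ℓ ℓ′ x → Meets ℓ′ ℓ x
  meets-sym ℓ ℓ′ {x} (b≉ , y≈ , z≈) = (λ b≈ → b≉ (-‿flip (β ℓ) (β ℓ′) b≈)) ,
    lin₁ y≈ (- 1ℤ) (eq₁ (β ℓ) (β ℓ′) (σ ℓ) (σ ℓ′) x) ,
    lin₂ y≈ z≈ (- (β ℓ′ - β ℓ)) (- 1ℤ) (eq₂ (β ℓ) (β ℓ′) (σ ℓ) (σ ℓ′) (τ ℓ) (τ ℓ′) x)
    where
    eq₁ : ∀ b b′ s s′ x → (b - b′) * x - (s - s′) ≡ - 1ℤ * ((b′ - b) * x - (s′ - s))
    eq₁ = solve-∀
    eq₂ : ∀ b b′ s s′ t t′ x → (b - b′) * (b′ * x - s′) + (t - t′) ≡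
          - (b′ - b) * ((b′ - b) * x - (s′ - s)) + - 1ℤ * ((b′ - b) * (b * x - s) + (t′ - t))
    eq₂ = solve-∀

  private
    divide : ∀ D₁ D₀ h s → D₁ ≡ D₀ + h * s → D₁ ≈0 → D₀ ≈0 → h ≉0 → s ≈0
    divide D₁ D₀ h s e D₁≈ D₀≈ h≉ = cancelˡ h h≉ (lin₂ (subst _≈0 e D₁≈) D₀≈ 1ℤ (- 1ℤ) (eq D₀ h s))
      where
      eq : ∀ D h s → h * s ≡ 1ℤ * (D + h * s) + - 1ℤ * D
      eq = solve-∀

    divide-first : ∀ D₁ D₀ h f g → D₁ ≡ D₀ + h * f + h * h * g → D₁ ≈0 → D₀ ≈0 → h ≉0 → (f + h * g) ≈0
    divide-first D₁ D₀ h f g e = divide D₁ D₀ h (f + h * g) (trans e (eq D₀ h f g))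
      where
      eq : ∀ D h f g → D + h * f + h * h * g ≡ D + h * (f + h * g)
      eq = solve-∀

    collect₂ : ∀ D₁ D₀ h F G p g → D₁ - h * F + h * h * G ≡ D₀ + h * p + h * h * g → D₁ ≈0 → D₀ ≈0 →
               (h * (F - h * G + (p + h * g))) ≈0
    collect₂ D₁ D₀ h F G p g e D₁≈ D₀≈ = lin₂ D₁≈ D₀≈ 1ℤ (- 1ℤ)
      (trans (eq₁ D₀ h F G p g) (trans (cong (λ z → h * F - h * h * G - D₀ + z) (sym e)) (eq₂ D₁ D₀ h F G)))
      where
      eq₁ : ∀ D₀ h F G p g → h * (F - h * G + (p + h * g)) ≡ h * F - h * h * G - D₀ + (D₀ + h * p + h * h * g)
      eq₁ = solve-∀
      eq₂ : ∀ D₁ D₀ h F G → h * F - h * h * G - D₀ + (D₁ - h * F + h * h * G) ≡ 1ℤ * D₁ + - 1ℤ * D₀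
      eq₂ = solve-∀

    collect₃ : ∀ D₁ D₀ h F G s → D₁ - h * F + h * h * G ≡ D₀ + h * s → D₁ ≈0 → D₀ ≈0 → (h * (F - h * G + s)) ≈0
    collect₃ D₁ D₀ h F G s e D₁≈ D₀≈ = lin₂ D₁≈ D₀≈ 1ℤ (- 1ℤ)
      (trans (eq₁ D₀ h F G s) (trans (cong (λ z → h * F - h * h * G - D₀ + z) (sym e)) (eq₂ D₁ D₀ h F G)))
      where
      eq₁ : ∀ D₀ h F G s → h * (F - h * G + s) ≡ h * F - h * h * G - D₀ + (D₀ + h * s)
      eq₁ = solve-∀
      eq₂ : ∀ D₁ D₀ h F G → h * F - h * h * G - D₀ + (D₁ - h * F + h * h * G) ≡ 1ℤ * D₁ + - 1ℤ * D₀
      eq₂ = solve-∀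

    absorb : ∀ f h g → (f + h * g) ≈0 → g ≈0 → f ≈0
    absorb f h g fg g≈ = lin₂ fg g≈ 1ℤ (- h) (eq f h g)
      where
      eq : ∀ f h g → f ≡ 1ℤ * (f + h * g) + - h * g
      eq = solve-∀

    subtract : ∀ f k → (f + k) ≈0 → f ≈0 → k ≈0
    subtract f k fk f≈ = lin₂ fk f≈ 1ℤ (- 1ℤ) (eq f k)
      where
      eq : ∀ f k → k ≡ 1ℤ * (f + k) + - 1ℤ * f
      eq = solve-∀

    plane : ∀ A B C x f g h k → (A * g - (B * x + C) * f) ≈0 → (f + h * g) ≈0 → (h * x - k) ≈0 → g ≉0 →
            (A + B * k + C * h) ≈0
    plane A B C x f g h k e fg hx g≉ = cancelˡ g g≉ (lin₃ e fg hx 1ℤ (B * x + C) (- (B * g)) (eq A B C x f g h k))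
      where
      eq : ∀ A B C x f g h k → g * (A + B * k + C * h) ≡
           1ℤ * (A * g - (B * x + C) * f) + (B * x + C) * (f + h * g) + - (B * g) * (h * x - k)
      eq = solve-∀

    gradient-identities : ∀ b x y z → (1ℤ * x + b * y + b * b * z) ≈0 → (0ℤ * x + 1ℤ * y + + 2 * b * z) ≈0 → (0ℤ * x + 0ℤ * y + 1ℤ * z) ≈0 →
                          x ≈0 × y ≈0 × z ≈0
    gradient-identities b x y z d e f = lin₃ d e f 1ℤ (- b) (b * b) (eqx b x y z) , lin₂ e f 1ℤ (- (+ 2 * b)) (eqy b x y z) , lin₁ f 1ℤ (eqz x y z)
      where
      eqx : ∀ b x y z → x ≡ 1ℤ * (1ℤ * x + b * y + b * b * z) + - b * (0ℤ * x + 1ℤ * y + + 2 * b * z) + b * b * (0ℤ * x + 0ℤ * y + 1ℤ * z)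
      eqx = solve-∀
      eqy : ∀ b x y z → y ≡ 1ℤ * (0ℤ * x + 1ℤ * y + + 2 * b * z) + - (+ 2 * b) * (0ℤ * x + 0ℤ * y + 1ℤ * z)
      eqy = solve-∀
      eqz : ∀ x y z → z ≡ 1ℤ * (0ℤ * x + 0ℤ * y + 1ℤ * z)
      eqz = solve-∀

  gradient : ∀ {n} (F : Tri n) V b → eval (𝐃 b F) V ≈0 → eval (𝐄 b F) V ≈0 → eval (𝐙 F) V ≈0 → ∀ i → eval (∂ i F) V ≈0
  gradient F V b d e z = λ { X → proj₁ all ; Y → proj₁ (proj₂ all) ; Z → proj₂ (proj₂ all) }
    where
    all = gradient-identities b (eval (∂ X F) V) (eval (∂ Y F) V) (eval (∂ Z F) V)
      (subst _≈0 (eval-∇ (direction b) F V) d) (subst _≈0 (eval-∇ ⟨ 0ℤ , 1ℤ , + 2 * b ⟩ F V) e) (subst _≈0 (eval-∇ ⟨ 0ℤ , 0ℤ , 1ℤ ⟩ F V) z)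

  linePoly : ∀ {n} ℓ (F : Tri n) → Poly n (λ x → eval F (pt ℓ x)) (λ x → eval (𝐃 (β ℓ) F) (pt ℓ x))
  linePoly ℓ F = Poly-restrict F (base ℓ) (direction (β ℓ))

  -- In characteristic zero `K / M` would be constant, with value 0 at r. Modulo p the polynomial
  -- `x^p − r^p` over `M = 1` would be a counterexample, which the bound on the degrees excludes.
  -- One factor `x − r` is divided out to start the iteration at `c = 1`.
  wronskian-lemma : ∀ {n m K K′ M M′} → Poly n K K′ → Poly m M M′ → ∀ r → M r ≉0 → K r ≈0 →
    n ℕ.+ m ℕ.+ 2 ℕ.< p → (∀ x → (K′ x * M x - K x * M′ x) ≈0) → ∀ x → K x ≈0
  wronskian-lemma {zero} (poly [] K≡ _) PM r _ _ _ _ x = ≡0⇒≈0 (K≡ x)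
  wronskian-lemma {suc n} {m} {K} {K′} {M} {M′} (poly k K≡ K′≡) PM r Mr Kr size W x =
    lin₂ (All≈0⇒ev≈0 q≈0 x) kr (x - r) 1ℤ
      (trans (K-quot x) (cong (λ z → (x - r) * ev q x + z) (sym (ℤₚ.*-identityˡ _))))
    where
    q = quotᵥ r k
    kr : ev k r ≈0
    kr = subst _≈0 (K≡ r) Kr
    K-quot : ∀ x → K x ≡ (x - r) * ev q x + ev k r
    K-quot x = trans (K≡ x) (ev-quotᵥ r k x)
    K′-quot : ∀ x → K′ x ≡ ev q x + (x - r) * ev′ q x
    K′-quot x = trans (K′≡ x) (ev′-quotᵥ r k x)
    q≈0 : All≈0 q
    q≈0 = wronskian-vanishes q PM 1 r Mr ℕₚ.≤-refl
      (ℕₚ.≤-trans (ℕₚ.≤-trans (ℕₚ.m≤m+n (suc n) m) (ℕₚ.m≤m+n _ 2)) (ℕₚ.<⇒≤ size))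
      (ℕₚ.<-trans (ℕₚ.+-monoˡ-< 2 (ℕₚ.+-monoˡ-< m ℕₚ.≤-refl)) size)
      λ x → lin₂ (subst₂ (λ a b → (a * M x - b * M′ x) ≈0) (K′-quot x) (K-quot x) (W x)) kr 1ℤ (M′ x) (eq x r (ev q x) (ev′ q x) (M x) (M′ x) (ev k r))
      where eq : ∀ x r q q′ m m′ e → 1ℤ * (q * m) + (x - r) * (q′ * m - q * m′) ≡
                   1ℤ * ((q + (x - r) * q′) * m - ((x - r) * q + e) * m′) + m′ * e
            eq = solve-∀

  private
    W₁-identity : ∀ M₀ N₀ f g f′ g′ f″ g″ →
      (M₀ * (1ℤ * (g″ * f + g′ * f′) + - 1ℤ * (g′ * f′ + g * f″)) + - N₀ * (f′ * f + f * f′)) * (f * f)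
       - (M₀ * (1ℤ * (g′ * f) + - 1ℤ * (g * f′)) + - N₀ * (f * f)) * (f′ * f + f * f′) ≡ - (M₀ * f) * Ode f g f′ g′ f″ g″
    W₁-identity M₀ N₀ f g f′ g′ f″ g″ = eq M₀ N₀ f g f′ g′ f″ g″
      where
      eq : ∀ M₀ N₀ f g f′ g′ f″ g″ →
        (M₀ * (1ℤ * (g″ * f + g′ * f′) + - 1ℤ * (g′ * f′ + g * f″)) + - N₀ * (f′ * f + f * f′)) * (f * f)
         - (M₀ * (1ℤ * (g′ * f) + - 1ℤ * (g * f′)) + - N₀ * (f * f)) * (f′ * f + f * f′) ≡
        - (M₀ * f) * (1ℤ * ((f″ * g) * f) + 1ℤ * ((- 1ℤ) * ((f * g″) * f) + (- + 2) * (1ℤ * ((f′ * f′) * g) + (- 1ℤ) * ((f′ * g′) * f))))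
      eq = solve-∀

    W₂-identity : ∀ M₀ N₀ fr C f g f′ g′ x →
      ((M₀ * fr) * (0ℤ * g + (1ℤ + x * 0ℤ) * g′) + - 1ℤ * ((N₀ * fr) * f + (C + x * (N₀ * fr)) * f′)) * f
       - ((M₀ * fr) * ((1ℤ + x * 0ℤ) * g) + - 1ℤ * ((C + x * (N₀ * fr)) * f)) * f′ ≡
      fr * (M₀ * (1ℤ * (g′ * f) + - 1ℤ * (g * f′)) + - N₀ * (f * f))
    W₂-identity = solve-∀

    root₂-identity : ∀ M₀ N₀ f g r → (M₀ * f) * ((1ℤ + r * 0ℤ) * g) + - 1ℤ * (((M₀ * g - N₀ * f * r) + r * (N₀ * f)) * f) ≡ 0ℤ
    root₂-identity = solve-∀

    conclusion-identity : ∀ x A g B C f → A * g - (B * x + C) * f ≡ 1ℤ * (A * ((1ℤ + x * 0ℤ) * g) + - 1ℤ * ((C + x * B) * f))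
    conclusion-identity = solve-∀

    root₁-identity : ∀ a b → a * b + - b * a ≡ 0ℤ
    root₁-identity = solve-∀

  module _ {n f f′ f″ g g′ g″} (Pf : Poly n f f′) (Pf′ : Poly n f′ f″) (Pg : Poly n g g′) (Pg′ : Poly n g′ g″)
    (r : ℤ) (fr : f r ≉0) (size : 4 ℕ.* n ℕ.+ 4 ℕ.< p) (ode : ∀ x → Ode (f x) (g x) (f′ x) (g′ x) (f″ x) (g″ x) ≈0) where

    private
      M N : ℤ → ℤ
      M x = f x * f x
      N x = 1ℤ * (g′ x * f x) + - 1ℤ * (g x * f′ x)

      -- First integration: `N / M` is `(g/f)′`, and the Wronskian of `M₀ N − N₀ M` with `M` is a
      -- multiple of `Ode`. The next lemma integrates once more, comparing g with an affine multiple
      -- of f.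
      constant-derivative : ∀ M₀ N₀ → (M₀ * N r + - N₀ * M r) ≈0 → ∀ x → (M₀ * N x + - N₀ * M x) ≈0
      constant-derivative M₀ N₀ root = wronskian-lemma
        (Poly-lincomb M₀ (- N₀) (Poly-lincomb 1ℤ (- 1ℤ) (Poly-* Pg′ Pf) (Poly-* Pg Pf′)) (Poly-* Pf Pf)) (Poly-* Pf Pf)
        r (*≉0 fr fr) root (ℕₚ.≤-<-trans (size≤ n) size)
        (λ x → lin₁ (ode x) (- (M₀ * f x)) (W₁-identity M₀ N₀ (f x) (g x) (f′ x) (g′ x) (f″ x) (g″ x)))
        where
        size≤ : ∀ a → a ℕ.+ a ℕ.+ (a ℕ.+ a) ℕ.+ 2 ℕ.≤ 4 ℕ.* a ℕ.+ 4
        size≤ a = ℕₚ.≤-trans (ℕₚ.+-monoʳ-≤ _ (s≤s (s≤s z≤n))) (ℕₚ.≤-reflexive (cong (ℕ._+ 4)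
          (trans (ℕₚ.+-assoc a a (a ℕ.+ a)) (cong (λ z → a ℕ.+ (a ℕ.+ (a ℕ.+ z))) (sym (ℕₚ.+-identityʳ a))))))

      affine : ∀ M₀ N₀ fr₀ C → (∀ x → (M₀ * N x + - N₀ * M x) ≈0) →
        ((M₀ * fr₀) * ((1ℤ + r * 0ℤ) * g r) + - 1ℤ * ((C + r * (N₀ * fr₀)) * f r)) ≈0 →
        ∀ x → ((M₀ * fr₀) * ((1ℤ + x * 0ℤ) * g x) + - 1ℤ * ((C + x * (N₀ * fr₀)) * f x)) ≈0
      affine M₀ N₀ fr₀ C MN root = wronskian-lemma
        (Poly-lincomb (M₀ * fr₀) (- 1ℤ) (Poly-* (Poly-linear 1ℤ 0ℤ) Pg) (Poly-* (Poly-linear C (N₀ * fr₀)) Pf)) Pf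
        r fr root size₂ (λ x → lin₁ (MN x) fr₀ (W₂-identity M₀ N₀ fr₀ C (f x) (g x) (f′ x) (g′ x) x))
        where
        size₂ : 2 ℕ.+ n ℕ.+ n ℕ.+ 2 ℕ.< p
        size₂ = ℕₚ.≤-<-trans (ℕₚ.≤-trans (ℕₚ.≤-reflexive eqn) (ℕₚ.+-monoˡ-≤ 4 (ℕₚ.*-monoˡ-≤ n {2} {4} (s≤s (s≤s z≤n))))) size
          where eqn : 2 ℕ.+ n ℕ.+ n ℕ.+ 2 ≡ 2 ℕ.* n ℕ.+ 4
                eqn = trans (ℕₚ.+-comm (2 ℕ.+ n ℕ.+ n) 2) (trans (ℕₚ.+-comm 4 (n ℕ.+ n)) (cong (λ z → n ℕ.+ z ℕ.+ 4) (sym (ℕₚ.+-identityʳ n))))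

    -- Ode says (g/f)″ = 0, hence g/f is affine in x.
    ode-solution : ∃[ A ] ∃[ B ] ∃[ C ] (A ≉0 × (∀ x → (A * g x - (B * x + C) * f x) ≈0))
    -- The tangent of `g/f` at r, with slope `N r / M r`, cleared of the denominator `(f r)³`.
    ode-solution = M r * f r , N r * f r , C , *≉0 (*≉0 fr fr) fr ,
      λ x → lin₁ (affine (M r) (N r) (f r) C (constant-derivative (M r) (N r) (≡0⇒≈0 (root₁-identity (M r) (N r))))
                    (≡0⇒≈0 (root₂-identity (M r) (N r) (f r) (g r) r)) x)
                 1ℤ (conclusion-identity x (M r * f r) (g x) (N r * f r) C (f x))
      where
      C : ℤ
      C = M r * g r - N r * f r * r

  -- Vertices carry the incidences, so coinciding lines do no harm. A neighbour is listed with the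
  -- abscissa of the meeting point; these being incongruent, m neighbours are m distinct places on
  -- the line.
  module _ {Vertex : Set} (lineOf : Vertex → Line) (vs : List Vertex) (nbrs : Vertex → List (ℤ × Vertex)) (m : ℕ)
    (rich    : ∀ {v} → v ∈ vs → m ℕ.≤ length (nbrs v))
    (nbrs#   : ∀ {v} → v ∈ vs → AllPairs (λ e e′ → (proj₁ e′ - proj₁ e) ≉0) (nbrs v))
    (meets   : ∀ {v} → v ∈ vs → All (λ (x , w) → w ∈ vs × Meets (lineOf v) (lineOf w) x) (nbrs v))
    where

    OnLines : ∀ {n} → Tri n → Set
    OnLines F = ∀ {v} → v ∈ vs → ∀ x → eval F (pt (lineOf v) x) ≈0

    private
      abscissae : Vertex → List ℤ
      abscissae v = map proj₁ (nbrs v)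

      abscissae-length : ∀ {n v} → n ℕ.≤ m → v ∈ vs → n ℕ.≤ length (abscissae v)
      abscissae-length n≤m v∈ = ℕₚ.≤-trans n≤m (subst (m ℕ.≤_) (sym (Listₚ.length-map proj₁ (nbrs _))) (rich v∈))

      abscissae# : ∀ {v} → v ∈ vs → Incongruent (abscissae v)
      abscissae# v∈ = AllPairsₚ.map⁺ (nbrs# v∈)

      module AtNbrs {n u u′} (P : Poly n u u′) {v} (v∈ : v ∈ vs) (n≤m : n ℕ.≤ m)
                    (z : All (λ e → u (proj₁ e) ≈0) (nbrs v)) where
        value≈0 : ∀ x → u x ≈0
        value≈0 = roots⇒value≈0 P (abscissae-length n≤m v∈) (abscissae# v∈) (Allₚ.map⁺ z)
        deriv≈0 : ∀ x → u′ x ≈0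
        deriv≈0 = roots⇒deriv≈0 P (abscissae-length n≤m v∈) (abscissae# v∈) (Allₚ.map⁺ z)

      onLines-𝐃 : ∀ {n u u′} → Poly n u u′ → n ℕ.≤ m → ∀ {v} → v ∈ vs → (∀ x → u x ≈0) → ∀ x → u′ x ≈0
      onLines-𝐃 P n≤m v∈ z = AtNbrs.deriv≈0 P v∈ n≤m (All.tabulate λ {e} _ → z (proj₁ e))

    axes : List Axis
    axes = X ∷ Y ∷ Z ∷ []

    ∈-axes : ∀ i → i ∈ axes
    ∈-axes X = here refl
    ∈-axes Y = there (here refl)
    ∈-axes Z = there (there (here refl))

    private
      naturals# : ∀ {k} → k ℕ.≤ p → Incongruent (applyUpTo +_ k)
      naturals# k≤p = AllPairsₚ.applyUpTo⁺₁ +_ _ λ i<j j<k → ordered≉0 i<j (ℕₚ.<-≤-trans j<k k≤p)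

      search : ∀ {A : Set} (xs : List A) (u : A → ℤ) → (∃[ x ] x ∈ xs × u x ≉0) ⊎ (∀ {x} → x ∈ xs → u x ≈0)
      search xs u with Any.any? (λ x → ¬? (u x ≈0?)) xs
      ... | yes a = inj₁ (find a)
      ... | no ¬a = inj₂ λ {x} x∈ → decidable-stable (u x ≈0?) (λ ux → ¬a (lose x∈ ux))

      -- Otherwise the restriction of F to the line through Q and P has a derivative with too many
      -- zeros, hence zero derivative, and a polynomial of degree below p with zero derivative is
      -- constant.
      partial≉0 : ∀ {n} (F : Tri (suc n)) P Q → suc n ℕ.+ 4 ℕ.≤ p → eval F Q ≈0 → eval F P ≉0 →
                  ∃[ i ] ∃[ R ] eval (∂ i F) R ≉0
      partial≉0 {n} F P Q n≤p FQ FP with search (cartesianProduct axes (applyUpTo +_ (suc n)))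
                                             (λ (i , t) → eval (∂ i F) (λ j → Q j + t * (P j - Q j)))
      ... | inj₁ ((i , t) , _ , ne) = i , _ , ne
      ... | inj₂ all = contradiction (subst _≈0 refl F≈0) FP
        where
        u : Point
        u j = P j - Q j
        R = Poly-restrict F Q u
        k = Poly.coeffs R
        q = quotᵥ 0ℤ k
        deriv≈0 : ∀ x → eval (∇ u F) (λ j → Q j + x * u j) ≈0
        deriv≈0 = roots⇒value≈0 (proj₂ (Poly-deriv R)) {applyUpTo +_ (suc n)} (ℕₚ.≤-reflexive (sym (Listₚ.length-applyUpTo +_ (suc n))))
          (naturals# (ℕₚ.≤-trans (ℕₚ.m≤m+n (suc n) 4) n≤p))
          (All.tabulate λ {t} t∈ → subst _≈0 (sym (eval-∇ u F _))
            (lin₃ (at X t∈) (at Y t∈) (at Z t∈) (u X) (u Y) (u Z) refl))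
          where at : ∀ i {t} → t ∈ applyUpTo +_ (suc n) → eval (∂ i F) (λ j → Q j + t * u j) ≈0
                at i t∈ = all (∈ₚ.∈-cartesianProduct⁺ (∈-axes i) t∈)
        q≈0 : All≈0 q
        -- With `M = 1` and `c = 1` the hypothesis reads `(x q)′ ≈ 0`, where `x q` is the
        -- restriction minus its constant term.
        q≈0 = wronskian-vanishes {M = λ _ → 1ℤ} q (Poly-const {0} 1ℤ) 1 0ℤ 1≉0 ℕₚ.≤-refl
          (ℕₚ.≤-trans (ℕₚ.m≤m+n (suc n) 4) n≤p)
          (ℕₚ.≤-trans (ℕₚ.≤-reflexive (trans (cong suc (ℕₚ.+-assoc n 1 2)) (sym refl))) (ℕₚ.≤-trans (ℕₚ.+-monoʳ-≤ (suc n) {3} {4} (s≤s (s≤s (s≤s z≤n)))) n≤p))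
          λ x → lin₁ (deriv≈0 x) 1ℤ (trans (eq x (ev q x) (ev′ q x)) (cong (1ℤ *_) (sym (trans (Poly.deriv R x) (ev′-quotᵥ 0ℤ k x)))))
          where eq : ∀ x q q′ → 1ℤ * (q * 1ℤ) + (x - 0ℤ) * (q′ * 1ℤ - q * 0ℤ) ≡ 1ℤ * (q + (x - 0ℤ) * q′)
                eq = solve-∀
        k0≈0 : ev k 0ℤ ≈0
        k0≈0 = subst _≈0 (Poly.value R 0ℤ) (eval-≈0 F (λ i → ≡0⇒≈0 (eq (Q i) (u i))) FQ)
          where eq : ∀ q u → q - (q + 0ℤ * u) ≡ 0ℤ
                eq = solve-∀
        F≈0 : eval F P ≈0
        F≈0 = eval-≈0 F (λ i → ≡0⇒≈0 (eq (Q i) (P i)))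
          (subst _≈0 (sym (Poly.value R 1ℤ)) (All≈0⇒ev≈0 (quotᵥ-All≈0 0ℤ k q≈0 k0≈0) 1ℤ))
          where eq : ∀ q p → (q + 1ℤ * (p - q)) - p ≡ 0ℤ
                eq = solve-∀

    -- Differentiate until some partial derivative no longer vanishes on all the lines.
    regular : ∀ n (F : Tri n) → n ℕ.+ 4 ℕ.≤ p → n ℕ.≤ m → ∃[ v ] v ∈ vs → OnLines F → ∀ P → eval F P ≉0 →
      ∃[ k ] Σ (Tri k) λ G → k ℕ.≤ n × OnLines G × ∃[ v ] (v ∈ vs × ∃[ x ] ∃[ i ] eval (∂ i G) (pt (lineOf v) x) ≉0)
    regular zero    O _ _ _ _ P ne = contradiction 0≈0 ne
    regular (suc n) F n≤p n≤m v₀ on P ne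
      with search (cartesianProduct vs (cartesianProduct axes (applyUpTo +_ (suc n)))) (λ (v , i , t) → eval (∂ i F) (pt (lineOf v) t))
    ... | inj₁ ((v , i , t) , vit∈ , ne′) =
          suc n , F , ℕₚ.≤-refl , (λ {v} → on {v}) , v , proj₁ (∈ₚ.∈-cartesianProduct⁻ vs _ vit∈) , t , i , ne′
    ... | inj₂ all
      with partial≉0 F P (pt (lineOf (proj₁ v₀)) 0ℤ) n≤p (on (proj₂ v₀) 0ℤ) ne
    ...   | i , R , ne′ with regular n (δ i F) (ℕₚ.<⇒≤ n≤p) (ℕₚ.<⇒≤ n≤m) v₀
                 (λ {v} v∈ x → subst _≈0 (eval-up (δ i F) (pt (lineOf v) x)) (on∂ v∈ x)) R
                 (λ z → ne′ (subst _≈0 (sym (eval-up (δ i F) R)) z))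
      where
      on∂ : OnLines (∂ i F)
      on∂ {v} v∈ = roots⇒value≈0 (linePoly (lineOf v) (∂ i F)) {applyUpTo +_ (suc n)} (ℕₚ.≤-reflexive (sym (Listₚ.length-applyUpTo +_ (suc n))))
        (naturals# (ℕₚ.≤-trans (ℕₚ.m≤m+n (suc n) 4) n≤p))
        (All.tabulate λ t∈ → all (∈ₚ.∈-cartesianProduct⁺ v∈ (∈ₚ.∈-cartesianProduct⁺ (∈-axes i) t∈)))
    ...     | k , G , k≤n , rest = k , G , ℕₚ.m≤n⇒m≤1+n k≤n , rest

    module _ {n} (F : Tri n) (on : OnLines F) (4n≤m : n ℕ.+ n ℕ.+ (n ℕ.+ n) ℕ.≤ m) where

      private
        3n≤m : n ℕ.+ n ℕ.+ n ℕ.≤ m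
        3n≤m = ℕₚ.≤-trans (ℕₚ.+-monoʳ-≤ (n ℕ.+ n) (ℕₚ.m≤m+n n n)) 4n≤m

        n≤m : n ℕ.≤ m
        n≤m = ℕₚ.≤-trans (ℕₚ.m≤n+m n (n ℕ.+ n)) 3n≤m

        𝐃≈0 : ∀ {v} → v ∈ vs → ∀ x → eval (𝐃 (β (lineOf v)) F) (pt (lineOf v) x) ≈0
        𝐃≈0 {v} v∈ = onLines-𝐃 (linePoly (lineOf v) F) n≤m v∈ (on v∈)

        𝐃𝐃≈0 : ∀ {v} → v ∈ vs → ∀ x → eval (𝐃 (β (lineOf v)) (𝐃 (β (lineOf v)) F)) (pt (lineOf v) x) ≈0
        𝐃𝐃≈0 {v} v∈ = onLines-𝐃 (linePoly (lineOf v) (𝐃 (β (lineOf v)) F)) n≤m v∈ (𝐃≈0 v∈)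

        𝐃𝐃𝐃≈0 : ∀ {v} → v ∈ vs → ∀ x → eval (𝐃 (β (lineOf v)) (𝐃 (β (lineOf v)) (𝐃 (β (lineOf v)) F))) (pt (lineOf v) x) ≈0
        𝐃𝐃𝐃≈0 {v} v∈ = onLines-𝐃 (linePoly (lineOf v) (𝐃 (β (lineOf v)) (𝐃 (β (lineOf v)) F))) n≤m v∈ (𝐃𝐃≈0 v∈)

        module Meeting {v w x} (v∈ : v ∈ vs) (w∈ : w ∈ vs) (M : Meets (lineOf v) (lineOf w) x) where
          b c h : ℤ
          b = β (lineOf v)
          c = β (lineOf w)
          h = c - b

          V : Point
          V = pt (lineOf v) x

          h≉0 : h ≉0
          h≉0 = proj₁ M

          transfer : ∀ {k} (G : Tri k) → eval G (pt (lineOf w) x) ≈0 → eval G V ≈0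
          transfer G = eval-≈0 G (λ i → -‿flip (pt (lineOf v) x i) (pt (lineOf w) x i) (meets⇒pt≈ (lineOf v) (lineOf w) M i))

          first : (eval (𝐄 b F) V + h * eval (𝐙 F) V) ≈0
          first = divide-first (eval (𝐃 c F) V) (eval (𝐃 b F) V) h (eval (𝐄 b F) V) (eval (𝐙 F) V)
            (Shift.𝐃-shift F V b c) (transfer (𝐃 c F) (𝐃≈0 w∈ x)) (𝐃≈0 v∈ x) h≉0

          second : (+ 2 * eval (𝐃 b (𝐄 b F)) V + h * eval (𝐑 b F) V + + 2 * h * h * eval (𝐄 b (𝐙 F)) V + h * h * h * eval (𝐙 (𝐙 F)) V) ≈0
          second = divide (eval (𝐃 c (𝐃 c F)) V) (eval (𝐃 b (𝐃 b F)) V) h _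
            (subst (λ r → eval (𝐃 c (𝐃 c F)) V ≡ eval (𝐃 b (𝐃 b F)) V + h * (+ 2 * eval (𝐃 b (𝐄 b F)) V + h * r
                     + + 2 * h * h * eval (𝐄 b (𝐙 F)) V + h * h * h * eval (𝐙 (𝐙 F)) V))
              (eval-𝐑 b F V) (Shift.𝐃𝐃-shift F V b c))
            (transfer (𝐃 c (𝐃 c F)) (𝐃𝐃≈0 w∈ x)) (𝐃𝐃≈0 v∈ x) h≉0

          hess : Hess (eval (𝐄 b F) V) (eval (𝐙 F) V) (eval (𝐃 b (𝐄 b F)) V) (eval (𝐑 b F) V) (eval (𝐄 b (𝐙 F)) V) (eval (𝐙 (𝐙 F)) V) ≈0
          hess = Hess≈0 h (eval (𝐄 b F) V) (eval (𝐙 F) V) (eval (𝐃 b (𝐄 b F)) V) (eval (𝐑 b F) V) (eval (𝐄 b (𝐙 F)) V) (eval (𝐙 (𝐙 F)) V) first second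

        -- Along a line `Hess` has 4n coefficients and vanishes at the m ≥ 4n meeting points, hence
        -- identically; only then may it be differentiated.
        hess-derivative : ∀ {v} → v ∈ vs → ∀ x → let b = β (lineOf v) ; V = pt (lineOf v) x in
          Hess′ (eval (𝐄 b F) V) (eval (𝐙 F) V) (eval (𝐃 b (𝐄 b F)) V) (eval (𝐑 b F) V) (eval (𝐄 b (𝐙 F)) V) (eval (𝐙 (𝐙 F)) V)
                (eval (𝐃 b (𝐙 F)) V) (eval (𝐃 b (𝐃 b (𝐄 b F))) V) (eval (𝐃 b (𝐑 b F)) V) (eval (𝐃 b (𝐄 b (𝐙 F))) V) (eval (𝐃 b (𝐙 (𝐙 F))) V) ≈0
        hess-derivative {v} v∈ = AtNbrs.deriv≈0
          (Poly-Hess (linePoly ℓ (𝐄 (β ℓ) F)) (linePoly ℓ (𝐙 F)) (linePoly ℓ (𝐃 (β ℓ) (𝐄 (β ℓ) F))) (linePoly ℓ (𝐑 (β ℓ) F))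
                     (linePoly ℓ (𝐄 (β ℓ) (𝐙 F))) (linePoly ℓ (𝐙 (𝐙 F))))
          v∈ 4n≤m (All.map (λ (w∈ , M) → Meeting.hess v∈ w∈ M) (meets v∈))
          where
          ℓ : Line
          ℓ = lineOf v

        module Ode-at {v w x} (v∈ : v ∈ vs) (w∈ : w ∈ vs) (M : Meets (lineOf v) (lineOf w) x) where
          -- The roles are exchanged: the neighbour w is the line on which `Hess′` is used, and v
          -- the one on which `Ode` is obtained.
          open Meeting w∈ v∈ (meets-sym (lineOf v) (lineOf w) M)

          ode-there : Ode (eval (𝐄 c F) V) (eval (𝐙 F) V) (eval (𝐃 c (𝐄 c F)) V) (eval (𝐃 c (𝐙 F)) V)
                          (eval (𝐃 c (𝐃 c (𝐄 c F))) V) (eval (𝐃 c (𝐃 c (𝐙 F))) V) ≈0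
          ode-there = ode-at-meeting h (eval (𝐄 b F) V) (eval (𝐙 F) V) (eval (𝐃 b (𝐄 b F)) V) (eval (𝐑 b F) V) (eval (𝐄 b (𝐙 F)) V) (eval (𝐙 (𝐙 F)) V)
            (eval (𝐃 b (𝐙 F)) V) (eval (𝐃 b (𝐃 b (𝐄 b F))) V) (eval (𝐃 b (𝐑 b F)) V) (eval (𝐃 b (𝐄 b (𝐙 F))) V) (eval (𝐃 b (𝐙 (𝐙 F))) V)
            (eval (𝐄 c F) V) (eval (𝐃 c (𝐄 c F)) V) (eval (𝐃 c (𝐃 c (𝐄 c F))) V) (eval (𝐃 c (𝐙 F)) V) (eval (𝐃 c (𝐃 c (𝐙 F))) V)
            h≉0 first second (hess-derivative w∈ x) f≈ f₁≡ mixed₂ mixed₃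
            where
            f≈ : (eval (𝐄 c F) V - (eval (𝐄 b F) V + + 2 * h * eval (𝐙 F) V)) ≈0
            f≈ = ≡0⇒≈0 (ℤₚ.i≡j⇒i-j≡0 (Shift.𝐄-shift F V b c))
            f₁≡ : eval (𝐃 c (𝐄 c F)) V ≡ eval (𝐃 b (𝐄 b F)) V + h * eval (𝐑 b F) V + + 3 * h * h * eval (𝐄 b (𝐙 F)) V + + 2 * h * h * h * eval (𝐙 (𝐙 F)) V
            f₁≡ = subst (λ r → eval (𝐃 c (𝐄 c F)) V ≡ eval (𝐃 b (𝐄 b F)) V + h * r + + 3 * h * h * eval (𝐄 b (𝐙 F)) V + + 2 * h * h * h * eval (𝐙 (𝐙 F)) V)
              (eval-𝐑 b F V) (Shift.𝐃𝐄-shift F V b c)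
            mixed₂ : (h * (eval (𝐃 c (𝐄 c F)) V - h * eval (𝐃 c (𝐙 F)) V + (eval (𝐃 b (𝐄 b F)) V + h * eval (𝐃 b (𝐙 F)) V))) ≈0
            mixed₂ = collect₂ (eval (𝐃 c (𝐃 c F)) V) (eval (𝐃 b (𝐃 b F)) V) h (eval (𝐃 c (𝐄 c F)) V) (eval (𝐃 c (𝐙 F)) V)
              (eval (𝐃 b (𝐄 b F)) V) (eval (𝐃 b (𝐙 F)) V) (Shift.𝐃𝐃-mixed F V b c) (transfer (𝐃 c (𝐃 c F)) (𝐃𝐃≈0 v∈ x)) (𝐃𝐃≈0 w∈ x)
            mixed₃ : (h * (eval (𝐃 c (𝐃 c (𝐄 c F))) V - h * eval (𝐃 c (𝐃 c (𝐙 F))) V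
                       + (+ 2 * eval (𝐃 b (𝐃 b (𝐄 b F))) V + h * eval (𝐃 b (𝐑 b F)) V + + 2 * h * h * eval (𝐃 b (𝐄 b (𝐙 F))) V + h * h * h * eval (𝐃 b (𝐙 (𝐙 F))) V))) ≈0
            mixed₃ = collect₃ (eval (𝐃 c (𝐃 c (𝐃 c F))) V) (eval (𝐃 b (𝐃 b (𝐃 b F))) V) h (eval (𝐃 c (𝐃 c (𝐄 c F))) V) (eval (𝐃 c (𝐃 c (𝐙 F))) V) _
              (subst (λ r → eval (𝐃 c (𝐃 c (𝐃 c F))) V - h * eval (𝐃 c (𝐃 c (𝐄 c F))) V + h * h * eval (𝐃 c (𝐃 c (𝐙 F))) V ≡
                        eval (𝐃 b (𝐃 b (𝐃 b F))) V + h * (+ 2 * eval (𝐃 b (𝐃 b (𝐄 b F))) V + h * r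
                          + + 2 * h * h * eval (𝐃 b (𝐄 b (𝐙 F))) V + h * h * h * eval (𝐃 b (𝐙 (𝐙 F))) V))
                (eval-𝐃𝐑 b F V) (Shift.𝐃𝐃𝐃-mixed F V b c))
              (transfer (𝐃 c (𝐃 c (𝐃 c F))) (𝐃𝐃𝐃≈0 v∈ x)) (𝐃𝐃𝐃≈0 w∈ x)

          ode-here : let V = pt (lineOf v) x in
            Ode (eval (𝐄 c F) V) (eval (𝐙 F) V) (eval (𝐃 c (𝐄 c F)) V) (eval (𝐃 c (𝐙 F)) V)
                (eval (𝐃 c (𝐃 c (𝐄 c F))) V) (eval (𝐃 c (𝐃 c (𝐙 F))) V) ≈0
          ode-here = ~≈0 (Ode~ (move (𝐄 c F)) (move (𝐙 F)) (move (𝐃 c (𝐄 c F))) (move (𝐃 c (𝐙 F)))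
                               (move (𝐃 c (𝐃 c (𝐄 c F)))) (move (𝐃 c (𝐃 c (𝐙 F))))) ode-there
            where
            move : ∀ {k} (G : Tri k) → eval G (pt (lineOf w) x) ~ eval G (pt (lineOf v) x)
            move G = cong~ (eval-≈ G (λ i → -‿flip (pt (lineOf v) x i) (pt (lineOf w) x i) (meets⇒pt≈ (lineOf v) (lineOf w) M i)))

      module _ {v} (v∈ : v ∈ vs) (5n<p : 4 ℕ.* n ℕ.+ 4 ℕ.< p) where

        private
          ℓ : Line
          ℓ = lineOf v
          b : ℤ
          b = β ℓ
          f g : ℤ → ℤ
          f x = eval (𝐄 b F) (pt ℓ x)
          g x = eval (𝐙 F) (pt ℓ x)

        ode : ∀ x → Ode (f x) (g x) (eval (𝐃 b (𝐄 b F)) (pt ℓ x)) (eval (𝐃 b (𝐙 F)) (pt ℓ x))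
                        (eval (𝐃 b (𝐃 b (𝐄 b F))) (pt ℓ x)) (eval (𝐃 b (𝐃 b (𝐙 F))) (pt ℓ x)) ≈0
        ode = AtNbrs.value≈0
          (proj₂ (Poly-Ode (linePoly ℓ (𝐄 b F)) (linePoly ℓ (𝐙 F)) (linePoly ℓ (𝐃 b (𝐄 b F))) (linePoly ℓ (𝐃 b (𝐙 F)))
                           (linePoly ℓ (𝐃 b (𝐃 b (𝐄 b F)))) (linePoly ℓ (𝐃 b (𝐃 b (𝐙 F))))))
          v∈ 3n≤m (All.map (λ (w∈ , M) → Ode-at.ode-here v∈ w∈ M) (meets v∈))

        meeting : ∀ {x w} → (x , w) ∈ nbrs v → w ∈ vs × Meets ℓ (lineOf w) x
        meeting e∈ = All.lookup (meets v∈) e∈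

        -- At a meeting `f ≈ −h g`, so f vanishes together with g; `𝐃`, `𝐄` and `𝐙` span all
        -- directions, so the whole gradient vanishes at enough points to vanish along the line.
        all-partials≈0 : (∀ {e} → e ∈ nbrs v → g (proj₁ e) ≈0) → ∀ i x → eval (∂ i F) (pt ℓ x) ≈0
        all-partials≈0 g≈0 i = AtNbrs.value≈0 (linePoly ℓ (∂ i F)) v∈ n≤m (All.tabulate λ {e} e∈ →
          let w∈ , M = meeting e∈
          in gradient F (pt ℓ (proj₁ e)) b (𝐃≈0 v∈ (proj₁ e))
               (absorb (f (proj₁ e)) (β (lineOf (proj₂ e)) - b) (g (proj₁ e)) (Meeting.first v∈ w∈ M) (g≈0 e∈)) (g≈0 e∈) i)

        -- Meeting `ℓ` is one linear equation on the parameters of the other line, and this is a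
        -- second one. With `A ≉0` it is not satisfied by `ℓ` itself.
        CoplanarTo : ℤ → ℤ → ℤ → ℤ × Vertex → Set
        CoplanarTo A B C (_ , w) = (A + B * (σ (lineOf w) - σ ℓ) + C * (β (lineOf w) - β ℓ)) ≈0

        coplanar? : ∀ A B C → Decidable (CoplanarTo A B C)
        coplanar? A B C (_ , w) = (A + B * (σ (lineOf w) - σ ℓ) + C * (β (lineOf w) - β ℓ)) ≈0?

        -- Where `g ≉0`, a meeting has `g/f = −1/h`, so the affine solution of `Ode` reads
        -- `A + (B x + C) h ≈ 0`, and `h x ≈ σ′ − σ` makes it linear. At most n abscissae are lost
        -- to the zeros of g.
        collinear-at : ∃[ e ] (e ∈ nbrs v × g (proj₁ e) ≉0) →
          ∃[ A ] ∃[ B ] ∃[ C ] (A ≉0 × length (nbrs v) ℕ.≤ n ℕ.+ length (filter (coplanar? A B C) (nbrs v)))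
        collinear-at ((r , w) , e∈ , gr) = A , B , C , A≉0 ,
          ℕₚ.≤-trans (filter-cover (λ e → g (proj₁ e) ≈0?) (coplanar? A B C) (nbrs v) (All.tabulate alternative))
            (ℕₚ.+-monoˡ-≤ _ few)
          where
          fr : f r ≉0
          fr z = *≉0 (Meeting.h≉0 v∈ (proj₁ (meeting e∈)) (proj₂ (meeting e∈))) gr
            (subtract (f r) ((β (lineOf w) - b) * g r) (Meeting.first v∈ (proj₁ (meeting e∈)) (proj₂ (meeting e∈))) z)
          solution = ode-solution (linePoly ℓ (𝐄 b F)) (linePoly ℓ (𝐃 b (𝐄 b F))) (linePoly ℓ (𝐙 F)) (linePoly ℓ (𝐃 b (𝐙 F))) r fr 5n<p ode
          A B C : ℤ
          A = proj₁ solution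
          B = proj₁ (proj₂ solution)
          C = proj₁ (proj₂ (proj₂ solution))
          A≉0 : A ≉0
          A≉0 = proj₁ (proj₂ (proj₂ (proj₂ solution)))
          alternative : ∀ {e} → e ∈ nbrs v → g (proj₁ e) ≈0 ⊎ CoplanarTo A B C e
          alternative {x , w} e∈ = by-cases (g x ≈0?) inj₁ λ gx → inj₂
            (plane A B C x (f x) (g x) (β (lineOf w) - β ℓ) (σ (lineOf w) - σ ℓ)
              (proj₂ (proj₂ (proj₂ (proj₂ solution))) x)
              (Meeting.first v∈ (proj₁ (meeting e∈)) (proj₂ (meeting e∈)))
              (proj₁ (proj₂ (proj₂ (meeting e∈)))) gx)
          few : length (filter (λ e → g (proj₁ e) ≈0?) (nbrs v)) ℕ.≤ n
          few = ℕₚ.≮⇒≥ λ n< → gr (roots⇒value≈0 (linePoly ℓ (𝐙 F))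
            {map proj₁ (filter (λ e → g (proj₁ e) ≈0?) (nbrs v))}
            (subst (n ℕ.≤_) (sym (Listₚ.length-map proj₁ (filter (λ e → g (proj₁ e) ≈0?) (nbrs v)))) (ℕₚ.<⇒≤ n<))
            (AllPairsₚ.map⁺ (AllPairsₚ.filter⁺ (λ e → g (proj₁ e) ≈0?) (nbrs# v∈)))
            (Allₚ.map⁺ (Allₚ.all-filter (λ e → g (proj₁ e) ≈0?) (nbrs v))) r)

        coplanar-neighbours : ∃[ x ] ∃[ i ] eval (∂ i F) (pt ℓ x) ≉0 →
          ∃[ A ] ∃[ B ] ∃[ C ] (A ≉0 × length (nbrs v) ℕ.≤ n ℕ.+ length (filter (coplanar? A B C) (nbrs v)))
        coplanar-neighbours (x , i , ne) with search (nbrs v) (λ e → g (proj₁ e))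
        ... | inj₁ found = collinear-at found
        ... | inj₂ g≈0   = contradiction (all-partials≈0 g≈0 i x) ne

    coplanar-neighbours-exist : ∀ n (F : Tri n) → OnLines F → ∃[ P ] eval F P ≉0 → 4 ℕ.* n ℕ.≤ m → 4 ℕ.* n ℕ.+ 4 ℕ.< p → ∃[ v ] v ∈ vs →
      ∃[ v ] ∃[ A ] ∃[ B ] ∃[ C ] (v ∈ vs × A ≉0 × length (nbrs v) ℕ.≤
        n ℕ.+ length (filter (λ (_ , w) → (A + B * (σ (lineOf w) - σ (lineOf v)) + C * (β (lineOf w) - β (lineOf v))) ≈0?) (nbrs v)))
    coplanar-neighbours-exist n F on (P , ne) 4n≤m 4n<p v₀
      with regular n F (ℕₚ.≤-trans (ℕₚ.+-monoˡ-≤ 4 (ℕₚ.m≤m+n n (3 ℕ.* n))) (ℕₚ.<⇒≤ 4n<p)) (ℕₚ.≤-trans (ℕₚ.m≤m+n n (3 ℕ.* n)) 4n≤m)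
             v₀ (λ {v} → on {v}) P ne
    ... | k , G , k≤n , onG , v , v∈ , x , i , ne′
      with coplanar-neighbours G (λ {v} → onG {v}) (ℕₚ.≤-trans (≤4* k) (ℕₚ.≤-trans (ℕₚ.*-monoʳ-≤ 4 k≤n) 4n≤m)) v∈
             (ℕₚ.≤-<-trans (ℕₚ.+-monoˡ-≤ 4 (ℕₚ.*-monoʳ-≤ 4 k≤n)) 4n<p) (x , i , ne′)
      where
      ≤4* : ∀ k → k ℕ.+ k ℕ.+ (k ℕ.+ k) ℕ.≤ 4 ℕ.* k
      ≤4* k = ℕₚ.≤-reflexive (trans (ℕₚ.+-assoc k k (k ℕ.+ k)) (cong (λ z → k ℕ.+ (k ℕ.+ (k ℕ.+ z))) (sym (ℕₚ.+-identityʳ k))))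
    ...   | A , B , C , A≉0 , le = v , A , B , C , v∈ , A≉0 , ℕₚ.≤-trans le (ℕₚ.+-monoˡ-≤ _ k≤n)

-- Counting in finite lists and pruning of graphs.

module _ {A : Set} where

  Unique-⊆-length : ∀ {xs ys : List A} → Unique xs → (∀ {x} → x ∈ xs → x ∈ ys) → length xs ℕ.≤ length ys
  Unique-⊆-length {[]} _ _ = z≤n
  Unique-⊆-length {x ∷ xs} {ys} (x# ∷ xs#) sub with ∈ₚ.∈-∃++ (sub (here refl))
  ... | as , bs , refl = ℕₚ.≤-trans (s≤s (Unique-⊆-length xs# sub′)) (ℕₚ.≤-reflexive
          (trans (cong suc (Listₚ.length-++ as)) (trans (sym (ℕₚ.+-suc (length as) (length bs))) (sym (Listₚ.length-++ as)))))
    where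
    sub′ : ∀ {y} → y ∈ xs → y ∈ as ++ bs
    sub′ y∈ with ∈ₚ.∈-++⁻ as (sub (there y∈))
    ... | inj₁ y∈as         = ∈ₚ.∈-++⁺ˡ y∈as
    ... | inj₂ (here refl)  = contradiction refl (All.lookup x# y∈)
    ... | inj₂ (there y∈bs) = ∈ₚ.∈-++⁺ʳ as y∈bs

module _ {A : Set} where

  injective-length : ∀ {B : Set} {xs : List A} {ys : List B} (f : A → B) → Unique xs →
    (∀ {x y} → x ∈ xs → y ∈ xs → f x ≡ f y → x ≡ y) → (∀ {x} → x ∈ xs → f x ∈ ys) → length xs ℕ.≤ length ys
  injective-length {xs = xs} f xs# inj into = subst (ℕ._≤ _) (Listₚ.length-map f xs)
    (Unique-⊆-length (AllPairsₚ.map⁺ (AllPairs-∈ xs# λ x∈ y∈ x≢y fx≡fy → x≢y (inj x∈ y∈ fx≡fy)))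
      λ z∈ → let x , x∈ , z≡ = ∈ₚ.∈-map⁻ f z∈ in subst (_∈ _) (sym z≡) (into x∈))

  count : ∀ {P : A → Set} → Decidable P → List A → ℕ
  count P? xs = length (filter P? xs)

  count-∷ : ∀ {P : A → Set} (P? : Decidable P) x xs → count P? (x ∷ xs) ≡ count P? (x ∷ []) ℕ.+ count P? xs
  count-∷ P? x xs with P? x
  ... | yes _ = refl
  ... | no  _ = refl

  count-⊎ : ∀ {P Q : A → Set} (P? : Decidable P) (Q? : Decidable Q) xs →
            count (λ x → P? x ⊎-dec Q? x) xs ℕ.≤ count P? xs ℕ.+ count Q? xs
  count-⊎ P? Q? [] = z≤n
  count-⊎ P? Q? (x ∷ xs) with P? x | Q? x | count-⊎ P? Q? xs
  ... | yes _ | yes _ | ih = s≤s (ℕₚ.≤-trans ih (ℕₚ.+-monoʳ-≤ _ (ℕₚ.n≤1+n _)))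
  ... | yes _ | no  _ | ih = s≤s ih
  ... | no  _ | yes _ | ih = ℕₚ.≤-trans (s≤s ih) (ℕₚ.≤-reflexive (sym (ℕₚ.+-suc _ _)))
  ... | no  _ | no  _ | ih = ih

  count-mono : ∀ {P Q : A → Set} (P? : Decidable P) (Q? : Decidable Q) xs → (∀ {x} → P x → Q x) → count P? xs ℕ.≤ count Q? xs
  count-mono P? Q? [] f = z≤n
  count-mono P? Q? (x ∷ xs) f with P? x | Q? x | count-mono P? Q? xs f
  ... | yes _ | yes _ | ih = s≤s ih
  ... | yes a | no ¬b | ih = contradiction (f a) ¬b
  ... | no  _ | yes _ | ih = ℕₚ.m≤n⇒m≤1+n ih
  ... | no  _ | no  _ | ih = ih

  count-Any : ∀ {B : Set} {Q : A → B → Set} (Q? : ∀ x y → Dec (Q x y)) (ys : List B) xs c →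
              (∀ {y} → y ∈ ys → count (λ x → Q? x y) xs ℕ.≤ c) →
              count (λ x → Any.any? (Q? x) ys) xs ℕ.≤ length ys ℕ.* c
  count-Any Q? [] xs c h = ℕₚ.≤-reflexive (cong length (Listₚ.filter-none (λ x → Any.any? (Q? x) []) {xs} (All.tabulate λ _ ())))
  count-Any Q? (y ∷ ys) xs c h = ℕₚ.≤-trans
    (count-mono (λ x → Any.any? (Q? x) (y ∷ ys)) (λ x → Q? x y ⊎-dec Any.any? (Q? x) ys) xs λ { (here q) → inj₁ q ; (there q) → inj₂ q })
    (ℕₚ.≤-trans (count-⊎ (λ x → Q? x y) (λ x → Any.any? (Q? x) ys) xs)
      (ℕₚ.+-mono-≤ (h (here refl)) (count-Any Q? ys xs c (λ y∈ → h (there y∈)))))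

  sum-map-mono : ∀ (f g : A → ℕ) xs → (∀ {x} → x ∈ xs → f x ℕ.≤ g x) → sum (map f xs) ℕ.≤ sum (map g xs)
  sum-map-mono f g [] h = z≤n
  sum-map-mono f g (x ∷ xs) h = ℕₚ.+-mono-≤ (h (here refl)) (sum-map-mono f g xs (λ x∈ → h (there x∈)))

  sum-map-const : ∀ c (xs : List A) → sum (map (λ _ → c) xs) ≡ length xs ℕ.* c
  sum-map-const c []       = refl
  sum-map-const c (x ∷ xs) = cong (c ℕ.+_) (sum-map-const c xs)

  sum-map-+ : ∀ (f g : A → ℕ) xs → sum (map (λ x → f x ℕ.+ g x) xs) ≡ sum (map f xs) ℕ.+ sum (map g xs)
  sum-map-+ f g []       = refl
  sum-map-+ f g (x ∷ xs) = trans (cong (f x ℕ.+ g x ℕ.+_) (sum-map-+ f g xs))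
    (interchange (f x) (g x) (sum (map f xs)) (sum (map g xs)))
    where
    interchange : ∀ a b c d → a ℕ.+ b ℕ.+ (c ℕ.+ d) ≡ a ℕ.+ c ℕ.+ (b ℕ.+ d)
    interchange = NatSolver.solve-∀

  sum-average : ∀ (f : A → ℕ) x xs → ∃[ z ] z ∈ x ∷ xs × length (x ∷ xs) ℕ.* f z ℕ.≤ sum (map f (x ∷ xs))
  sum-average f x [] = x , here refl , ℕₚ.≤-refl
  sum-average f x (y ∷ ys) with sum-average f y ys
  ... | z , z∈ , le with ℕₚ.≤-total (f x) (f z)
  ...   | inj₁ fx≤fz = x , here refl , ℕₚ.+-monoʳ-≤ (f x) (ℕₚ.≤-trans (ℕₚ.*-monoʳ-≤ (length (y ∷ ys)) fx≤fz) le)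
  ...   | inj₂ fz≤fx = z , there z∈ , ℕₚ.+-mono-≤ fz≤fx le

sum-count-swap : ∀ {A B : Set} {Q : A → B → Set} (Q? : ∀ x y → Dec (Q x y)) xs ys →
  sum (map (λ x → count (Q? x) ys) xs) ≡ sum (map (λ y → count (λ x → Q? x y) xs) ys)
sum-count-swap Q? [] ys = sym (trans (sum-map-const 0 ys) (ℕₚ.*-zeroʳ (length ys)))
sum-count-swap Q? (x ∷ xs) ys = trans (cong₂ ℕ._+_ (single ys) (sum-count-swap Q? xs ys))
  (trans (sym (sum-map-+ (λ y → count (λ x → Q? x y) (x ∷ [])) (λ y → count (λ x → Q? x y) xs) ys))
         (cong sum (Listₚ.map-cong (λ y → sym (count-∷ (λ x → Q? x y) x xs)) ys)))
  where
  one : ∀ y → count (Q? x) (y ∷ []) ≡ count (λ x → Q? x y) (x ∷ [])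
  one y with Q? x y
  ... | yes _ = refl
  ... | no  _ = refl
  single : ∀ ys → count (Q? x) ys ≡ sum (map (λ y → count (λ x → Q? x y) (x ∷ [])) ys)
  single []       = refl
  single (y ∷ ys) = trans (count-∷ (Q? x) y ys) (cong₂ ℕ._+_ (one y) (single ys))

average-count : ∀ {A B : Set} {Q : A → B → Set} (Q? : ∀ x y → Dec (Q x y)) xs ys c → 0 ℕ.< length xs →
  (∀ {y} → y ∈ ys → count (λ x → Q? x y) xs ℕ.≤ c) →
  ∃[ x ] x ∈ xs × length xs ℕ.* count (Q? x) ys ℕ.≤ length ys ℕ.* c
average-count Q? (x ∷ xs) ys c _ h with sum-average (λ x → count (Q? x) ys) x xs
... | z , z∈ , le = z , z∈ , ℕₚ.≤-trans le (ℕₚ.≤-trans (ℕₚ.≤-reflexive (sum-count-swap Q? (x ∷ xs) ys))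
  (ℕₚ.≤-trans (sum-map-mono (λ y → count (λ x → Q? x y) (_ ∷ _)) (λ _ → c) ys h) (ℕₚ.≤-reflexive (sum-map-const c ys))))

count-split : ∀ {A : Set} {P : A → Set} (P? : Decidable P) xs → length xs ≡ count P? xs ℕ.+ count (λ x → ¬? (P? x)) xs
count-split P? [] = refl
count-split P? (x ∷ xs) with P? x
... | yes _ = cong suc (count-split P? xs)
... | no  _ = trans (cong suc (count-split P? xs)) (sym (ℕₚ.+-suc _ _))

2ab≤a²+b² : ∀ a b → 2 ℕ.* (a ℕ.* b) ℕ.≤ a ℕ.* a ℕ.+ b ℕ.* b
2ab≤a²+b² a b with ℕₚ.≤-total a b
... | inj₁ a≤b = go a (b ℕ.∸ a) (ℕₚ.m+[n∸m]≡n a≤b)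
  where
  go : ∀ a c {b} → a ℕ.+ c ≡ b → 2 ℕ.* (a ℕ.* b) ℕ.≤ a ℕ.* a ℕ.+ b ℕ.* b
  go a c refl = ℕₚ.≤-trans (ℕₚ.m≤m+n _ (c ℕ.* c)) (ℕₚ.≤-reflexive (eq a c))
    where eq : ∀ a c → 2 ℕ.* (a ℕ.* (a ℕ.+ c)) ℕ.+ c ℕ.* c ≡ a ℕ.* a ℕ.+ (a ℕ.+ c) ℕ.* (a ℕ.+ c)
          eq = NatSolver.solve-∀
... | inj₂ b≤a = go b (a ℕ.∸ b) (ℕₚ.m+[n∸m]≡n b≤a)
  where
  go : ∀ b c {a} → b ℕ.+ c ≡ a → 2 ℕ.* (a ℕ.* b) ℕ.≤ a ℕ.* a ℕ.+ b ℕ.* b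
  go b c refl = ℕₚ.≤-trans (ℕₚ.m≤m+n _ (c ℕ.* c)) (ℕₚ.≤-reflexive (eq b c))
    where eq : ∀ b c → 2 ℕ.* ((b ℕ.+ c) ℕ.* b) ℕ.+ c ℕ.* c ≡ (b ℕ.+ c) ℕ.* (b ℕ.+ c) ℕ.+ b ℕ.* b
          eq = NatSolver.solve-∀

private
  -- The cross term 2ab, multiplied by the number of classes, is bounded by the inequality of means
  -- for that multiple of a and b; this avoids division.
  cauchy-step : ∀ K a b P → b ℕ.* b ℕ.≤ K ℕ.* P → (a ℕ.+ b) ℕ.* (a ℕ.+ b) ℕ.≤ suc K ℕ.* (a ℕ.* a ℕ.+ P)
  cauchy-step zero a zero P _ = ℕₚ.≤-trans (ℕₚ.≤-reflexive (eq a)) (ℕₚ.≤-trans (ℕₚ.m≤m+n (a ℕ.* a) P) (ℕₚ.≤-reflexive (sym (ℕₚ.*-identityˡ _))))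
    where eq : ∀ a → (a ℕ.+ 0) ℕ.* (a ℕ.+ 0) ≡ a ℕ.* a
          eq = NatSolver.solve-∀
  cauchy-step (suc K) a b P b²≤ = ℕₚ.≤-trans (ℕₚ.≤-reflexive (expand a b)) (ℕₚ.≤-trans
    (ℕₚ.+-mono-≤ (ℕₚ.+-monoʳ-≤ (a ℕ.* a) cross) b²≤) (ℕₚ.≤-reflexive (collect K a P)))
    where
    expand : ∀ a b → (a ℕ.+ b) ℕ.* (a ℕ.+ b) ≡ a ℕ.* a ℕ.+ 2 ℕ.* (a ℕ.* b) ℕ.+ b ℕ.* b
    expand = NatSolver.solve-∀
    collect : ∀ K a P → a ℕ.* a ℕ.+ (P ℕ.+ suc K ℕ.* (a ℕ.* a)) ℕ.+ suc K ℕ.* P ≡ suc (suc K) ℕ.* (a ℕ.* a ℕ.+ P)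
    collect = NatSolver.solve-∀
    cross : 2 ℕ.* (a ℕ.* b) ℕ.≤ P ℕ.+ suc K ℕ.* (a ℕ.* a)
    cross = ℕₚ.*-cancelˡ-≤ (suc K) (ℕₚ.≤-trans (ℕₚ.≤-reflexive (eq₁ K a b)) (ℕₚ.≤-trans (2ab≤a²+b² (suc K ℕ.* a) b)
      (ℕₚ.≤-trans (ℕₚ.+-monoʳ-≤ (suc K ℕ.* a ℕ.* (suc K ℕ.* a)) b²≤) (ℕₚ.≤-reflexive (eq₂ K a P)))))
      where
      eq₁ : ∀ K a b → suc K ℕ.* (2 ℕ.* (a ℕ.* b)) ≡ 2 ℕ.* (suc K ℕ.* a ℕ.* b)
      eq₁ = NatSolver.solve-∀
      eq₂ : ∀ K a P → suc K ℕ.* a ℕ.* (suc K ℕ.* a) ℕ.+ suc K ℕ.* P ≡ suc K ℕ.* (P ℕ.+ suc K ℕ.* (a ℕ.* a))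
      eq₂ = NatSolver.solve-∀

module _ {A : Set} (key : A → ℕ) where

  samePairs : List A → List (A × A)
  samePairs xs = filter (λ (x , y) → key x ℕ.≟ key y) (cartesianProduct xs xs)

  cauchy-schwarz : ∀ {xs} (ks : List ℕ) → Unique xs → (∀ {x} → x ∈ xs → key x ∈ ks) →
    length xs ℕ.* length xs ℕ.≤ length ks ℕ.* length (samePairs xs)
  cauchy-schwarz {[]}    []       _   _  = z≤n
  cauchy-schwarz {x ∷ _} []       _   h with () ← h (here refl)
  cauchy-schwarz {xs}    (k ∷ ks) xs# h = ℕₚ.≤-trans
    (ℕₚ.≤-reflexive (cong (λ n → n ℕ.* n) (count-split at? xs)))
    (ℕₚ.≤-trans (cauchy-step (length ks) (length xs₁) (length xs₂) (length (samePairs xs₂)) (cauchy-schwarz ks xs₂# h₂))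
      (ℕₚ.*-monoʳ-≤ (suc (length ks)) split))
    where
    at? = λ x → key x ℕ.≟ k
    xs₁ = filter at? xs
    xs₂ = filter (λ x → ¬? (at? x)) xs
    xs₁# = Uniqueₚ.filter⁺ at? xs#
    xs₂# = Uniqueₚ.filter⁺ (λ x → ¬? (at? x)) xs#
    h₂ : ∀ {x} → x ∈ xs₂ → key x ∈ ks
    h₂ x∈ with ∈ₚ.∈-filter⁻ (λ x → ¬? (at? x)) x∈
    ... | x∈xs , ≢k with h x∈xs
    ...   | here ≡k  = contradiction ≡k ≢k
    ...   | there ∈k = ∈k
    same? : Decidable (λ (x , y) → key x ≡ key y)
    same? (x , y) = key x ℕ.≟ key y
    split : length xs₁ ℕ.* length xs₁ ℕ.+ length (samePairs xs₂) ℕ.≤ length (samePairs xs)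
    split = ℕₚ.≤-trans (ℕₚ.≤-reflexive (trans (cong (ℕ._+ length (samePairs xs₂)) (sym (length-cartesianProduct xs₁ xs₁)))
                                             (sym (Listₚ.length-++ (cartesianProduct xs₁ xs₁)))))
      (Unique-⊆-length (Uniqueₚ.++⁺ (Uniqueₚ.cartesianProduct⁺ xs₁# xs₁#) (Uniqueₚ.filter⁺ same? (Uniqueₚ.cartesianProduct⁺ xs₂# xs₂#)) disjoint) sub)
      where
      disjoint : ∀ {z} → ¬ (z ∈ cartesianProduct xs₁ xs₁ × z ∈ samePairs xs₂)
      disjoint (z∈₁ , z∈₂) = proj₂ (∈ₚ.∈-filter⁻ (λ x → ¬? (at? x)) {xs = xs} (proj₁ (∈ₚ.∈-cartesianProduct⁻ xs₂ xs₂ (proj₁ (∈ₚ.∈-filter⁻ same? z∈₂)))))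
        (proj₂ (∈ₚ.∈-filter⁻ at? {xs = xs} (proj₁ (∈ₚ.∈-cartesianProduct⁻ xs₁ xs₁ z∈₁))))
      sub : ∀ {z} → z ∈ cartesianProduct xs₁ xs₁ ++ samePairs xs₂ → z ∈ samePairs xs
      sub z∈ with ∈ₚ.∈-++⁻ (cartesianProduct xs₁ xs₁) z∈
      ... | inj₁ z∈₁ with ∈ₚ.∈-cartesianProduct⁻ xs₁ xs₁ z∈₁
      ...   | x∈ , y∈ with ∈ₚ.∈-filter⁻ at? {xs = xs} x∈ | ∈ₚ.∈-filter⁻ at? {xs = xs} y∈
      ...     | x∈′ , x≡ | y∈′ , y≡ = ∈ₚ.∈-filter⁺ same? (∈ₚ.∈-cartesianProduct⁺ x∈′ y∈′) (trans x≡ (sym y≡))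
      sub z∈ | inj₂ z∈₂ with ∈ₚ.∈-filter⁻ same? {xs = cartesianProduct xs₂ xs₂} z∈₂
      ... | z∈₂′ , z≡ with ∈ₚ.∈-cartesianProduct⁻ xs₂ xs₂ z∈₂′
      ...   | x∈ , y∈ = ∈ₚ.∈-filter⁺ same? (∈ₚ.∈-cartesianProduct⁺ (proj₁ (∈ₚ.∈-filter⁻ (λ x → ¬? (at? x)) {xs = xs} x∈))
                                                                (proj₁ (∈ₚ.∈-filter⁻ (λ x → ¬? (at? x)) {xs = xs} y∈))) z≡

module _ {E U : Set} (_≟U_ : DecidableEquality U) (end : Bool → E → U) where

  degree : List E → Bool × U → ℕ
  degree G (s , u) = count (λ e → end s e ≟U u) G

  -- Removing a vertex of degree below m destroys fewer than m edges. Removing all n vertices would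
  -- thus destroy at most mn edges, so the process stops with edges left.
  prune : ∀ n m (vs : List (Bool × U)) (G : List E) → length vs ≡ n → Unique G →
    (∀ {e} → e ∈ G → ∀ s → (s , end s e) ∈ vs) → m ℕ.* n ℕ.< length G →
    ∃[ G′ ] (Unique G′ × (∀ {e} → e ∈ G′ → e ∈ G) × 0 ℕ.< length G′ × (∀ {e} → e ∈ G′ → ∀ s → m ℕ.≤ degree G′ (s , end s e)))
  prune n m vs G |vs| G# ends lt with Any.any? (λ v → degree G v ℕ.<? m) vs
  ... | no ¬low = G , G# , id , ℕₚ.≤-<-trans z≤n lt , λ e∈ s → ℕₚ.≮⇒≥ λ low → ¬low (lose (ends e∈ s) low)
  ... | yes low with find low
  ...   | (s , u) , v∈ , deg<m with ∈ₚ.∈-∃++ v∈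
  prune zero m .(as ++ (s , u) ∷ bs) G |vs| G# ends lt | yes low | (s , u) , v∈ , deg<m | as , bs , refl
    with () ← trans (sym |vs|) (trans (Listₚ.length-++ as) (ℕₚ.+-suc (length as) (length bs)))
  prune (suc n) m .(as ++ (s , u) ∷ bs) G |vs| G# ends lt | yes low | (s , u) , v∈ , deg<m | as , bs , refl
    with prune n m (as ++ bs) G₁ |vs₁| (Uniqueₚ.filter⁺ away? G#) ends₁ lt₁
    where
    away? : Decidable (λ e → ¬ end s e ≡ u)
    away? e = ¬? (end s e ≟U u)
    G₁ = filter away? G
    |vs₁| : length (as ++ bs) ≡ n
    |vs₁| = ℕₚ.suc-injective (trans (trans (cong suc (Listₚ.length-++ as)) (sym (ℕₚ.+-suc (length as) (length bs)))) (trans (sym (Listₚ.length-++ as)) |vs|))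
    ends₁ : ∀ {e} → e ∈ G₁ → ∀ t → (t , end t e) ∈ as ++ bs
    ends₁ {e} e∈ t with ∈ₚ.∈-filter⁻ away? {xs = G} e∈
    ... | e∈G , e≢ with ∈ₚ.∈-++⁻ as (ends e∈G t)
    ...   | inj₁ i         = ∈ₚ.∈-++⁺ˡ i
    ...   | inj₂ (here refl) = contradiction refl e≢
    ...   | inj₂ (there i) = ∈ₚ.∈-++⁺ʳ as i
    lt₁ : m ℕ.* n ℕ.< length G₁
    lt₁ = ℕₚ.+-cancelˡ-< m _ _ (ℕₚ.≤-<-trans (ℕₚ.≤-reflexive (sym (ℕₚ.*-suc m n)))
      (ℕₚ.<-≤-trans lt (ℕₚ.≤-trans (ℕₚ.≤-reflexive (count-split (λ e → end s e ≟U u) G)) (ℕₚ.+-monoˡ-≤ (length G₁) (ℕₚ.<⇒≤ deg<m)))))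
  ... | G′ , G′# , sub , ne , rich = G′ , G′# , (λ e∈ → proj₁ (∈ₚ.∈-filter⁻ (λ e → ¬? (end s e ≟U u)) (sub e∈))) , ne , rich

taggedPairs : ∀ {A B : Set} → (A → List B) → List A → List (A × B)
taggedPairs f = concatMap (λ x → map (x ,_) (f x))

taggedPairs-length : ∀ {A B : Set} (f : A → List B) xs → length (taggedPairs f xs) ≡ sum (map (λ x → length (f x)) xs)
taggedPairs-length f []       = refl
taggedPairs-length f (x ∷ xs) = trans (Listₚ.length-++ (map (x ,_) (f x))) (cong₂ ℕ._+_ (Listₚ.length-map (x ,_) (f x)) (taggedPairs-length f xs))

taggedPairs⁻ : ∀ {A B : Set} (f : A → List B) xs {z} → z ∈ taggedPairs f xs → proj₁ z ∈ xs × proj₂ z ∈ f (proj₁ z)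
taggedPairs⁻ f (x ∷ xs) z∈ with ∈ₚ.∈-++⁻ (map (x ,_) (f x)) z∈
... | inj₂ z∈xs = let x∈ , y∈ = taggedPairs⁻ f xs z∈xs in there x∈ , y∈
... | inj₁ z∈x with ∈ₚ.∈-map⁻ (x ,_) z∈x
...   | y , y∈ , refl = here refl , y∈

taggedPairs-unique : ∀ {A B : Set} (f : A → List B) xs → Unique xs → (∀ x → Unique (f x)) → Unique (taggedPairs f xs)
taggedPairs-unique f [] _ _ = []
taggedPairs-unique f (x ∷ xs) (x# ∷ xs#) f# = Uniqueₚ.++⁺ (AllPairsₚ.map⁺ (AllPairs.map (λ y≢ e → y≢ (cong proj₂ e)) (f# x)))
  (taggedPairs-unique f xs xs# f#) λ (z∈x , z∈xs) → let y , _ , e = ∈ₚ.∈-map⁻ (x ,_) z∈x in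
    All.lookup x# (proj₁ (taggedPairs⁻ f xs z∈xs)) (sym (cong proj₁ e))

incompatible : ∀ {A : Set} {R : A → A → Set} {xs} → AllPairs R xs → (∀ {x y} → x ∈ xs → y ∈ xs → ¬ R x y) → length xs ℕ.≤ 1
incompatible {xs = []}        _             _ = z≤n
incompatible {xs = _ ∷ []}    _             _ = s≤s z≤n
incompatible {xs = _ ∷ _ ∷ _} ((r ∷ _) ∷ _) h = contradiction r (h (here refl) (there (here refl)))

at-most-one : ∀ {A : Set} {xs : List A} → Unique xs → (∀ {x y} → x ∈ xs → y ∈ xs → x ≡ y) → length xs ℕ.≤ 1
at-most-one xs# all = incompatible xs# λ x∈ y∈ x≢y → x≢y (all x∈ y∈)

-- From incidences in a grid to meetings of isotropic lines.

-- An edge ((a, b), (a′, b′)), (s, s′) joins the lines through (a, b) of slope s and through (a′, b′) of slope s′.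
Edge : Set
Edge = ((ℕ × ℕ) × (ℕ × ℕ)) × (ℕ × ℕ)

module Grid (p : ℕ) (p-prime : Prime p) where
  open Modular p p-prime
  open Roots p p-prime
  open Vanishing p p-prime
  open LineConfiguration p p-prime

  private
    quotient-spec : ∀ D n → D ≉0 → (D * (n * reciprocal D) - n) ≈0
    quotient-spec D n D≉0 = lin₁ (reciprocal-spec D D≉0) n (eq D n (reciprocal D))
      where
      eq : ∀ D n r → D * (n * r) - n ≡ n * (D * r - 1ℤ)
      eq = solve-∀

    meeting-identity : ∀ a b b′ s s′ ν x t t′ → ((b - b′) * x - (s′ + ν - s)) ≈0 → (a - s * b - t) ≈0 → (a - s′ * b′ - t′) ≈0 →
      ((b - b′) * (b′ * x - s) + (t′ - (t + ν * b′))) ≈0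
    meeting-identity a b b′ s s′ ν x t t′ u v w = lin₃ u v w b′ 1ℤ (- 1ℤ) (eq a b b′ s s′ ν x t t′)
      where
      eq : ∀ a b b′ s s′ ν x t t′ → (b - b′) * (b′ * x - s) + (t′ - (t + ν * b′)) ≡
           b′ * ((b - b′) * x - (s′ + ν - s)) + 1ℤ * (a - s * b - t) + - 1ℤ * (a - s′ * b′ - t′)
      eq = solve-∀

    collision-identity : ∀ D D₁ n n₁ x x₁ → (D * x - n) ≈0 → (D₁ * x₁ - n₁) ≈0 → (x₁ - x) ≈0 → (n₁ * D - n * D₁) ≈0
    collision-identity D D₁ n n₁ x x₁ u v w = lin₃ u v w D₁ (- D) (D₁ * D) (eq D D₁ n n₁ x x₁)
      where
      eq : ∀ D D₁ n n₁ x x₁ → n₁ * D - n * D₁ ≡ D₁ * (D * x - n) + - D * (D₁ * x₁ - n₁) + D₁ * D * (x₁ - x)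
      eq = solve-∀

    numerator-identity : ∀ D n n₁ x x₁ → (D * x - n) ≈0 → (D * x₁ - n₁) ≈0 → (x₁ - x) ≈0 → (n₁ - n) ≈0
    numerator-identity D n n₁ x x₁ u v w = lin₃ u v w 1ℤ (- 1ℤ) D (eq D n n₁ x x₁)
      where
      eq : ∀ D n n₁ x x₁ → n₁ - n ≡ 1ℤ * (D * x - n) + - 1ℤ * (D * x₁ - n₁) + D * (x₁ - x)
      eq = solve-∀

  intercept : ℕ → ℕ × ℕ → ℕ
  intercept s (a , b) = res (+ a - + s * + b)

  -- The ordinates are crossed: each slope is paired with the ordinate of the other incidence. With
  -- `β = b′`, `σ = s` and `β′ = b`, `σ′ = s′`, the equality `sb + t = s′b′ + t′` becomes the
  -- meeting equation `βσ′ − σβ′ + τ′ − τ = 0`. Adding `ν` to `σ′` and `νβ` to `τ` leaves it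
  -- unchanged.
  end : Bool → Edge → ℕ × (ℕ × ℕ)
  end true  ((e , e′) , (s , s′)) = proj₂ e′ , s , intercept s e
  end false ((e , e′) , (s , s′)) = proj₂ e , s′ , intercept s′ e′

  numerator : ℕ → Edge → ℤ
  numerator ν ((e , e′) , (s , s′)) = + s′ + + ν - + s

  denominator : Edge → ℤ
  denominator ((e , e′) , (s , s′)) = + proj₂ e - + proj₂ e′

  abscissa : ℕ → Edge → ℤ
  abscissa ν ε = numerator ν ε * reciprocal (denominator ε)

  -- The shift by ν makes distinct incidences on a line meet it at distinct points, for most of them.
  lineOf : ℕ → Bool × (ℕ × (ℕ × ℕ)) → Line
  lineOf ν (true  , β , s , t) = line (+ β) (+ s) (+ t + + ν * + β)
  lineOf ν (false , β , s , t) = line (+ β) (+ s + + ν) (+ t)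

  module _ (pts : List (ℕ × ℕ)) (As Bs S : List ℕ) (T : ℕ → List ℕ) (d : ℕ)
    (pts# : Unique pts) (Bs# : Unique Bs) (S# : Unique S)
    (As<p : ∀ {a} → a ∈ As → a ℕ.< p) (Bs<p : ∀ {b} → b ∈ Bs → b ℕ.< p) (S<p : ∀ {s} → s ∈ S → s ℕ.< p)
    (|As| : length As ℕ.≤ d) (|Bs| : length Bs ℕ.≤ d) (|T| : ∀ {s} → s ∈ S → length (T s) ℕ.≤ d)
    (pts⊆ : ∀ {e} → e ∈ pts → proj₁ e ∈ As × proj₂ e ∈ Bs) (T∋ : ∀ {e s} → e ∈ pts → s ∈ S → intercept s e ∈ T s)
    where

    private
      k = length S

      Good : (ℕ × ℕ) × (ℕ × ℕ) → Set
      Good (e , e′) = proj₁ e ≡ proj₁ e′ × proj₂ e ≢ proj₂ e′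

      good? : Decidable Good
      good? (e , e′) = (proj₁ e ℕ.≟ proj₁ e′) ×-dec ¬? (proj₂ e ℕ.≟ proj₂ e′)

    goodPairs : List ((ℕ × ℕ) × (ℕ × ℕ))
    goodPairs = filter good? (cartesianProduct pts pts)

    edges : List Edge
    edges = cartesianProduct goodPairs (cartesianProduct S S)

    private
      edges# : Unique edges
      edges# = Uniqueₚ.cartesianProduct⁺ (Uniqueₚ.filter⁺ good? (Uniqueₚ.cartesianProduct⁺ pts# pts#)) (Uniqueₚ.cartesianProduct⁺ S# S#)

      record Valid (ε : Edge) : Set where
        field
          e∈  : proj₁ (proj₁ ε) ∈ pts
          e′∈ : proj₂ (proj₁ ε) ∈ pts
          s∈  : proj₁ (proj₂ ε) ∈ S
          s′∈ : proj₂ (proj₂ ε) ∈ S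
          a≡  : proj₁ (proj₁ (proj₁ ε)) ≡ proj₁ (proj₂ (proj₁ ε))
          b≢  : proj₂ (proj₁ (proj₁ ε)) ≢ proj₂ (proj₂ (proj₁ ε))

      valid : ∀ {ε} → ε ∈ edges → Valid ε
      valid {ε} ε∈ with ∈ₚ.∈-cartesianProduct⁻ goodPairs (cartesianProduct S S) ε∈
      ... | g∈ , ss∈ with ∈ₚ.∈-filter⁻ good? {xs = cartesianProduct pts pts} g∈ | ∈ₚ.∈-cartesianProduct⁻ S S ss∈
      ...   | pp∈ , a≡ , b≢ | s∈ , s′∈ with ∈ₚ.∈-cartesianProduct⁻ pts pts pp∈
      ...     | e∈ , e′∈ = record { e∈ = e∈ ; e′∈ = e′∈ ; s∈ = s∈ ; s′∈ = s′∈ ; a≡ = a≡ ; b≢ = b≢ }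

    -- Cauchy-Schwarz over the at most d values of a. The summand `length pts` pays for the pairs of
    -- equal points, which give parallel lines.
    goodPairs-many : length pts ℕ.* length pts ℕ.≤ d ℕ.* (length goodPairs ℕ.+ length pts)
    goodPairs-many = ℕₚ.≤-trans (cauchy-schwarz proj₁ As pts# (λ e∈ → proj₁ (pts⊆ e∈)))
      (ℕₚ.*-mono-≤ |As| (ℕₚ.≤-trans (ℕₚ.≤-trans
        (count-mono (λ (e , e′) → proj₁ e ℕ.≟ proj₁ e′) (λ ee → good? ee ⊎-dec diagonal? ee) (cartesianProduct pts pts) split)
        (count-⊎ good? diagonal? (cartesianProduct pts pts))) (ℕₚ.+-monoʳ-≤ (length goodPairs) diagonal-few)))
      where
      Diagonal : (ℕ × ℕ) × (ℕ × ℕ) → Set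
      Diagonal (e , e′) = proj₁ e ≡ proj₁ e′ × proj₂ e ≡ proj₂ e′
      diagonal? : Decidable Diagonal
      diagonal? (e , e′) = (proj₁ e ℕ.≟ proj₁ e′) ×-dec (proj₂ e ℕ.≟ proj₂ e′)
      split : ∀ {ee} → proj₁ (proj₁ ee) ≡ proj₁ (proj₂ ee) → Good ee ⊎ Diagonal ee
      split {(a , b) , (a′ , b′)} a≡ with b ℕ.≟ b′
      ... | yes b≡ = inj₂ (a≡ , b≡)
      ... | no  b≢ = inj₁ (a≡ , b≢)
      diagonal-few : count diagonal? (cartesianProduct pts pts) ℕ.≤ length pts
      diagonal-few = injective-length proj₁ (Uniqueₚ.filter⁺ diagonal? (Uniqueₚ.cartesianProduct⁺ pts# pts#))
        (λ {x} {y} x∈ y∈ → inj (proj₂ (∈ₚ.∈-filter⁻ diagonal? {xs = cartesianProduct pts pts} x∈)) (proj₂ (∈ₚ.∈-filter⁻ diagonal? {xs = cartesianProduct pts pts} y∈)))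
        (λ x∈ → proj₁ (∈ₚ.∈-cartesianProduct⁻ pts pts (proj₁ (∈ₚ.∈-filter⁻ diagonal? {xs = cartesianProduct pts pts} x∈))))
        where
        inj : ∀ {x y} → Diagonal x → Diagonal y → proj₁ x ≡ proj₁ y → x ≡ y
        inj {(a , b) , _} {(_ , _) , _} (refl , refl) (refl , refl) refl = refl

    private
      -- Another candidate partner would meet the line at the same abscissa: `Clash₁` refers to the
      -- line of kind `true`, `Clash₂` to the one of kind `false`. The equations are
      -- cross-multiplied quotients, linear in ν with leading coefficient `b − b₁` or `b₁ − b′` up
      -- to sign, so each excludes a single ν.
      Clash₁ Clash₂ : (b b′ s s′ s₁ b₁ ν : ℕ) → Set
      Clash₁ b b′ s s′ s₁ b₁ ν = b₁ ≢ b  × ((+ s₁ + + ν - + s) * (+ b - + b′) - (+ s′ + + ν - + s) * (+ b₁ - + b′)) ≈0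
      Clash₂ b b′ s s′ s₁ b₁ ν = b₁ ≢ b′ × ((+ s′ + + ν - + s₁) * (+ b - + b′) - (+ s′ + + ν - + s) * (+ b - + b₁)) ≈0

      clash₁? : ∀ b b′ s s′ s₁ b₁ → Decidable (Clash₁ b b′ s s′ s₁ b₁)
      clash₁? b b′ s s′ s₁ b₁ ν = ¬? (b₁ ℕ.≟ b) ×-dec (((+ s₁ + + ν - + s) * (+ b - + b′) - (+ s′ + + ν - + s) * (+ b₁ - + b′)) ≈0?)

      clash₂? : ∀ b b′ s s′ s₁ b₁ → Decidable (Clash₂ b b′ s s′ s₁ b₁)
      clash₂? b b′ s s′ s₁ b₁ ν = ¬? (b₁ ℕ.≟ b′) ×-dec (((+ s′ + + ν - + s₁) * (+ b - + b′) - (+ s′ + + ν - + s) * (+ b - + b₁)) ≈0?)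

      Clash : ℕ → Edge → ℕ × ℕ → Set
      Clash ν (((_ , b) , (_ , b′)) , (s , s′)) (s₁ , b₁) = Clash₁ b b′ s s′ s₁ b₁ ν ⊎ Clash₂ b b′ s s′ s₁ b₁ ν

      clash? : ∀ ν ε q → Dec (Clash ν ε q)
      clash? ν (((_ , b) , (_ , b′)) , (s , s′)) (s₁ , b₁) = clash₁? b b′ s s′ s₁ b₁ ν ⊎-dec clash₂? b b′ s s′ s₁ b₁ ν

      SB : List (ℕ × ℕ)
      SB = cartesianProduct S Bs

      bad? : ∀ ν ε → Dec (Any (Clash ν ε) SB)
      bad? ν ε = Any.any? (clash? ν ε) SB

      clash₁-unique : ∀ ν ν′ b b′ b₁ s s′ s₁ → (b - b₁) ≉0 → ((s₁ + ν - s) * (b - b′) - (s′ + ν - s) * (b₁ - b′)) ≈0 →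
        ((s₁ + ν′ - s) * (b - b′) - (s′ + ν′ - s) * (b₁ - b′)) ≈0 → (ν - ν′) ≈0
      clash₁-unique ν ν′ b b′ b₁ s s′ s₁ b≢ u v = cancelˡ (b - b₁) b≢ (lin₂ u v 1ℤ (- 1ℤ) (eq ν ν′ b b′ b₁ s s′ s₁))
        where
        eq : ∀ ν ν′ b b′ b₁ s s′ s₁ → (b - b₁) * (ν - ν′) ≡ 1ℤ * ((s₁ + ν - s) * (b - b′) - (s′ + ν - s) * (b₁ - b′)) +
               - 1ℤ * ((s₁ + ν′ - s) * (b - b′) - (s′ + ν′ - s) * (b₁ - b′))
        eq = solve-∀

      clash₂-unique : ∀ ν ν′ b b′ b₁ s s′ s₁ → (b₁ - b′) ≉0 → ((s′ + ν - s₁) * (b - b′) - (s′ + ν - s) * (b - b₁)) ≈0 →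
        ((s′ + ν′ - s₁) * (b - b′) - (s′ + ν′ - s) * (b - b₁)) ≈0 → (ν - ν′) ≈0
      clash₂-unique ν ν′ b b′ b₁ s s′ s₁ b≢ u v = cancelˡ (b₁ - b′) b≢ (lin₂ u v 1ℤ (- 1ℤ) (eq ν ν′ b b′ b₁ s s′ s₁))
        where
        eq : ∀ ν ν′ b b′ b₁ s s′ s₁ → (b₁ - b′) * (ν - ν′) ≡ 1ℤ * ((s′ + ν - s₁) * (b - b′) - (s′ + ν - s) * (b - b₁)) +
               - 1ℤ * ((s′ + ν′ - s₁) * (b - b′) - (s′ + ν′ - s) * (b - b₁))
        eq = solve-∀

      ≢⇒≉ : ∀ {m n} → m ℕ.< p → n ℕ.< p → m ≢ n → (+ m - + n) ≉0
      ≢⇒≉ m< n< m≢n m≈n = m≢n (≈⇒≡ m< n< m≈n)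

      few-clashes : ∀ {ε} → ε ∈ edges → ∀ {q} → q ∈ SB → count (λ ν → clash? ν ε q) (upTo p) ℕ.≤ 2
      few-clashes {ε@(((a , b) , (a′ , b′)) , (s , s′))} ε∈ {s₁ , b₁} q∈ =
        ℕₚ.≤-trans (count-⊎ (clash₁? b b′ s s′ s₁ b₁) (clash₂? b b′ s s′ s₁ b₁) (upTo p)) (ℕₚ.+-mono-≤ few₁ few₂)
        where
        module v = Valid (valid ε∈)
        b< = Bs<p (proj₂ (pts⊆ v.e∈))
        b′< = Bs<p (proj₂ (pts⊆ v.e′∈))
        b₁< = Bs<p (proj₂ (∈ₚ.∈-cartesianProduct⁻ S Bs q∈))
        few₁ : count (clash₁? b b′ s s′ s₁ b₁) (upTo p) ℕ.≤ 1
        few₁ = at-most-one (Uniqueₚ.filter⁺ (clash₁? b b′ s s′ s₁ b₁) (Uniqueₚ.upTo⁺ p)) λ {ν} {ν′} ν∈ ν′∈ →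
          let ν<  , ≢ , u = ∈ₚ.∈-filter⁻ (clash₁? b b′ s s′ s₁ b₁) {xs = upTo p} ν∈
              ν′< , _ , w = ∈ₚ.∈-filter⁻ (clash₁? b b′ s s′ s₁ b₁) {xs = upTo p} ν′∈
          in ≈⇒≡ (∈ₚ.∈-upTo⁻ ν<) (∈ₚ.∈-upTo⁻ ν′<)
               (clash₁-unique (+ ν) (+ ν′) (+ b) (+ b′) (+ b₁) (+ s) (+ s′) (+ s₁) (≢⇒≉ b< b₁< (λ e → ≢ (sym e))) u w)
        few₂ : count (clash₂? b b′ s s′ s₁ b₁) (upTo p) ℕ.≤ 1
        few₂ = at-most-one (Uniqueₚ.filter⁺ (clash₂? b b′ s s′ s₁ b₁) (Uniqueₚ.upTo⁺ p)) λ {ν} {ν′} ν∈ ν′∈ →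
          let ν<  , ≢ , u = ∈ₚ.∈-filter⁻ (clash₂? b b′ s s′ s₁ b₁) {xs = upTo p} ν∈
              ν′< , _ , w = ∈ₚ.∈-filter⁻ (clash₂? b b′ s s′ s₁ b₁) {xs = upTo p} ν′∈
          in ≈⇒≡ (∈ₚ.∈-upTo⁻ ν<) (∈ₚ.∈-upTo⁻ ν′<)
               (clash₂-unique (+ ν) (+ ν′) (+ b) (+ b′) (+ b₁) (+ s) (+ s′) (+ s₁) (≢⇒≉ b₁< b′< ≢) u w)

      0<p : 0 ℕ.< p
      0<p = ℕₚ.<-trans (s≤s z≤n) 1<p

      cancel-half : ∀ {c e} → 4 ℕ.* (k ℕ.* d) ℕ.≤ p → p ℕ.* c ℕ.≤ e ℕ.* (length SB ℕ.* 2) → 2 ℕ.* c ℕ.≤ e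
      cancel-half {c} {e} 4kd≤p le = ℕₚ.*-cancelˡ-≤ p ⦃ ℕ.>-nonZero 0<p ⦄
        (ℕₚ.≤-trans (ℕₚ.≤-reflexive (eq₁ p c)) (ℕₚ.≤-trans (ℕₚ.*-monoʳ-≤ 2 le)
          (ℕₚ.≤-trans (ℕₚ.≤-reflexive (eq₂ e (length SB))) (ℕₚ.≤-trans (ℕₚ.*-monoʳ-≤ e
            (ℕₚ.≤-trans (ℕₚ.*-monoʳ-≤ 4 (ℕₚ.≤-trans (ℕₚ.≤-reflexive (length-cartesianProduct S Bs)) (ℕₚ.*-monoʳ-≤ k |Bs|))) 4kd≤p))
            (ℕₚ.≤-reflexive (ℕₚ.*-comm e p))))))
        where
        eq₁ : ∀ p c → p ℕ.* (2 ℕ.* c) ≡ 2 ℕ.* (p ℕ.* c)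
        eq₁ = NatSolver.solve-∀
        eq₂ : ∀ e l → 2 ℕ.* (e ℕ.* (l ℕ.* 2)) ≡ e ℕ.* (4 ℕ.* l)
        eq₂ = NatSolver.solve-∀

      -- An edge is spoiled by at most two values of ν for each of the at most kd candidates. As
      -- `4kd ≤ p`, the average over ν spoils at most half of the edges.
      shift-exists : 4 ℕ.* (k ℕ.* d) ℕ.≤ p → ∃[ ν ] length edges ℕ.≤ 2 ℕ.* count (λ ε → ¬? (bad? ν ε)) edges
      shift-exists 4kd≤p with average-count bad? (upTo p) edges (length SB ℕ.* 2) (subst (0 ℕ.<_) (sym (Listₚ.length-upTo p)) 0<p)
          (λ {ε} ε∈ → count-Any (λ ν q → clash? ν ε q) SB (upTo p) 2 (few-clashes ε∈))
      ... | ν , _ , le = ν , halve (length edges) (count (bad? ν) edges) (count (λ ε → ¬? (bad? ν ε)) edges)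
                (count-split (bad? ν) edges) (cancel-half {e = length edges} 4kd≤p (subst (λ n → n ℕ.* count (bad? ν) edges ℕ.≤ length edges ℕ.* (length SB ℕ.* 2)) (Listₚ.length-upTo p) le))
        where
        halve : ∀ e c g → e ≡ c ℕ.+ g → 2 ℕ.* c ℕ.≤ e → e ℕ.≤ 2 ℕ.* g
        halve e c g refl 2c≤ = ℕₚ.≤-trans (ℕₚ.+-monoˡ-≤ g c≤g) (ℕₚ.≤-reflexive (cong (g ℕ.+_) (sym (ℕₚ.+-identityʳ g))))
          where
          c≤g : c ℕ.≤ g
          c≤g = ℕₚ.+-cancelˡ-≤ c c g (ℕₚ.≤-trans (ℕₚ.≤-reflexive (cong (c ℕ.+_) (sym (ℕₚ.+-identityʳ c)))) 2c≤)

      slopes : List (ℕ × ℕ)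
      slopes = taggedPairs T S

      vertices : List (Bool × (ℕ × (ℕ × ℕ)))
      vertices = cartesianProduct (true ∷ false ∷ []) (cartesianProduct Bs slopes)

      |slopes| : length slopes ℕ.≤ k ℕ.* d
      |slopes| = ℕₚ.≤-trans (ℕₚ.≤-reflexive (taggedPairs-length T S))
        (ℕₚ.≤-trans (sum-map-mono (λ s → length (T s)) (λ _ → d) S |T|) (ℕₚ.≤-reflexive (sum-map-const d S)))

      |vertices| : length vertices ℕ.≤ 2 ℕ.* (d ℕ.* (k ℕ.* d))
      |vertices| = ℕₚ.≤-trans (ℕₚ.≤-reflexive (trans (length-cartesianProduct (true ∷ false ∷ []) (cartesianProduct Bs slopes)) (cong (2 ℕ.*_) (length-cartesianProduct Bs slopes))))
        (ℕₚ.*-monoʳ-≤ 2 (ℕₚ.*-mono-≤ |Bs| |slopes|))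

      ∈-vertices : ∀ c {b s t} → b ∈ Bs → s ∈ S → t ∈ T s → (c , b , s , t) ∈ vertices
      ∈-vertices c b∈ s∈ t∈ = ∈ₚ.∈-cartesianProduct⁺ (∈bool c)
        (∈ₚ.∈-cartesianProduct⁺ b∈ (∈ₚ.∈-concatMap⁺ (λ s → map (s ,_) (T s)) (lose s∈ (∈ₚ.∈-map⁺ (_ ,_) t∈))))
        where
        ∈bool : ∀ c → c ∈ true ∷ false ∷ []
        ∈bool true  = here refl
        ∈bool false = there (here refl)

      ends∈ : ∀ {ε} → ε ∈ edges → ∀ c → (c , end c ε) ∈ vertices
      ends∈ ε∈ true  = let open Valid (valid ε∈) in ∈-vertices true (proj₂ (pts⊆ e′∈)) s∈ (T∋ e∈ s∈)
      ends∈ ε∈ false = let open Valid (valid ε∈) in ∈-vertices false (proj₂ (pts⊆ e∈)) s′∈ (T∋ e′∈ s′∈)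

      b≉ : ∀ {ε} → ε ∈ edges → denominator ε ≉0
      b≉ ε∈ = let open Valid (valid ε∈) in ≢⇒≉ (Bs<p (proj₂ (pts⊆ e∈))) (Bs<p (proj₂ (pts⊆ e′∈))) b≢

      abscissa-spec : ∀ ν {ε} → ε ∈ edges → (denominator ε * abscissa ν ε - numerator ν ε) ≈0
      abscissa-spec ν {ε} ε∈ = quotient-spec (denominator ε) (numerator ν ε) (b≉ ε∈)

      meets-true : ∀ ν {ε} → ε ∈ edges → Meets (lineOf ν (true , end true ε)) (lineOf ν (false , end false ε)) (abscissa ν ε)
      meets-true ν {ε@(((a , b) , (a′ , b′)) , (s , s′))} ε∈ = b≉ ε∈ , abscissa-spec ν ε∈ ,
        meeting-identity (+ a) (+ b) (+ b′) (+ s) (+ s′) (+ ν) (abscissa ν ε) (+ intercept s (a , b)) (+ intercept s′ (a′ , b′))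
          (abscissa-spec ν ε∈) (x≈res (+ a - + s * + b))
          (subst (λ a → (+ a - + s′ * + b′ - + intercept s′ (a′ , b′)) ≈0) (sym (Valid.a≡ (valid ε∈))) (x≈res (+ a′ - + s′ * + b′)))

      meets-edge : ∀ ν c {ε} → ε ∈ edges → Meets (lineOf ν (c , end c ε)) (lineOf ν (not c , end (not c) ε)) (abscissa ν ε)
      meets-edge ν true  ε∈ = meets-true ν ε∈
      meets-edge ν false {ε} ε∈ = meets-sym (lineOf ν (true , end true ε)) (lineOf ν (false , end false ε)) (meets-true ν ε∈)

      same-point : ∀ s {a b a₁} → a ℕ.< p → a₁ ℕ.< p → intercept s (a , b) ≡ intercept s (a₁ , b) → a ≡ a₁
      same-point s {a} {b} {a₁} a< a₁< t≡ = ≈⇒≡ a< a₁< (lin₁ (res-injective {+ a - + s * + b} {+ a₁ - + s * + b} t≡) 1ℤ (eq (+ a) (+ a₁) (+ s * + b)))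
        where
        eq : ∀ a a₁ c → a - a₁ ≡ 1ℤ * (a - c - (a₁ - c))
        eq = solve-∀

      -- One end together with the ordinate and slope of the other fixes both ordinates, both slopes
      -- and one intercept; the intercept then determines a.
      same-edge : ∀ c {ε ε₁} → ε ∈ edges → ε₁ ∈ edges → end c ε ≡ end c ε₁ →
        proj₁ (end (not c) ε) ≡ proj₁ (end (not c) ε₁) → proj₁ (proj₂ (end (not c) ε)) ≡ proj₁ (proj₂ (end (not c) ε₁)) → ε ≡ ε₁
      same-edge true {((a , b) , (a′ , b′)) , (s , s′)} {((a₁ , b₁) , (a₁′ , b₁′)) , (s₁ , s₁′)} ε∈ ε₁∈ end≡ β≡ σ≡ =
        go (cong proj₁ end≡) (cong (λ u → proj₁ (proj₂ u)) end≡) (cong (λ u → proj₂ (proj₂ u)) end≡) β≡ σ≡ (Valid.a≡ (valid ε∈)) (Valid.a≡ (valid ε₁∈))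
        where
        a< = As<p (proj₁ (pts⊆ (Valid.e∈ (valid ε∈))))
        a₁< = As<p (proj₁ (pts⊆ (Valid.e∈ (valid ε₁∈))))
        go : b′ ≡ b₁′ → s ≡ s₁ → intercept s (a , b) ≡ intercept s₁ (a₁ , b₁) → b ≡ b₁ → s′ ≡ s₁′ → a ≡ a′ → a₁ ≡ a₁′ →
             (((a , b) , (a′ , b′)) , (s , s′)) ≡ (((a₁ , b₁) , (a₁′ , b₁′)) , (s₁ , s₁′))
        go refl refl t≡ refl refl refl refl = cong (λ a → ((a , b) , (a , b′)) , (s , s′)) (same-point s a< a₁< t≡)
      same-edge false {((a , b) , (a′ , b′)) , (s , s′)} {((a₁ , b₁) , (a₁′ , b₁′)) , (s₁ , s₁′)} ε∈ ε₁∈ end≡ β≡ σ≡ =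
        go (cong proj₁ end≡) (cong (λ u → proj₁ (proj₂ u)) end≡) (cong (λ u → proj₂ (proj₂ u)) end≡) β≡ σ≡ (Valid.a≡ (valid ε∈)) (Valid.a≡ (valid ε₁∈))
        where
        a< = As<p (proj₁ (pts⊆ (Valid.e′∈ (valid ε∈))))
        a₁< = As<p (proj₁ (pts⊆ (Valid.e′∈ (valid ε₁∈))))
        go : b ≡ b₁ → s′ ≡ s₁′ → intercept s′ (a′ , b′) ≡ intercept s₁′ (a₁′ , b₁′) → b′ ≡ b₁′ → s ≡ s₁ → a ≡ a′ → a₁ ≡ a₁′ →
             (((a , b) , (a′ , b′)) , (s , s′)) ≡ (((a₁ , b₁) , (a₁′ , b₁′)) , (s₁ , s₁′))
        go refl refl t≡ refl refl refl refl = cong (λ a → ((a , b) , (a , b′)) , (s , s′)) (same-point s′ a< a₁< t≡)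

      cancel-ν : ∀ ν s s₁ t → ((s₁ + ν - t) - (s + ν - t)) ≈0 → (s₁ - s) ≈0
      cancel-ν ν s s₁ t u = lin₁ u 1ℤ (eq ν s s₁ t)
        where
        eq : ∀ ν s s₁ t → s₁ - s ≡ 1ℤ * ((s₁ + ν - t) - (s + ν - t))
        eq = solve-∀

      cancel-s : ∀ ν s s₁ t → ((t + ν - s₁) - (t + ν - s)) ≈0 → (s - s₁) ≈0
      cancel-s ν s s₁ t u = lin₁ u 1ℤ (eq ν s s₁ t)
        where
        eq : ∀ ν s s₁ t → s - s₁ ≡ 1ℤ * ((t + ν - s₁) - (t + ν - s))
        eq = solve-∀

      -- A coincidence between different denominators is a clash. With equal denominators the
      -- numerators agree, hence the slopes, and `same-edge` applies.
      distinct-abscissae : ∀ ν c {ε ε₁} → ε ∈ edges → ε₁ ∈ edges → ¬ Any (Clash ν ε) SB → end c ε ≡ end c ε₁ →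
        (abscissa ν ε₁ - abscissa ν ε) ≈0 → ε ≡ ε₁
      distinct-abscissae ν true {ε@(((a , b) , (a′ , b′)) , (s , s′))} {ε₁@(((a₁ , b₁) , (a₁′ , b₁′)) , (s₁ , s₁′))} ε∈ ε₁∈ ok end≡ x≈ =
        go (cong proj₁ end≡) (cong (λ u → proj₁ (proj₂ u)) end≡) (abscissa-spec ν ε₁∈) (b₁ ℕ.≟ b)
        where
        v₁ = valid ε₁∈
        go : b′ ≡ b₁′ → s ≡ s₁ → ((+ b₁ - + b₁′) * abscissa ν ε₁ - (+ s₁′ + + ν - + s₁)) ≈0 → Dec (b₁ ≡ b) → ε ≡ ε₁
        go b′≡ s≡ spec₁ (no b₁≢b) = contradiction (lose (∈ₚ.∈-cartesianProduct⁺ (Valid.s′∈ v₁) (proj₂ (pts⊆ (Valid.e∈ v₁))))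
          (inj₁ (b₁≢b , collision-identity (+ b - + b′) (+ b₁ - + b′) (+ s′ + + ν - + s) (+ s₁′ + + ν - + s) (abscissa ν ε) (abscissa ν ε₁)
            (abscissa-spec ν ε∈) (subst₂ (λ b′ s → ((+ b₁ - + b′) * abscissa ν ε₁ - (+ s₁′ + + ν - + s)) ≈0) (sym b′≡) (sym s≡) spec₁) x≈))) ok
        go b′≡ s≡ spec₁ (yes b₁≡b) = same-edge true ε∈ ε₁∈ end≡ (sym b₁≡b)
          (sym (≈⇒≡ (S<p (Valid.s′∈ v₁)) (S<p (Valid.s′∈ (valid ε∈))) (cancel-ν (+ ν) (+ s′) (+ s₁′) (+ s)
            (numerator-identity (+ b - + b′) (+ s′ + + ν - + s) (+ s₁′ + + ν - + s) (abscissa ν ε) (abscissa ν ε₁) (abscissa-spec ν ε∈)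
              (subst₂ (λ B s → (B * abscissa ν ε₁ - (+ s₁′ + + ν - + s)) ≈0) (cong₂ (λ x y → + x - + y) b₁≡b (sym b′≡)) (sym s≡) spec₁) x≈))))
      distinct-abscissae ν false {ε@(((a , b) , (a′ , b′)) , (s , s′))} {ε₁@(((a₁ , b₁) , (a₁′ , b₁′)) , (s₁ , s₁′))} ε∈ ε₁∈ ok end≡ x≈ =
        go (cong proj₁ end≡) (cong (λ u → proj₁ (proj₂ u)) end≡) (abscissa-spec ν ε₁∈) (b₁′ ℕ.≟ b′)
        where
        v₁ = valid ε₁∈
        go : b ≡ b₁ → s′ ≡ s₁′ → ((+ b₁ - + b₁′) * abscissa ν ε₁ - (+ s₁′ + + ν - + s₁)) ≈0 → Dec (b₁′ ≡ b′) → ε ≡ ε₁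
        go b≡ s′≡ spec₁ (no b₁′≢b′) = contradiction (lose (∈ₚ.∈-cartesianProduct⁺ (Valid.s∈ v₁) (proj₂ (pts⊆ (Valid.e′∈ v₁))))
          (inj₂ (b₁′≢b′ , collision-identity (+ b - + b′) (+ b - + b₁′) (+ s′ + + ν - + s) (+ s′ + + ν - + s₁) (abscissa ν ε) (abscissa ν ε₁)
            (abscissa-spec ν ε∈) (subst₂ (λ b s′ → ((+ b - + b₁′) * abscissa ν ε₁ - (+ s′ + + ν - + s₁)) ≈0) (sym b≡) (sym s′≡) spec₁) x≈))) ok
        go b≡ s′≡ spec₁ (yes b₁′≡b′) = same-edge false ε∈ ε₁∈ end≡ (sym b₁′≡b′)
          (≈⇒≡ (S<p (Valid.s∈ (valid ε∈))) (S<p (Valid.s∈ v₁)) (cancel-s (+ ν) (+ s) (+ s₁) (+ s′)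
            (numerator-identity (+ b - + b′) (+ s′ + + ν - + s) (+ s′ + + ν - + s₁) (abscissa ν ε) (abscissa ν ε₁) (abscissa-spec ν ε∈)
              (subst₂ (λ B s′ → (B * abscissa ν ε₁ - (+ s′ + + ν - + s₁)) ≈0) (cong₂ (λ x y → + x - + y) (sym b≡) b₁′≡b′) (sym s′≡) spec₁) x≈)))

      _≟U_ : DecidableEquality (ℕ × (ℕ × ℕ))
      _≟U_ = ≡-dec ℕ._≟_ (≡-dec ℕ._≟_ ℕ._≟_)

      module Configuration (ν : ℕ) (G : List Edge) (G# : Unique G) (G⊆ : ∀ {ε} → ε ∈ G → ε ∈ edges × ¬ Any (Clash ν ε) SB)
        (m : ℕ) (G-rich : ∀ {ε} → ε ∈ G → ∀ c → m ℕ.≤ degree _≟U_ end G (c , end c ε)) (nonempty : 0 ℕ.< length G) where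

        Vertex : Set
        Vertex = Bool × (ℕ × (ℕ × ℕ))

        entry : Bool → Edge → ℤ × Vertex
        entry c ε = abscissa ν ε , (not c , end (not c) ε)

        incident : Vertex → List Edge
        incident (c , u) = filter (λ ε → end c ε ≟U u) G

        nbrs : Vertex → List (ℤ × Vertex)
        nbrs (c , u) = map (entry c) (incident (c , u))

        active : List Vertex
        active = map (λ ε → true , end true ε) G ++ map (λ ε → false , end false ε) G

        active⁺ : ∀ c {ε} → ε ∈ G → (c , end c ε) ∈ active
        active⁺ true  ε∈ = ∈ₚ.∈-++⁺ˡ (∈ₚ.∈-map⁺ (λ ε → true , end true ε) ε∈)
        active⁺ false ε∈ = ∈ₚ.∈-++⁺ʳ (map (λ ε → true , end true ε) G) (∈ₚ.∈-map⁺ (λ ε → false , end false ε) ε∈)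

        active⁻ : ∀ {v} → v ∈ active → ∃[ ε ] ∃[ c ] (ε ∈ G × v ≡ (c , end c ε))
        active⁻ v∈ with ∈ₚ.∈-++⁻ (map (λ ε → true , end true ε) G) v∈
        ... | inj₁ i with ∈ₚ.∈-map⁻ (λ ε → true , end true ε) i
        ...   | ε , ε∈ , v≡ = ε , true , ε∈ , v≡
        active⁻ v∈ | inj₂ i with ∈ₚ.∈-map⁻ (λ ε → false , end false ε) i
        ...   | ε , ε∈ , v≡ = ε , false , ε∈ , v≡

        incident⁻ : ∀ {v ε} → ε ∈ incident v → ε ∈ G × end (proj₁ v) ε ≡ proj₂ v
        incident⁻ {c , u} = ∈ₚ.∈-filter⁻ (λ ε → end c ε ≟U u)

        rich : ∀ {v} → v ∈ active → m ℕ.≤ length (nbrs v)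
        rich v∈ with active⁻ v∈
        ... | ε , c , ε∈ , refl = subst (m ℕ.≤_) (sym (Listₚ.length-map (entry c) (incident (c , end c ε)))) (G-rich ε∈ c)

        nbrs# : ∀ {v} → AllPairs (λ e e′ → (proj₁ e′ - proj₁ e) ≉0) (nbrs v)
        nbrs# {c , u} = AllPairsₚ.map⁺ (AllPairs-∈ (Uniqueₚ.filter⁺ (λ ε → end c ε ≟U u) G#) λ ε∈ ε₁∈ ε≢ x≈ →
          let i , e = incident⁻ {c , u} ε∈
              i₁ , e₁ = incident⁻ {c , u} ε₁∈
          in ε≢ (distinct-abscissae ν c (proj₁ (G⊆ i)) (proj₁ (G⊆ i₁)) (proj₂ (G⊆ i)) (trans e (sym e₁)) x≈))

        meets : ∀ {v} → v ∈ active → All (λ (x , w) → w ∈ active × Meets (lineOf ν v) (lineOf ν w) x) (nbrs v)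
        meets {c , u} _ = Allₚ.map⁺ (All.tabulate λ {ε} ε∈ →
          let i , e = incident⁻ {c , u} ε∈
          in active⁺ (not c) i , subst (λ u → Meets (lineOf ν (c , u)) (lineOf ν (not c , end (not c) ε)) (abscissa ν ε)) e (meets-edge ν c (proj₁ (G⊆ i))))

        nbrs⁻ : ∀ {v e} → e ∈ nbrs v → ∃[ ε ] (ε ∈ G × end (proj₁ v) ε ≡ proj₂ v × e ≡ entry (proj₁ v) ε)
        nbrs⁻ {c , u} e∈ with ∈ₚ.∈-map⁻ (entry c) e∈
        ... | ε , ε∈ , refl with incident⁻ {c , u} ε∈
        ...   | i , e = ε , i , e , refl

        βᵉ σᵉ : ℤ × Vertex → ℕ
        βᵉ (_ , (_ , β , _ , _)) = β
        σᵉ (_ , (_ , _ , σ , _)) = σ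

        βᵉ∈ : ∀ {v e} → e ∈ nbrs v → βᵉ e ∈ Bs
        βᵉ∈ {v} e∈ with nbrs⁻ {v} e∈
        βᵉ∈ {true  , u} e∈ | ε , i , _ , refl = proj₂ (pts⊆ (Valid.e∈ (valid (proj₁ (G⊆ i)))))
        βᵉ∈ {false , u} e∈ | ε , i , _ , refl = proj₂ (pts⊆ (Valid.e′∈ (valid (proj₁ (G⊆ i)))))

        σᵉ∈ : ∀ {v e} → e ∈ nbrs v → σᵉ e ∈ S
        σᵉ∈ {v} e∈ with nbrs⁻ {v} e∈
        σᵉ∈ {true  , u} e∈ | ε , i , _ , refl = Valid.s′∈ (valid (proj₁ (G⊆ i)))
        σᵉ∈ {false , u} e∈ | ε , i , _ , refl = Valid.s∈ (valid (proj₁ (G⊆ i)))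

        entry-injective : ∀ {v e e′} → e ∈ nbrs v → e′ ∈ nbrs v → βᵉ e ≡ βᵉ e′ → σᵉ e ≡ σᵉ e′ → e ≡ e′
        entry-injective {c , u} e∈ e′∈ β≡ σ≡ with nbrs⁻ {c , u} e∈ | nbrs⁻ {c , u} e′∈
        ... | ε , i , q , refl | ε′ , i′ , q′ , refl = cong (entry c) (same-edge c (proj₁ (G⊆ i)) (proj₁ (G⊆ i′)) (trans q (sym q′)) β≡ σ≡)

        shiftOf : Bool → ℤ
        shiftOf true  = + ν
        shiftOf false = 0ℤ

        line-β : ∀ {v e} → e ∈ nbrs v → β (lineOf ν (proj₂ e)) ≡ + βᵉ e
        line-β {v} e∈ with nbrs⁻ {v} e∈
        line-β {true  , u} e∈ | ε , i , _ , refl = refl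
        line-β {false , u} e∈ | ε , i , _ , refl = refl

        line-σ : ∀ {v e} → e ∈ nbrs v → σ (lineOf ν (proj₂ e)) ≡ + σᵉ e + shiftOf (proj₁ v)
        line-σ {v} e∈ with nbrs⁻ {v} e∈
        line-σ {true  , u} e∈ | ε , i , _ , refl = refl
        line-σ {false , u} e∈ | ε , i , _ , refl = sym (ℤₚ.+-identityʳ (+ σᵉ (entry false ε)))

        module _ (v : Vertex) (A B C : ℤ) (A≉0 : A ≉0) where

          private
            Coplanar : ℤ × Vertex → Set
            Coplanar (_ , w) = (A + B * (σ (lineOf ν w) - σ (lineOf ν v)) + C * (β (lineOf ν w) - β (lineOf ν v))) ≈0

            onPlane? : Decidable Coplanar
            onPlane? (_ , w) = (A + B * (σ (lineOf ν w) - σ (lineOf ν v)) + C * (β (lineOf ν w) - β (lineOf ν v))) ≈0?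

            Relation : ℕ → ℕ → Set
            Relation β′ σ′ = (A + B * (+ σ′ + shiftOf (proj₁ v) - σ (lineOf ν v)) + C * (+ β′ - β (lineOf ν v))) ≈0

            relation : ∀ {e} → e ∈ nbrs v → Coplanar e → Relation (βᵉ e) (σᵉ e)
            relation e∈ = subst₂ (λ s b → (A + B * (s - σ (lineOf ν v)) + C * (b - β (lineOf ν v))) ≈0) (line-σ {v} e∈) (line-β {v} e∈)

            σ-determined : B ≉0 → ∀ {b s s₁} → s ℕ.< p → s₁ ℕ.< p → Relation b s → Relation b s₁ → s ≡ s₁
            σ-determined B≉0 {b} {s} {s₁} s< s₁< u w = ≈⇒≡ s< s₁< (cancelˡ B B≉0
              (lin₂ u w 1ℤ (- 1ℤ) (eq A B (C * (+ b - β (lineOf ν v))) (+ s) (+ s₁) (shiftOf (proj₁ v)) (σ (lineOf ν v)))))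
              where
              eq : ∀ A B c s s₁ t σ → B * (s - s₁) ≡ 1ℤ * (A + B * (s + t - σ) + c) + - 1ℤ * (A + B * (s₁ + t - σ) + c)
              eq = solve-∀

            β-determined : C ≉0 → ∀ {s b b₁} → b ℕ.< p → b₁ ℕ.< p → Relation b s → Relation b₁ s → b ≡ b₁
            β-determined C≉0 {s} {b} {b₁} b< b₁< u w = ≈⇒≡ b< b₁< (cancelˡ C C≉0
              (lin₂ u w 1ℤ (- 1ℤ) (eq (A + B * (+ s + shiftOf (proj₁ v) - σ (lineOf ν v))) C (+ b) (+ b₁) (β (lineOf ν v)))))
              where
              eq : ∀ a C b b₁ β → C * (b - b₁) ≡ 1ℤ * (a + C * (b - β)) + - 1ℤ * (a + C * (b₁ - β))
              eq = solve-∀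

            C≉0 : B ≈0 → ∀ {b s} → Relation b s → C ≉0
            C≉0 B≈0 {b} {s} u C≈0 = A≉0 (lin₃ u B≈0 C≈0 1ℤ (- (+ s + shiftOf (proj₁ v) - σ (lineOf ν v))) (- (+ b - β (lineOf ν v)))
              (eq A B C (+ s + shiftOf (proj₁ v) - σ (lineOf ν v)) (+ b - β (lineOf ν v))))
              where
              eq : ∀ A B C x y → A ≡ 1ℤ * (A + B * x + C * y) + - x * B + - y * C
              eq = solve-∀

            coplanar⁻ : ∀ {e} → e ∈ filter onPlane? (nbrs v) → e ∈ nbrs v × Coplanar e
            coplanar⁻ = ∈ₚ.∈-filter⁻ onPlane? {xs = nbrs v}

            filtered# : Unique (filter onPlane? (nbrs v))
            filtered# = Uniqueₚ.filter⁺ onPlane? (AllPairs.map (λ x≉ e≡ → x≉ (≡0⇒≈0 (ℤₚ.i≡j⇒i-j≡0 (cong proj₁ (sym e≡))))) (nbrs# {v}))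

          -- If `B ≉0` the ordinate determines the slope. If `B ≈0`, then `A ≉0` forces `C ≉0` and
          -- the slope determines the ordinate. Ordinate and slope identify a neighbour.
          few-coplanar : length (filter onPlane? (nbrs v)) ℕ.≤ d ℕ.+ k
          few-coplanar = by-cases (B ≈0?)
            (λ B≈0 → ℕₚ.≤-trans (injective-length σᵉ filtered#
                (λ {e} {e′} e∈ e′∈ σ≡ → let i , c = coplanar⁻ e∈ ; i′ , c′ = coplanar⁻ e′∈ in
                  entry-injective {v} i i′ (β-determined (C≉0 B≈0 (relation i c)) (Bs<p (βᵉ∈ {v} i)) (Bs<p (βᵉ∈ {v} i′)) (relation i c)
                    (subst (Relation (βᵉ e′)) (sym σ≡) (relation i′ c′))) σ≡)
                (λ e∈ → σᵉ∈ {v} (proj₁ (coplanar⁻ e∈)))) (ℕₚ.m≤n+m k d))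
            (λ B≉0 → ℕₚ.≤-trans (injective-length βᵉ filtered#
                (λ {e} {e′} e∈ e′∈ β≡ → let i , c = coplanar⁻ e∈ ; i′ , c′ = coplanar⁻ e′∈ in
                  entry-injective {v} i i′ β≡ (σ-determined B≉0 (S<p (σᵉ∈ {v} i)) (S<p (σᵉ∈ {v} i′)) (relation i c)
                    (subst (λ b → Relation b (σᵉ e′)) (sym β≡) (relation i′ c′))))
                (λ e∈ → βᵉ∈ {v} (proj₁ (coplanar⁻ e∈)))) (ℕₚ.≤-trans |Bs| (ℕₚ.m≤m+n d k)))

        conclude : ∀ n → ∃[ v ] ∃[ A ] ∃[ B ] ∃[ C ] (v ∈ active × A ≉0 × length (nbrs v) ℕ.≤ n ℕ.+ length (filter
            (λ (_ , w) → (A + B * (σ (lineOf ν w) - σ (lineOf ν v)) + C * (β (lineOf ν w) - β (lineOf ν v))) ≈0?) (nbrs v))) →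
          m ℕ.≤ n ℕ.+ (d ℕ.+ k)
        conclude n (v , A , B , C , v∈ , A≉0 , le) = ℕₚ.≤-trans (rich v∈) (ℕₚ.≤-trans le (ℕₚ.+-monoʳ-≤ n (few-coplanar v A B C A≉0)))

        m-bounded : ∀ h → h ℕ.≤ p → let n = h ℕ.+ (h ℕ.+ (h ℕ.+ 1)) in
          2 ℕ.* (d ℕ.* (k ℕ.* d)) ℕ.* n ℕ.< h ℕ.* (h ℕ.* h) → 4 ℕ.* n ℕ.≤ m → 4 ℕ.* n ℕ.+ 4 ℕ.< p → m ℕ.≤ n ℕ.+ (d ℕ.+ k)
        m-bounded h h≤p small 4n≤m 4n<p = conclude n (coplanar-neighbours-exist (lineOf ν) active nbrs m rich (λ {v} _ → nbrs# {v}) meets n F onLines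
            (proj₂ (proj₁ vanishing) , proj₁ (proj₂ vanishing)) 4n≤m 4n<p someVertex)
          where
          n : ℕ
          n = h ℕ.+ (h ℕ.+ (h ℕ.+ 1))
          Qs : List Point
          -- n points on each line, as many as the coefficients of the restriction of `F`; vanishing
          -- there forces vanishing on the whole line.
          Qs = map (λ (v , x) → pt (lineOf ν v) (+ x)) (cartesianProduct vertices (upTo n))
          |Qs| : length Qs ≡ length vertices ℕ.* n
          |Qs| = trans (Listₚ.length-map _ (cartesianProduct vertices (upTo n)))
            (trans (length-cartesianProduct vertices (upTo n)) (cong (length vertices ℕ.*_) (Listₚ.length-upTo n)))
          vanishing = vanishing-polynomial h Qs h≤p (ℕₚ.≤-<-trans (ℕₚ.≤-trans (ℕₚ.≤-reflexive |Qs|) (ℕₚ.*-monoˡ-≤ n |vertices|)) small)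
          F : Tri n
          F = proj₁ (proj₁ vanishing)
          n≤p : n ℕ.≤ p
          n≤p = ℕₚ.≤-trans (ℕₚ.m≤m+n n (3 ℕ.* n)) (ℕₚ.≤-trans (ℕₚ.m≤m+n (4 ℕ.* n) 4) (ℕₚ.<⇒≤ 4n<p))
          someVertex : ∃[ v ] v ∈ active
          someVertex = go G refl nonempty
            where
            go : ∀ G′ → G ≡ G′ → 0 ℕ.< length G′ → ∃[ v ] v ∈ active
            go (ε ∷ _) G≡ _ = _ , active⁺ true {ε} (subst (ε ∈_) (sym G≡) (here refl))
          onLine : ∀ ε c → ε ∈ G → ∀ x → eval F (pt (lineOf ν (c , end c ε)) x) ≈0
          onLine ε c ε∈ = roots⇒value≈0 (linePoly (lineOf ν (c , end c ε)) F) {map +_ (upTo n)}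
            (ℕₚ.≤-reflexive (sym (trans (Listₚ.length-map +_ (upTo n)) (Listₚ.length-upTo n))))
            (AllPairsₚ.map⁺ (AllPairsₚ.applyUpTo⁺₁ id n λ i<j j<n → ordered≉0 i<j (ℕₚ.<-≤-trans j<n n≤p)))
            (Allₚ.map⁺ (All.tabulate λ x∈ → All.lookup (proj₂ (proj₂ vanishing))
              (∈ₚ.∈-map⁺ (λ (v , x) → pt (lineOf ν v) (+ x)) (∈ₚ.∈-cartesianProduct⁺ (ends∈ (proj₁ (G⊆ ε∈)) c) x∈))))
          onLines : ∀ {v} → v ∈ active → ∀ x → eval F (pt (lineOf ν v) x) ≈0
          onLines v∈ x = let ε , c , ε∈ , v≡ = active⁻ v∈ in
            subst (λ v → eval F (pt (lineOf ν v) x) ≈0) (sym v≡) (onLine ε c ε∈ x)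

    -- Half of the edges survive a suitable shift. Were these more than m per vertex, pruning would
    -- leave a nonempty configuration with all degrees at least m, against `m-bounded`.
    few-edges : ∀ h m → let n = h ℕ.+ (h ℕ.+ (h ℕ.+ 1)) in
      4 ℕ.* (k ℕ.* d) ℕ.≤ p → h ℕ.≤ p → 2 ℕ.* (d ℕ.* (k ℕ.* d)) ℕ.* n ℕ.< h ℕ.* (h ℕ.* h) → 4 ℕ.* n ℕ.≤ m → 4 ℕ.* n ℕ.+ 4 ℕ.< p →
      n ℕ.+ (d ℕ.+ k) ℕ.< m → length edges ℕ.≤ 2 ℕ.* (m ℕ.* (2 ℕ.* (d ℕ.* (k ℕ.* d))))
    few-edges h m 4kd≤p h≤p small 4n≤m 4n<p n<m = ℕₚ.≮⇒≥ λ many →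
      let ν , half = shift-exists 4kd≤p
          G = filter (λ ε → ¬? (bad? ν ε)) edges
          G′ , G′# , sub , ne , rich = prune _≟U_ end (length vertices) m vertices G refl (Uniqueₚ.filter⁺ (λ ε → ¬? (bad? ν ε)) edges#)
            (λ ε∈ → ends∈ (proj₁ (∈ₚ.∈-filter⁻ (λ ε → ¬? (bad? ν ε)) {xs = edges} ε∈)))
            (ℕₚ.≤-<-trans (ℕₚ.*-monoʳ-≤ m |vertices|) (ℕₚ.*-cancelˡ-< 2 _ _ (ℕₚ.<-≤-trans many half)))
      in ℕₚ.<⇒≱ n<m (Configuration.m-bounded ν G′ G′# (λ ε∈ → ∈ₚ.∈-filter⁻ (λ ε → ¬? (bad? ν ε)) {xs = edges} (sub ε∈)) m rich ne h h≤p small 4n≤m 4n<p)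

-- Collisions of linear forms over all directions.

module Directions (p : ℕ) (p-prime : Prime p) where
  open Modular p p-prime

  dot : ℕ × ℕ → ℕ × ℕ → ℤ
  dot (a , b) (c , d) = + a * + c + + b * + d

  det : ℕ × ℕ → ℕ × ℕ → ℤ
  det (a , b) (c , d) = + a * + d - + b * + c

  key : ℕ × ℕ → ℕ × ℕ → ℕ
  key w y = res (dot w y)

  Bounded : ℕ × ℕ → Set
  Bounded (a , b) = a ℕ.< p × b ℕ.< p

  private
    cramer₁ : ∀ a b c d y z y′ z′ → ((a * y + b * z) - (a * y′ + b * z′)) ≈0 → ((c * y + d * z) - (c * y′ + d * z′)) ≈0 →
              (a * d - b * c) ≉0 → (y - y′) ≈0
    cramer₁ a b c d y z y′ z′ u v D≉0 = cancelˡ (a * d - b * c) D≉0 (lin₂ u v d (- b) (eq a b c d y z y′ z′))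
      where
      eq : ∀ a b c d y z y′ z′ → (a * d - b * c) * (y - y′) ≡ d * ((a * y + b * z) - (a * y′ + b * z′)) + - b * ((c * y + d * z) - (c * y′ + d * z′))
      eq = solve-∀

    cramer₂ : ∀ a b c d y z y′ z′ → ((a * y + b * z) - (a * y′ + b * z′)) ≈0 → ((c * y + d * z) - (c * y′ + d * z′)) ≈0 →
              (a * d - b * c) ≉0 → (z - z′) ≈0
    cramer₂ a b c d y z y′ z′ u v D≉0 = cancelˡ (a * d - b * c) D≉0 (lin₂ u v (- c) a (eq a b c d y z y′ z′))
      where
      eq : ∀ a b c d y z y′ z′ → (a * d - b * c) * (z - z′) ≡ - c * ((a * y + b * z) - (a * y′ + b * z′)) + a * ((c * y + d * z) - (c * y′ + d * z′))
      eq = solve-∀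

  coordinates-injective : ∀ w w′ {y y′} → det w w′ ≉0 → Bounded y → Bounded y′ → key w y ≡ key w y′ → key w′ y ≡ key w′ y′ → y ≡ y′
  coordinates-injective (a , b) (c , d) {y , z} {y′ , z′} D≉0 (y< , z<) (y′< , z′<) e e′ =
    cong₂ _,_ (≈⇒≡ y< y′< (cramer₁ (+ a) (+ b) (+ c) (+ d) (+ y) (+ z) (+ y′) (+ z′) (res-injective {dot (a , b) (y , z)} {dot (a , b) (y′ , z′)} e) (res-injective {dot (c , d) (y , z)} {dot (c , d) (y′ , z′)} e′) D≉0))
              (≈⇒≡ z< z′< (cramer₂ (+ a) (+ b) (+ c) (+ d) (+ y) (+ z) (+ y′) (+ z′) (res-injective {dot (a , b) (y , z)} {dot (a , b) (y′ , z′)} e) (res-injective {dot (c , d) (y , z)} {dot (c , d) (y′ , z′)} e′) D≉0))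

  private
    diagonal? : Decidable (λ (yy : (ℕ × ℕ) × (ℕ × ℕ)) → proj₁ yy ≡ proj₂ yy)
    diagonal? (y , y′) = y ≟F2 y′

    collide? : ∀ w → Decidable (λ (yy : (ℕ × ℕ) × (ℕ × ℕ)) → key w (proj₁ yy) ≡ key w (proj₂ yy))
    collide? w (y , y′) = key w y ℕ.≟ key w y′

  module _ (E : List (ℕ × ℕ)) (E# : Unique E) (E< : ∀ {y} → y ∈ E → Bounded y) where

    private
      N = length E
      E² = cartesianProduct E E

    collisions : ℕ × ℕ → ℕ
    collisions w = length (samePairs (key w) E)

    -- Two independent forms determine a point, so a pair of distinct points collides in at most one
    -- direction; a diagonal pair collides in all of them.
    total-collisions : ∀ Θ → AllPairs (λ w w′ → det w w′ ≉0) Θ → sum (map collisions Θ) ℕ.≤ N ℕ.* N ℕ.+ length Θ ℕ.* N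
    total-collisions Θ Θ# = begin
      sum (map collisions Θ)                                                ≡⟨ sum-count-swap (λ w yy → collide? w yy) Θ E² ⟩
      sum (map (λ yy → count (λ w → collide? w yy) Θ) E²)                   ≤⟨ sum-map-mono _ _ E² pointwise ⟩
      sum (map (λ yy → 1 ℕ.+ length Θ ℕ.* count diagonal? (yy ∷ [])) E²)    ≡⟨ sum-map-+ (λ _ → 1) _ E² ⟩
      sum (map (λ _ → 1) E²) ℕ.+ sum (map (λ yy → length Θ ℕ.* count diagonal? (yy ∷ [])) E²)
        ≡⟨ cong₂ ℕ._+_ (trans (sum-map-const 1 E²) (trans (ℕₚ.*-identityʳ _) (length-cartesianProduct E E))) (diag E²) ⟩
      N ℕ.* N ℕ.+ length Θ ℕ.* count diagonal? E²                           ≤⟨ ℕₚ.+-monoʳ-≤ (N ℕ.* N) (ℕₚ.*-monoʳ-≤ (length Θ) diagonal-few) ⟩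
      N ℕ.* N ℕ.+ length Θ ℕ.* N                                            ∎
      where
      open ℕₚ.≤-Reasoning
      diag : ∀ L → sum (map (λ yy → length Θ ℕ.* count diagonal? (yy ∷ [])) L) ≡ length Θ ℕ.* count diagonal? L
      diag []      = sym (ℕₚ.*-zeroʳ (length Θ))
      diag (yy ∷ L) = trans (cong (length Θ ℕ.* count diagonal? (yy ∷ []) ℕ.+_) (diag L))
        (trans (sym (ℕₚ.*-distribˡ-+ (length Θ) (count diagonal? (yy ∷ [])) (count diagonal? L)))
               (cong (length Θ ℕ.*_) (sym (count-∷ diagonal? yy L))))
      diagonal-few : count diagonal? E² ℕ.≤ N
      diagonal-few = injective-length proj₁ (Uniqueₚ.filter⁺ diagonal? (Uniqueₚ.cartesianProduct⁺ E# E#))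
        (λ x∈ y∈ e → cong₂ _,_ e (trans (sym (proj₂ (∈ₚ.∈-filter⁻ diagonal? {xs = E²} x∈))) (trans e (proj₂ (∈ₚ.∈-filter⁻ diagonal? {xs = E²} y∈)))))
        (λ x∈ → proj₁ (∈ₚ.∈-cartesianProduct⁻ E E (proj₁ (∈ₚ.∈-filter⁻ diagonal? {xs = E²} x∈))))
      pointwise : ∀ {yy} → yy ∈ E² → count (λ w → collide? w yy) Θ ℕ.≤ 1 ℕ.+ length Θ ℕ.* count diagonal? (yy ∷ [])
      pointwise {y , y′} yy∈ with y ≟F2 y′
      ... | yes _ = ℕₚ.m≤n⇒m≤1+n (ℕₚ.≤-trans (Listₚ.length-filter (λ w → collide? w (y , y′)) Θ) (ℕₚ.≤-reflexive (sym (ℕₚ.*-identityʳ (length Θ)))))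
      ... | no y≢ = ℕₚ.≤-trans (incompatible (AllPairsₚ.filter⁺ (λ w → collide? w (y , y′)) Θ#)
              λ {w} {w′} w∈ w′∈ D≉0 → y≢ (coordinates-injective w w′ D≉0 (E< (proj₁ (∈ₚ.∈-cartesianProduct⁻ E E yy∈))) (E< (proj₂ (∈ₚ.∈-cartesianProduct⁻ E E yy∈)))
                (proj₂ (∈ₚ.∈-filter⁻ (λ w → collide? w (y , y′)) {xs = Θ} w∈)) (proj₂ (∈ₚ.∈-filter⁻ (λ w → collide? w (y , y′)) {xs = Θ} w′∈))))
              (s≤s z≤n)

    many-collisions : ∀ w ks → (∀ {y} → y ∈ E → key w y ∈ ks) → N ℕ.* N ℕ.≤ length ks ℕ.* collisions w
    many-collisions w ks = cauchy-schwarz (key w) ks E#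

    module _ (Φ : List (ℕ × ℕ)) (Φ# : AllPairs (λ w w′ → det w w′ ≉0) Φ) (Φ≉0 : ∀ {w} → w ∈ Φ → (+ proj₁ w) ≉0 ⊎ (+ proj₂ w) ≉0)
      (|Φ|≤p : length Φ ℕ.≤ p) (d : ℕ) (2d≤p : 2 ℕ.* d ℕ.≤ p) (D : ℕ × ℕ → List ℕ) (|D| : ∀ {w} → w ∈ Φ → length (D w) ℕ.≤ d)
      (D∋ : ∀ {w y} → w ∈ Φ → y ∈ E → key w y ∈ D w) where

      private
        k = length Φ
        q = p ℕ.∸ k

        parallel? : ∀ m w → Dec (det w (1 , m) ≈0)
        parallel? m w = det w (1 , m) ≈0?

        m-determined : ∀ a b m m′ → (a ≉0 ⊎ b ≉0) → (a * m - b * 1ℤ) ≈0 → (a * m′ - b * 1ℤ) ≈0 → (m - m′) ≈0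
        m-determined a b m m′ ab u v = by-cases (a ≈0?)
          (λ a≈0 → contradiction-⊎ ab a≈0 (lin₂ u a≈0 (- 1ℤ) m (eq₁ a b m)))
          (λ a≉0 → cancelˡ a a≉0 (lin₂ u v 1ℤ (- 1ℤ) (eq₂ a b m m′)))
          where
          contradiction-⊎ : ∀ {X : Set} → (a ≉0 ⊎ b ≉0) → a ≈0 → b ≈0 → X
          contradiction-⊎ (inj₁ a≉) a≈ _ = contradiction a≈ a≉
          contradiction-⊎ (inj₂ b≉) _ b≈ = contradiction b≈ b≉
          eq₁ : ∀ a b m → b ≡ - 1ℤ * (a * m - b * 1ℤ) + m * a
          eq₁ = solve-∀
          eq₂ : ∀ a b m m′ → a * (m - m′) ≡ 1ℤ * (a * m - b * 1ℤ) + - 1ℤ * (a * m′ - b * 1ℤ)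
          eq₂ = solve-∀

        few-parallel : ∀ {w} → w ∈ Φ → count (λ m → parallel? m w) (upTo p) ℕ.≤ 1
        few-parallel {w@(a , b)} w∈ = at-most-one (Uniqueₚ.filter⁺ (λ m → parallel? m w) (Uniqueₚ.upTo⁺ p)) λ {m} {m′} m∈ m′∈ →
          let m< , u = ∈ₚ.∈-filter⁻ (λ m → parallel? m w) {xs = upTo p} m∈
              m′< , v = ∈ₚ.∈-filter⁻ (λ m → parallel? m w) {xs = upTo p} m′∈
          in ≈⇒≡ (∈ₚ.∈-upTo⁻ m<) (∈ₚ.∈-upTo⁻ m′<) (m-determined (+ a) (+ b) (+ m) (+ m′) (Φ≉0 w∈) u v)

        transverse? : Decidable (λ m → ¬ Any (λ w → det w (1 , m) ≈0) Φ)
        transverse? m = ¬? (Any.any? (parallel? m) Φ)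

        -- A member of `Φ` is parallel to at most one `(1 , m)` with m < p, so at least p - k slopes
        -- are transverse to `Φ`. Truncation brings the completed family to exactly p directions.
        slopes : List ℕ
        slopes = take q (filter transverse? (upTo p))

        |slopes| : length slopes ≡ q
        |slopes| = trans (Listₚ.length-take q (filter transverse? (upTo p))) (ℕₚ.m≤n⇒m⊓n≡m (ℕₚ.m≤n+o⇒m∸n≤o p k
          (ℕₚ.≤-trans (ℕₚ.≤-reflexive (trans (sym (Listₚ.length-upTo p)) (count-split (λ m → Any.any? (parallel? m) Φ) (upTo p))))
            (ℕₚ.+-monoˡ-≤ _ (ℕₚ.≤-trans (count-Any parallel? Φ (upTo p) 1 few-parallel) (ℕₚ.≤-reflexive (ℕₚ.*-identityʳ k)))))))

        ∈-slopes : ∀ {m} → m ∈ slopes → ¬ Any (λ w → det w (1 , m) ≈0) Φ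
        ∈-slopes m∈ = All.lookup (Allₚ.take⁺ q (Allₚ.all-filter transverse? (upTo p))) m∈

        Ψ : List (ℕ × ℕ)
        Ψ = map (1 ,_) slopes

        |Ψ| : length Ψ ≡ q
        |Ψ| = trans (Listₚ.length-map {B = ℕ × ℕ} (1 ,_) slopes) |slopes|

        slope-det : ∀ m m′ → 1ℤ * m′ - m * 1ℤ ≡ m′ - m
        slope-det = solve-∀

        Ψ# : AllPairs (λ w w′ → det w w′ ≉0) Ψ
        Ψ# = AllPairsₚ.map⁺ (AllPairsₚ.take⁺ q (AllPairsₚ.filter⁺ transverse? (AllPairsₚ.applyUpTo⁺₁ id p
          λ {m} {m′} m<m′ m′<p z → ordered≉0 m<m′ m′<p (subst _≈0 (slope-det (+ m) (+ m′)) z))))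

        Θ# : AllPairs (λ w w′ → det w w′ ≉0) (Φ ++ Ψ)
        Θ# = AllPairsₚ.++⁺ Φ# Ψ# (All.tabulate λ w∈ → Allₚ.map⁺ (All.tabulate λ m∈ z → ∈-slopes m∈ (lose w∈ z)))

        sum-lower : ∀ c Θ → (∀ {w} → w ∈ Θ → N ℕ.* N ℕ.≤ c ℕ.* collisions w) → length Θ ℕ.* (N ℕ.* N) ℕ.≤ c ℕ.* sum (map collisions Θ)
        sum-lower c [] _ = z≤n
        sum-lower c (w ∷ Θ) h = ℕₚ.≤-trans (ℕₚ.+-mono-≤ (h (here refl)) (sum-lower c Θ (λ w∈ → h (there w∈))))
          (ℕₚ.≤-reflexive (sym (ℕₚ.*-distribˡ-+ c (collisions w) (sum (map collisions Θ)))))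

      -- The directions other than Φ take at least their average share N²/p of the collisions, which leaves at most pN to Φ.
      few-poor-directions : 0 ℕ.< N → length Φ ℕ.* N ℕ.≤ 2 ℕ.* (d ℕ.* p)
      few-poor-directions 0<N = arithmetic N p d k q (sum (map collisions Φ)) (sum (map collisions Ψ)) 0<N (ℕₚ.<-trans (s≤s z≤n) 1<p) 2d≤p (ℕₚ.m+[n∸m]≡n |Φ|≤p)
        (sum-lower d Φ (λ {w} w∈ → ℕₚ.≤-trans (many-collisions w (D w) (D∋ w∈)) (ℕₚ.*-monoˡ-≤ (collisions w) (|D| w∈))))
        (subst (λ n → n ℕ.* (N ℕ.* N) ℕ.≤ p ℕ.* sum (map collisions Ψ)) |Ψ|
          (sum-lower p Ψ (λ {w} w∈ → subst (λ n → N ℕ.* N ℕ.≤ n ℕ.* collisions w) (Listₚ.length-upTo p)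
            (many-collisions w (upTo p) (λ {y} _ → ∈ₚ.∈-upTo⁺ (res<p (dot w y)))))))
        (subst₂ (λ s t → s ℕ.≤ N ℕ.* N ℕ.+ t ℕ.* N)
          (trans (cong sum (Listₚ.map-++ collisions Φ Ψ)) (Listₚₐ.sum-++ (map collisions Φ) (map collisions Ψ)))
          (trans (Listₚ.length-++ Φ) (trans (cong (k ℕ.+_) |Ψ|) (ℕₚ.m+[n∸m]≡n |Φ|≤p)))
          (total-collisions (Φ ++ Ψ) Θ#))
        where
        -- The bounds on t and on s + t give s ≤ pN + kN²/p, hence kN² ≤ dpN + dkN²/p. By 2d ≤ p the
        -- last term is at most half of the left side. All is multiplied by p to stay within the
        -- naturals.
        arithmetic : ∀ N p d k q s t → 0 ℕ.< N → 0 ℕ.< p → 2 ℕ.* d ℕ.≤ p → k ℕ.+ q ≡ p → k ℕ.* (N ℕ.* N) ℕ.≤ d ℕ.* s → q ℕ.* (N ℕ.* N) ℕ.≤ p ℕ.* t →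
          s ℕ.+ t ℕ.≤ N ℕ.* N ℕ.+ p ℕ.* N → k ℕ.* N ℕ.≤ 2 ℕ.* (d ℕ.* p)
        arithmetic N p d k q s t 0<N 0<p 2d≤p refl hs ht hst =
          ℕₚ.*-cancelˡ-≤ (p ℕ.* N) ⦃ ℕₚ.m*n≢0 p N ⦃ ℕ.>-nonZero 0<p ⦄ ⦃ ℕ.>-nonZero 0<N ⦄ ⦄ final
          where
          open ℕₚ.≤-Reasoning
          a = N ℕ.* N
          sum≤ : p ℕ.* (k ℕ.* a) ℕ.+ d ℕ.* (q ℕ.* a) ℕ.≤ p ℕ.* d ℕ.* (a ℕ.+ p ℕ.* N)
          sum≤ = begin
            p ℕ.* (k ℕ.* a) ℕ.+ d ℕ.* (q ℕ.* a)   ≤⟨ ℕₚ.+-mono-≤ (ℕₚ.*-monoʳ-≤ p hs) (ℕₚ.*-monoʳ-≤ d ht) ⟩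
            p ℕ.* (d ℕ.* s) ℕ.+ d ℕ.* (p ℕ.* t)   ≡⟨ e p d s t ⟩
            p ℕ.* d ℕ.* (s ℕ.+ t)                 ≤⟨ ℕₚ.*-monoʳ-≤ (p ℕ.* d) hst ⟩
            p ℕ.* d ℕ.* (a ℕ.+ p ℕ.* N)           ∎
            where e : ∀ p d s t → p ℕ.* (d ℕ.* s) ℕ.+ d ℕ.* (p ℕ.* t) ≡ p ℕ.* d ℕ.* (s ℕ.+ t)
                  e = NatSolver.solve-∀
          pka≤ : p ℕ.* (k ℕ.* a) ℕ.≤ p ℕ.* d ℕ.* (p ℕ.* N) ℕ.+ d ℕ.* (k ℕ.* a)
          pka≤ = ℕₚ.+-cancelʳ-≤ (d ℕ.* (q ℕ.* a)) _ _ (begin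
            p ℕ.* (k ℕ.* a) ℕ.+ d ℕ.* (q ℕ.* a)   ≤⟨ sum≤ ⟩
            p ℕ.* d ℕ.* (a ℕ.+ p ℕ.* N)           ≡⟨ e k q d a N ⟩
            p ℕ.* d ℕ.* (p ℕ.* N) ℕ.+ d ℕ.* (k ℕ.* a) ℕ.+ d ℕ.* (q ℕ.* a) ∎)
            where e : ∀ k q d a N → (k ℕ.+ q) ℕ.* d ℕ.* (a ℕ.+ (k ℕ.+ q) ℕ.* N) ≡ (k ℕ.+ q) ℕ.* d ℕ.* ((k ℕ.+ q) ℕ.* N) ℕ.+ d ℕ.* (k ℕ.* a) ℕ.+ d ℕ.* (q ℕ.* a)
                  e = NatSolver.solve-∀
          final : p ℕ.* N ℕ.* (k ℕ.* N) ℕ.≤ p ℕ.* N ℕ.* (2 ℕ.* (d ℕ.* p))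
          final = ℕₚ.+-cancelʳ-≤ (p ℕ.* (k ℕ.* a)) _ _ (begin
            p ℕ.* N ℕ.* (k ℕ.* N) ℕ.+ p ℕ.* (k ℕ.* a)    ≡⟨ e₁ p N k ⟩
            2 ℕ.* (p ℕ.* (k ℕ.* a))                      ≤⟨ ℕₚ.*-monoʳ-≤ 2 pka≤ ⟩
            2 ℕ.* (p ℕ.* d ℕ.* (p ℕ.* N) ℕ.+ d ℕ.* (k ℕ.* a)) ≡⟨ e₂ p d N (k ℕ.* a) ⟩
            p ℕ.* N ℕ.* (2 ℕ.* (d ℕ.* p)) ℕ.+ 2 ℕ.* d ℕ.* (k ℕ.* a) ≤⟨ ℕₚ.+-monoʳ-≤ (p ℕ.* N ℕ.* (2 ℕ.* (d ℕ.* p))) (ℕₚ.*-monoˡ-≤ (k ℕ.* a) 2d≤p) ⟩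
            p ℕ.* N ℕ.* (2 ℕ.* (d ℕ.* p)) ℕ.+ p ℕ.* (k ℕ.* a) ∎)
            where e₁ : ∀ p N k → p ℕ.* N ℕ.* (k ℕ.* N) ℕ.+ p ℕ.* (k ℕ.* (N ℕ.* N)) ≡ 2 ℕ.* (p ℕ.* (k ℕ.* (N ℕ.* N)))
                  e₁ = NatSolver.solve-∀
                  e₂ : ∀ p d N x → 2 ℕ.* (p ℕ.* d ℕ.* (p ℕ.* N) ℕ.+ d ℕ.* x) ≡ p ℕ.* N ℕ.* (2 ℕ.* (d ℕ.* p)) ℕ.+ 2 ℕ.* d ℕ.* x
                  e₂ = NatSolver.solve-∀

-- The form x · x is anisotropic for p ≡ 3 (mod 4).

parity : ∀ n → ∃[ u ] (n ≡ 2 ℕ.* u ⊎ n ≡ suc (2 ℕ.* u))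
parity zero = 0 , inj₁ refl
parity (suc n) with parity n
... | u , inj₁ e = u , inj₂ (cong suc e)
... | u , inj₂ e = suc u , inj₁ (trans (cong suc e) (sym (ℕₚ.*-suc 2 u)))

private
  %4-helper : ∀ x y → (x ℕ.+ y ℕ.* 4) ℕ.% 4 ≡ x ℕ.% 4
  %4-helper x y = ℕᵐ.[m+kn]%n≡m%n x y 4

  odd≢even : ∀ a b → suc (2 ℕ.* a) ≢ 2 ℕ.* b
  odd≢even a b e with () ← trans (sym (trans (cong (λ z → suc z ℕ.% 2) (ℕₚ.*-comm 2 a)) (ℕᵐ.[m+kn]%n≡m%n 1 a 2)))
                              (trans (cong (ℕ._% 2) e) (trans (cong (ℕ._% 2) (ℕₚ.*-comm 2 b)) (ℕᵐ.m*n%n≡0 b 2)))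

  cofactor≡3 : ∀ u c i j → c ℕ.< 4 → 2 ℕ.* u ℕ.* (2 ℕ.* u) ℕ.+ 1 ≡ (c ℕ.+ i ℕ.* 4) ℕ.* (3 ℕ.+ j ℕ.* 4) → c ≡ 3
  cofactor≡3 u c i j c<4 e = go c c<4 (trans (sym (%4-helper (c ℕ.* 3) (c ℕ.* j ℕ.+ i ℕ.* 3 ℕ.+ i ℕ.* j ℕ.* 4))) (trans (cong (ℕ._% 4) (trans (sym (right c i j)) (sym e)))
      (trans (cong (ℕ._% 4) (left u)) (%4-helper 1 (u ℕ.* u)))))
    where
    left : ∀ u → 2 ℕ.* u ℕ.* (2 ℕ.* u) ℕ.+ 1 ≡ 1 ℕ.+ u ℕ.* u ℕ.* 4
    left = NatSolver.solve-∀
    right : ∀ c i j → (c ℕ.+ i ℕ.* 4) ℕ.* (3 ℕ.+ j ℕ.* 4) ≡ c ℕ.* 3 ℕ.+ (c ℕ.* j ℕ.+ i ℕ.* 3 ℕ.+ i ℕ.* j ℕ.* 4) ℕ.* 4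
    right = NatSolver.solve-∀
    go : ∀ c → c ℕ.< 4 → (c ℕ.* 3) ℕ.% 4 ≡ 1 → c ≡ 3
    go 0 _ ()
    go 1 _ ()
    go 2 _ ()
    go 3 _ _ = refl
    go (suc (suc (suc (suc _)))) (s≤s (s≤s (s≤s (s≤s ())))) _

-- Descent: an even root 2u < m of x² + 1 modulo m ≡ 3 (mod 4) has a cofactor m′ < m which is again ≡ 3 (mod 4).
no-square-root-of--1 : ∀ j a → ¬ (3 ℕ.+ j ℕ.* 4) ℕᵈ.∣ (a ℕ.* a ℕ.+ 1)
no-square-root-of--1 j = go j (<-wellFounded j)
  where
  even-root : ∀ j → Acc ℕ._<_ j → ∀ u → 2 ℕ.* u ℕ.< 3 ℕ.+ j ℕ.* 4 → ¬ (3 ℕ.+ j ℕ.* 4) ℕᵈ.∣ (2 ℕ.* u ℕ.* (2 ℕ.* u) ℕ.+ 1)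

  go : ∀ j → Acc ℕ._<_ j → ∀ a → ¬ (3 ℕ.+ j ℕ.* 4) ℕᵈ.∣ (a ℕ.* a ℕ.+ 1)
  go j ac a m∣ = choose (parity r)
    where
    m r q t : ℕ
    m = 3 ℕ.+ j ℕ.* 4
    r = a ℕ.% m
    q = a ℕ./ m
    t = m ℕ.∸ r
    r<m : r ℕ.< m
    r<m = ℕᵐ.m%n<n a m
    r+t≡m : r ℕ.+ t ≡ m
    r+t≡m = ℕₚ.m+[n∸m]≡n (ℕₚ.<⇒≤ r<m)
    expand : ∀ r q m → (r ℕ.+ q ℕ.* m) ℕ.* (r ℕ.+ q ℕ.* m) ℕ.+ 1 ≡ (2 ℕ.* r ℕ.* q ℕ.+ q ℕ.* q ℕ.* m) ℕ.* m ℕ.+ (r ℕ.* r ℕ.+ 1)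
    expand = NatSolver.solve-∀
    m∣r : m ℕᵈ.∣ (r ℕ.* r ℕ.+ 1)
    m∣r = ℕᵈ.∣m+n∣m⇒∣n (subst (m ℕᵈ.∣_) (trans (cong (λ a → a ℕ.* a ℕ.+ 1) (ℕᵐ.m≡m%n+[m/n]*n a m)) (expand r q m)) m∣)
            (ℕᵈ.n∣m*n (2 ℕ.* r ℕ.* q ℕ.+ q ℕ.* q ℕ.* m))
    reflect : ∀ r t m → r ℕ.+ t ≡ m → 2 ℕ.* r ℕ.* m ℕ.+ (t ℕ.* t ℕ.+ 1) ≡ m ℕ.* m ℕ.+ (r ℕ.* r ℕ.+ 1)
    reflect r t .(r ℕ.+ t) refl = eq r t
      where eq : ∀ r t → 2 ℕ.* r ℕ.* (r ℕ.+ t) ℕ.+ (t ℕ.* t ℕ.+ 1) ≡ (r ℕ.+ t) ℕ.* (r ℕ.+ t) ℕ.+ (r ℕ.* r ℕ.+ 1)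
            eq = NatSolver.solve-∀
    m∣t : m ℕᵈ.∣ (t ℕ.* t ℕ.+ 1)
    m∣t = ℕᵈ.∣m+n∣m⇒∣n (subst (m ℕᵈ.∣_) (sym (reflect r t m r+t≡m)) (ℕᵈ.∣m∣n⇒∣m+n (ℕᵈ.m∣m*n m) m∣r)) (ℕᵈ.n∣m*n (2 ℕ.* r))
    -- The modulus is odd, so an odd root r is exchanged for the even root m - r.
    choose-t : ∀ u → r ≡ suc (2 ℕ.* u) → ∃[ w ] (t ≡ 2 ℕ.* w ⊎ t ≡ suc (2 ℕ.* w)) → ⊥
    choose-t u r≡ (w , inj₁ t≡) = even-root j ac w
      (subst (ℕ._< m) t≡ (ℕₚ.∸-monoʳ-< (subst (0 ℕ.<_) (sym r≡) (s≤s z≤n)) (ℕₚ.<⇒≤ r<m)))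
      (subst (λ t → m ℕᵈ.∣ (t ℕ.* t ℕ.+ 1)) t≡ m∣t)
    choose-t u r≡ (w , inj₂ t≡) = odd≢even (1 ℕ.+ 2 ℕ.* j) (1 ℕ.+ u ℕ.+ w)
      (trans (eq₁ j) (trans (sym r+t≡m) (trans (cong₂ ℕ._+_ r≡ t≡) (eq₂ u w))))
      where
      eq₁ : ∀ j → suc (2 ℕ.* (1 ℕ.+ 2 ℕ.* j)) ≡ 3 ℕ.+ j ℕ.* 4
      eq₁ = NatSolver.solve-∀
      eq₂ : ∀ u w → suc (2 ℕ.* u) ℕ.+ suc (2 ℕ.* w) ≡ 2 ℕ.* (1 ℕ.+ u ℕ.+ w)
      eq₂ = NatSolver.solve-∀
    choose : ∃[ u ] (r ≡ 2 ℕ.* u ⊎ r ≡ suc (2 ℕ.* u)) → ⊥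
    choose (u , inj₁ r≡) = even-root j ac u (subst (ℕ._< m) r≡ r<m) (subst (λ r → m ℕᵈ.∣ (r ℕ.* r ℕ.+ 1)) r≡ m∣r)
    choose (u , inj₂ r≡) = choose-t u r≡ (parity t)

  even-root j (acc rec) u 2u<m (ℕᵈ.divides m′ e) = go i (rec i<j) (2 ℕ.* u) (ℕᵈ.divides (3 ℕ.+ j ℕ.* 4) (trans e (trans (ℕₚ.*-comm m′ (3 ℕ.+ j ℕ.* 4)) (cong ((3 ℕ.+ j ℕ.* 4) ℕ.*_) m′≡))))
    where
    i c : ℕ
    i = m′ ℕ./ 4
    c = m′ ℕ.% 4
    m′≡c : m′ ≡ c ℕ.+ i ℕ.* 4
    m′≡c = ℕᵐ.m≡m%n+[m/n]*n m′ 4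
    m′≡ : m′ ≡ 3 ℕ.+ i ℕ.* 4
    m′≡ = trans m′≡c (cong (ℕ._+ i ℕ.* 4) (cofactor≡3 u c i j (ℕᵐ.m%n<n m′ 4) (trans e (cong (ℕ._* (3 ℕ.+ j ℕ.* 4)) m′≡c))))
    m′<m : m′ ℕ.< 3 ℕ.+ j ℕ.* 4
    m′<m = ℕₚ.*-cancelʳ-< (3 ℕ.+ j ℕ.* 4) m′ (3 ℕ.+ j ℕ.* 4) (subst (ℕ._< (3 ℕ.+ j ℕ.* 4) ℕ.* (3 ℕ.+ j ℕ.* 4)) e
      (ℕₚ.≤-<-trans (ℕₚ.+-monoˡ-≤ 1 (ℕₚ.*-mono-≤ (ℕₚ.≤-pred 2u<m) (ℕₚ.≤-pred 2u<m)))
        (ℕₚ.≤-trans (ℕₚ.m≤m+n _ (3 ℕ.+ 8 ℕ.* j)) (ℕₚ.≤-reflexive (eq j)))))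
      where eq : ∀ j → suc ((2 ℕ.+ j ℕ.* 4) ℕ.* (2 ℕ.+ j ℕ.* 4) ℕ.+ 1) ℕ.+ (3 ℕ.+ 8 ℕ.* j) ≡ (3 ℕ.+ j ℕ.* 4) ℕ.* (3 ℕ.+ j ℕ.* 4)
            eq = NatSolver.solve-∀
    i<j : i ℕ.< j
    i<j = ℕₚ.*-cancelʳ-< 4 i j (ℕₚ.+-cancelˡ-< 3 (i ℕ.* 4) (j ℕ.* 4) (subst (ℕ._< 3 ℕ.+ j ℕ.* 4) m′≡ m′<m))

module Anisotropy (p : ℕ) (p-prime : Prime p) (p≡3 : p ℕ.% 4 ≡ 3) where
  open Modular p p-prime

  no-root : ∀ a → (a * a + 1ℤ) ≉0
  no-root a z = no-square-root-of--1 (p ℕ./ 4) (res a) (subst₂ ℕᵈ._∣_ p≡ abs≡ (∣⇒∣ᵤ res-root))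
    where
    p≡ : p ≡ 3 ℕ.+ p ℕ./ 4 ℕ.* 4
    p≡ = trans (ℕᵐ.m≡m%n+[m/n]*n p 4) (cong (ℕ._+ p ℕ./ 4 ℕ.* 4) p≡3)
    res-root : (+ res a * + res a + 1ℤ) ≈0
    res-root = lin₂ z (x≈res a) 1ℤ (- (a + + res a)) (eq a (+ res a))
      where eq : ∀ a r → r * r + 1ℤ ≡ 1ℤ * (a * a + 1ℤ) + - (a + r) * (a - r)
            eq = solve-∀
    abs≡ : ∣ + res a * + res a + 1ℤ ∣ ≡ res a ℕ.* res a ℕ.+ 1
    abs≡ = cong (λ n → ∣ n + 1ℤ ∣) (sym (ℤₚ.pos-* (res a) (res a)))

  anisotropic : ∀ a b → (a ≉0 ⊎ b ≉0) → (a * a + b * b) ≉0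
  anisotropic a b (inj₁ a≉0) z with inverse a a≉0
  ... | c , ac≈1 = no-root (b * c) (lin₂ z ac≈1 (c * c) (- (a * c + 1ℤ)) (eq a b c))
    where eq : ∀ a b c → b * c * (b * c) + 1ℤ ≡ c * c * (a * a + b * b) + - (a * c + 1ℤ) * (a * c - 1ℤ)
          eq = solve-∀
  anisotropic a b (inj₂ b≉0) z = anisotropic b a (inj₁ b≉0) (lin₁ z 1ℤ (eq a b))
    where eq : ∀ a b → b * b + a * a ≡ 1ℤ * (a * a + b * b)
          eq = solve-∀

-- Numerical parameters of the polynomial method.

integer-sqrt : ∀ Q → ∃[ r ] (r ℕ.* r ℕ.≤ Q × Q ℕ.< suc r ℕ.* suc r)
integer-sqrt zero = 0 , z≤n , s≤s z≤n
integer-sqrt (suc Q) with integer-sqrt Q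
... | r , r²≤ , <r² with ℕₚ.m≤n⇒m<n∨m≡n <r²
...   | inj₁ lt = r , ℕₚ.m≤n⇒m≤1+n r²≤ , lt
...   | inj₂ eq = suc r , ℕₚ.≤-reflexive (sym eq) , subst (ℕ._< suc (suc r) ℕ.* suc (suc r)) (sym eq)
          (ℕₚ.*-mono-< (ℕₚ.n<1+n (suc r)) (ℕₚ.n<1+n (suc r)))

square-cancel-≤ : ∀ {a b} → a ℕ.* a ℕ.≤ b ℕ.* b → a ℕ.≤ b
square-cancel-≤ a²≤b² = ℕₚ.≮⇒≥ λ b<a → ℕₚ.<⇒≱ (ℕₚ.*-mono-< b<a b<a) a²≤b²

square-cancel-< : ∀ {a b} → a ℕ.* a ℕ.< b ℕ.* b → a ℕ.< b
square-cancel-< a²<b² = ℕₚ.≰⇒> λ b≤a → ℕₚ.<⇒≱ a²<b² (ℕₚ.*-mono-≤ b≤a b≤a)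

-- The parameters of the polynomial method: h = ⌊√(8kd²)⌋ + 1 is large enough for a polynomial of degree 3h to vanish
-- on 2kd² lines, and minimal degree 16h is forced.
grid-arithmetic : ∀ p k d N gp → 1 ℕ.≤ k → 1 ℕ.≤ d → k ℕ.≤ d → 2 ℕ.* d ℕ.≤ N → 120 ℕ.* (k ℕ.* d) ℕ.< p →
  N ℕ.* N ℕ.≤ d ℕ.* (gp ℕ.+ N) →
  (∀ h m → let n = h ℕ.+ (h ℕ.+ (h ℕ.+ 1)) in
    4 ℕ.* (k ℕ.* d) ℕ.≤ p → h ℕ.≤ p → 2 ℕ.* (d ℕ.* (k ℕ.* d)) ℕ.* n ℕ.< h ℕ.* (h ℕ.* h) → 4 ℕ.* n ℕ.≤ m → 4 ℕ.* n ℕ.+ 4 ℕ.< p →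
    n ℕ.+ (d ℕ.+ k) ℕ.< m → gp ℕ.* (k ℕ.* k) ℕ.≤ 2 ℕ.* (m ℕ.* (2 ℕ.* (d ℕ.* (k ℕ.* d))))) →
  k ℕ.* (N ℕ.* N ℕ.* (N ℕ.* N)) ℕ.≤ 524288 ℕ.* (d ℕ.* d ℕ.* (d ℕ.* d) ℕ.* (d ℕ.* d ℕ.* (d ℕ.* d)))
grid-arithmetic p k d N gp 1≤k 1≤d k≤d 2d≤N 120kd<p pairs few = go (integer-sqrt Q)
  where
  open ℕₚ.≤-Reasoning
  Q = 8 ℕ.* (k ℕ.* (d ℕ.* d))
  d²≤Q : d ℕ.* d ℕ.≤ Q
  d²≤Q = begin
    d ℕ.* d                   ≡⟨ sym (ℕₚ.*-identityˡ (d ℕ.* d)) ⟩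
    1 ℕ.* (d ℕ.* d)           ≤⟨ ℕₚ.*-monoˡ-≤ (d ℕ.* d) 1≤k ⟩
    k ℕ.* (d ℕ.* d)           ≤⟨ ℕₚ.m≤m+n _ _ ⟩
    Q                         ∎
  go : ∃[ r ] (r ℕ.* r ℕ.≤ Q × Q ℕ.< suc r ℕ.* suc r) → _
  -- The estimate `N² k ≤ 128 h d³` is squared and combined with `h² ≤ 32 k d²`; the constant 524288
  -- is 128² · 32.
  go (r , r²≤Q , Q<h²) = ℕₚ.*-cancelˡ-≤ k ⦃ ℕ.>-nonZero 1≤k ⦄ (begin
    k ℕ.* (k ℕ.* (N ℕ.* N ℕ.* (N ℕ.* N)))                              ≡⟨ e₁ k N ⟩
    N ℕ.* N ℕ.* k ℕ.* (N ℕ.* N ℕ.* k)                                   ≤⟨ ℕₚ.*-mono-≤ N²k≤ N²k≤ ⟩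
    128 ℕ.* (h ℕ.* (d ℕ.* (d ℕ.* d))) ℕ.* (128 ℕ.* (h ℕ.* (d ℕ.* (d ℕ.* d)))) ≡⟨ e₂ h d ⟩
    16384 ℕ.* (h ℕ.* h) ℕ.* (d ℕ.* d ℕ.* (d ℕ.* d) ℕ.* (d ℕ.* d))       ≤⟨ ℕₚ.*-monoˡ-≤ (d ℕ.* d ℕ.* (d ℕ.* d) ℕ.* (d ℕ.* d)) (ℕₚ.*-monoʳ-≤ 16384 h²≤) ⟩
    16384 ℕ.* (32 ℕ.* (k ℕ.* (d ℕ.* d))) ℕ.* (d ℕ.* d ℕ.* (d ℕ.* d) ℕ.* (d ℕ.* d)) ≡⟨ e₃ (k ℕ.* (d ℕ.* d)) (d ℕ.* d ℕ.* (d ℕ.* d) ℕ.* (d ℕ.* d)) ⟩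
    524288 ℕ.* (k ℕ.* (d ℕ.* d) ℕ.* (d ℕ.* d ℕ.* (d ℕ.* d) ℕ.* (d ℕ.* d))) ≡⟨ e₄ k d 524288 ⟩
    k ℕ.* (524288 ℕ.* (d ℕ.* d ℕ.* (d ℕ.* d) ℕ.* (d ℕ.* d ℕ.* (d ℕ.* d)))) ∎)
    where
    h = suc r
    n = h ℕ.+ (h ℕ.+ (h ℕ.+ 1))
    m = 16 ℕ.* h
    e₁ : ∀ k N → k ℕ.* (k ℕ.* (N ℕ.* N ℕ.* (N ℕ.* N))) ≡ N ℕ.* N ℕ.* k ℕ.* (N ℕ.* N ℕ.* k)
    e₁ = NatSolver.solve-∀
    e₂′ : ∀ c h d → c ℕ.* (h ℕ.* (d ℕ.* (d ℕ.* d))) ℕ.* (c ℕ.* (h ℕ.* (d ℕ.* (d ℕ.* d)))) ≡ c ℕ.* c ℕ.* (h ℕ.* h) ℕ.* (d ℕ.* d ℕ.* (d ℕ.* d) ℕ.* (d ℕ.* d))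
    e₂′ = NatSolver.solve-∀
    e₂ : ∀ h d → 128 ℕ.* (h ℕ.* (d ℕ.* (d ℕ.* d))) ℕ.* (128 ℕ.* (h ℕ.* (d ℕ.* (d ℕ.* d)))) ≡ 16384 ℕ.* (h ℕ.* h) ℕ.* (d ℕ.* d ℕ.* (d ℕ.* d) ℕ.* (d ℕ.* d))
    e₂ = e₂′ 128
    e₃′ : ∀ a b x y → a ℕ.* (b ℕ.* x) ℕ.* y ≡ a ℕ.* b ℕ.* (x ℕ.* y)
    e₃′ = NatSolver.solve-∀
    e₃ : ∀ x y → 16384 ℕ.* (32 ℕ.* x) ℕ.* y ≡ 524288 ℕ.* (x ℕ.* y)
    e₃ = e₃′ 16384 32
    e₄ : ∀ k d c → c ℕ.* (k ℕ.* (d ℕ.* d) ℕ.* (d ℕ.* d ℕ.* (d ℕ.* d) ℕ.* (d ℕ.* d))) ≡ k ℕ.* (c ℕ.* (d ℕ.* d ℕ.* (d ℕ.* d) ℕ.* (d ℕ.* d ℕ.* (d ℕ.* d))))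
    e₄ = NatSolver.solve-∀
    n≤4h : n ℕ.≤ 4 ℕ.* h
    n≤4h = ℕₚ.≤-trans (ℕₚ.+-monoʳ-≤ h (ℕₚ.+-monoʳ-≤ h (ℕₚ.+-monoʳ-≤ h {1} {h} (s≤s z≤n)))) (ℕₚ.≤-reflexive (eq h))
      where eq : ∀ h → h ℕ.+ (h ℕ.+ (h ℕ.+ h)) ≡ 4 ℕ.* h
            eq = NatSolver.solve-∀
    d<h : d ℕ.< h
    d<h = square-cancel-< (ℕₚ.≤-<-trans d²≤Q Q<h²)
    1≤r : 1 ℕ.≤ r
    1≤r = ℕₚ.≮⇒≥ λ r<1 → ℕₚ.<⇒≱ d<h (ℕₚ.≤-trans r<1 1≤d)
    h²≤ : h ℕ.* h ℕ.≤ 32 ℕ.* (k ℕ.* (d ℕ.* d))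
    h²≤ = begin
      h ℕ.* h                          ≤⟨ ℕₚ.*-mono-≤ (ℕₚ.+-monoˡ-≤ r 1≤r) (ℕₚ.+-monoˡ-≤ r 1≤r) ⟩
      (r ℕ.+ r) ℕ.* (r ℕ.+ r)          ≡⟨ eq r ⟩
      4 ℕ.* (r ℕ.* r)                  ≤⟨ ℕₚ.*-monoʳ-≤ 4 r²≤Q ⟩
      4 ℕ.* Q                          ≡⟨ sym (ℕₚ.*-assoc 4 8 (k ℕ.* (d ℕ.* d))) ⟩
      32 ℕ.* (k ℕ.* (d ℕ.* d))         ∎
      where eq : ∀ r → (r ℕ.+ r) ℕ.* (r ℕ.+ r) ≡ 4 ℕ.* (r ℕ.* r)
            eq = NatSolver.solve-∀
    h≤6kd : h ℕ.≤ 6 ℕ.* (k ℕ.* d)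
    h≤6kd = square-cancel-≤ (begin
      h ℕ.* h                             ≤⟨ h²≤ ⟩
      32 ℕ.* (k ℕ.* (d ℕ.* d))            ≤⟨ ℕₚ.*-mono-≤ {32} {36} (ℕₚ.m≤m+n 32 4) (ℕₚ.*-monoʳ-≤ k (ℕₚ.≤-trans (ℕₚ.≤-reflexive (sym (ℕₚ.*-identityˡ (d ℕ.* d)))) (ℕₚ.*-monoˡ-≤ (d ℕ.* d) 1≤k))) ⟩
      36 ℕ.* (k ℕ.* (k ℕ.* (d ℕ.* d)))    ≡⟨ eq k d 6 ⟩
      6 ℕ.* (k ℕ.* d) ℕ.* (6 ℕ.* (k ℕ.* d)) ∎)
      where eq : ∀ k d c → c ℕ.* c ℕ.* (k ℕ.* (k ℕ.* (d ℕ.* d))) ≡ c ℕ.* (k ℕ.* d) ℕ.* (c ℕ.* (k ℕ.* d))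
            eq = NatSolver.solve-∀
    20h<p : 20 ℕ.* h ℕ.< p
    20h<p = ℕₚ.≤-<-trans (ℕₚ.≤-trans (ℕₚ.*-monoʳ-≤ 20 h≤6kd) (ℕₚ.≤-reflexive (sym (ℕₚ.*-assoc 20 6 (k ℕ.* d))))) 120kd<p
    4n≤16h : 4 ℕ.* n ℕ.≤ m
    4n≤16h = ℕₚ.≤-trans (ℕₚ.*-monoʳ-≤ 4 n≤4h) (ℕₚ.≤-reflexive (sym (ℕₚ.*-assoc 4 4 h)))
    4≤4h : 4 ℕ.≤ 4 ℕ.* h
    4≤4h = ℕₚ.*-monoʳ-≤ 4 {1} {h} (s≤s z≤n)
    small : 2 ℕ.* (d ℕ.* (k ℕ.* d)) ℕ.* n ℕ.< h ℕ.* (h ℕ.* h)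
    small = begin-strict
      2 ℕ.* (d ℕ.* (k ℕ.* d)) ℕ.* n              ≤⟨ ℕₚ.*-monoʳ-≤ (2 ℕ.* (d ℕ.* (k ℕ.* d))) n≤4h ⟩
      2 ℕ.* (d ℕ.* (k ℕ.* d)) ℕ.* (4 ℕ.* h)      ≡⟨ eq d k h 2 4 ⟩
      h ℕ.* Q                                    <⟨ ℕₚ.*-monoʳ-< h Q<h² ⟩
      h ℕ.* (h ℕ.* h)                            ∎
      where eq : ∀ d k h a b → a ℕ.* (d ℕ.* (k ℕ.* d)) ℕ.* (b ℕ.* h) ≡ h ℕ.* (a ℕ.* b ℕ.* (k ℕ.* (d ℕ.* d)))
            eq = NatSolver.solve-∀
    n<m : n ℕ.+ (d ℕ.+ k) ℕ.< m
    n<m = begin-strict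
      n ℕ.+ (d ℕ.+ k)                  ≤⟨ ℕₚ.+-mono-≤ n≤4h (ℕₚ.+-mono-≤ (ℕₚ.<⇒≤ d<h) (ℕₚ.≤-trans k≤d (ℕₚ.<⇒≤ d<h))) ⟩
      4 ℕ.* h ℕ.+ (h ℕ.+ h)            ≡⟨ eq h ⟩
      6 ℕ.* h                          <⟨ ℕₚ.*-monoˡ-< h {6} {16} (ℕₚ.m≤m+n 7 9) ⟩
      16 ℕ.* h                         ∎
      where eq : ∀ h → 4 ℕ.* h ℕ.+ (h ℕ.+ h) ≡ 6 ℕ.* h
            eq = NatSolver.solve-∀
    gpk≤ : gp ℕ.* k ℕ.≤ 64 ℕ.* (h ℕ.* (d ℕ.* d))
    gpk≤ = ℕₚ.*-cancelʳ-≤ _ _ k ⦃ ℕ.>-nonZero 1≤k ⦄ (begin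
      gp ℕ.* k ℕ.* k                                ≡⟨ ℕₚ.*-assoc gp k k ⟩
      gp ℕ.* (k ℕ.* k)                              ≤⟨ few h m (ℕₚ.≤-trans (ℕₚ.*-monoˡ-≤ (k ℕ.* d) {4} {120} (ℕₚ.m≤m+n 4 116)) (ℕₚ.<⇒≤ 120kd<p))
                                                          (ℕₚ.≤-trans (ℕₚ.m≤m+n h (19 ℕ.* h)) (ℕₚ.<⇒≤ 20h<p)) small 4n≤16h
                                                          (ℕₚ.≤-<-trans (ℕₚ.≤-trans (ℕₚ.+-mono-≤ 4n≤16h 4≤4h) (ℕₚ.≤-reflexive (sym (ℕₚ.*-distribʳ-+ h 16 4)))) 20h<p) n<m ⟩
      2 ℕ.* (16 ℕ.* h ℕ.* (2 ℕ.* (d ℕ.* (k ℕ.* d)))) ≡⟨ eq h d k 2 16 ⟩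
      64 ℕ.* (h ℕ.* (d ℕ.* d)) ℕ.* k                ∎)
      where eq : ∀ h d k a b → a ℕ.* (b ℕ.* h ℕ.* (a ℕ.* (d ℕ.* (k ℕ.* d)))) ≡ a ℕ.* b ℕ.* a ℕ.* (h ℕ.* (d ℕ.* d)) ℕ.* k
            eq = NatSolver.solve-∀
    N²k≤ : N ℕ.* N ℕ.* k ℕ.≤ 128 ℕ.* (h ℕ.* (d ℕ.* (d ℕ.* d)))
    -- Doubling the count of pairs lets `2d ≤ N` absorb its diagonal term dN.
    N²k≤ = ℕₚ.+-cancelʳ-≤ (N ℕ.* N ℕ.* k) _ _ (begin
      N ℕ.* N ℕ.* k ℕ.+ N ℕ.* N ℕ.* k                       ≤⟨ ℕₚ.+-mono-≤ (ℕₚ.*-monoˡ-≤ k pairs) (ℕₚ.*-monoˡ-≤ k pairs) ⟩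
      d ℕ.* (gp ℕ.+ N) ℕ.* k ℕ.+ d ℕ.* (gp ℕ.+ N) ℕ.* k     ≡⟨ eq₁ d gp N k ⟩
      2 ℕ.* (d ℕ.* (gp ℕ.* k)) ℕ.+ 2 ℕ.* d ℕ.* (N ℕ.* k)    ≤⟨ ℕₚ.+-mono-≤ (ℕₚ.*-monoʳ-≤ 2 (ℕₚ.*-monoʳ-≤ d gpk≤)) (ℕₚ.*-monoˡ-≤ (N ℕ.* k) 2d≤N) ⟩
      2 ℕ.* (d ℕ.* (64 ℕ.* (h ℕ.* (d ℕ.* d)))) ℕ.+ N ℕ.* (N ℕ.* k) ≡⟨ cong₂ ℕ._+_ (eq₂ d h 2 64) (sym (ℕₚ.*-assoc N N k)) ⟩
      128 ℕ.* (h ℕ.* (d ℕ.* (d ℕ.* d))) ℕ.+ N ℕ.* N ℕ.* k   ∎)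
      where eq₁ : ∀ d gp N k → d ℕ.* (gp ℕ.+ N) ℕ.* k ℕ.+ d ℕ.* (gp ℕ.+ N) ℕ.* k ≡ 2 ℕ.* (d ℕ.* (gp ℕ.* k)) ℕ.+ 2 ℕ.* d ℕ.* (N ℕ.* k)
            eq₁ = NatSolver.solve-∀
            eq₂ : ∀ d h a b → a ℕ.* (d ℕ.* (b ℕ.* (h ℕ.* (d ℕ.* d)))) ≡ a ℕ.* b ℕ.* (h ℕ.* (d ℕ.* (d ℕ.* d)))
            eq₂ = NatSolver.solve-∀

-- Coordinates from two directions, slopes from the others.

module Slopes (p : ℕ) (p-prime : Prime p) where
  open Modular p p-prime
  open Directions p p-prime
  open Grid p p-prime

  private
    intercept-identity : ∀ α β ω a b s κ e g i D → (α - a) ≈0 → (β - b) ≈0 → (- (e * i) - s) ≈0 → (g * i - 1ℤ) ≈0 → (ω - κ) ≈0 →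
      D * ω ≡ g * α + e * β → ((a - s * b) - i * D * κ) ≈0
    intercept-identity α β ω a b s κ e g i D u v w x y Dω = lin₂ (lin₃ u v w (- 1ℤ) s β refl) (lin₂ x y (- α) (i * D) refl) 1ℤ 1ℤ
      (trans (eq α β ω a b s κ e g i D) (replace
        (1ℤ * (- 1ℤ * (α - a) + s * (β - b) + β * (- (e * i) - s)) + 1ℤ * (- α * (g * i - 1ℤ) + i * D * (ω - κ)))
        i Dω))
      where
      eq : ∀ α β ω a b s κ e g i D → (a - s * b) - i * D * κ ≡
        (1ℤ * (- 1ℤ * (α - a) + s * (β - b) + β * (- (e * i) - s)) + 1ℤ * (- α * (g * i - 1ℤ) + i * D * (ω - κ))) + i * (g * α + e * β) - i * (D * ω)
      eq = solve-∀
      cancel : ∀ m i t → m + i * t - i * t ≡ m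
      cancel = solve-∀
      replace : ∀ m i {s t} → s ≡ t → m + i * t - i * s ≡ m
      replace m i {s} refl = cancel m i s

    expansion : ∀ a b c d x y u v → (a * d - b * c) * (x * u + y * v) ≡ (x * d - y * c) * (a * u + b * v) + (a * y - b * x) * (c * u + d * v)
    expansion = solve-∀

    slope-identity : ∀ e g i e′ g′ i′ → (- (e * i) - - (e′ * i′)) ≈0 → (g * i - 1ℤ) ≈0 → (g′ * i′ - 1ℤ) ≈0 → (e * g′ - e′ * g) ≈0
    slope-identity e g i e′ g′ i′ u v w = lin₃ u v w (- (g * g′)) (- (e * g′)) (e′ * g) (eq e g i e′ g′ i′)
      where
      eq : ∀ e g i e′ g′ i′ → e * g′ - e′ * g ≡ - (g * g′) * (- (e * i) - - (e′ * i′)) + - (e * g′) * (g * i - 1ℤ) + e′ * g * (g′ * i′ - 1ℤ)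
      eq = solve-∀

    plücker : ∀ a b c d x y u v → (a * y - b * x) * (u * d - v * c) - (a * v - b * u) * (x * d - y * c) ≡ (a * d - b * c) * (u * y - v * x)
    plücker = solve-∀

  module _ (E : List (ℕ × ℕ)) (E# : Unique E) (E< : ∀ {y} → y ∈ E → Bounded y)
    (w₁ w₂ : ℕ × ℕ) (W : List (ℕ × ℕ)) (w₁₂ : det w₁ w₂ ≉0) (W₂ : ∀ {w} → w ∈ W → det w w₂ ≉0)
    (W# : AllPairs (λ w w′ → det w w′ ≉0) W) (d : ℕ) (D : ℕ × ℕ → List ℕ) (D# : ∀ w → Unique (D w)) (D<p : ∀ {w t} → t ∈ D w → t ℕ.< p)
    (D∋ : ∀ {w y} → y ∈ E → key w y ∈ D w)
    (|D₁| : length (D w₁) ℕ.≤ d) (|D₂| : length (D w₂) ℕ.≤ d) (|D| : ∀ {w} → w ∈ W → length (D w) ℕ.≤ d) where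

    private
      N = length E
      k = length W

      -- By Cramer's rule, `det w₁ w₂ (w · y) = det w w₂ (w₁ · y) + det w₁ w (w₂ · y)`. For this
      -- slope s the intercept a - sb is therefore a fixed multiple of w · y and takes at most d
      -- values.
      slopeℤ : ℕ × ℕ → ℤ
      slopeℤ w = - (det w₁ w * reciprocal (det w w₂))

      slope : ℕ × ℕ → ℕ
      slope w = res (slopeℤ w)

      pts : List (ℕ × ℕ)
      pts = map (λ y → key w₁ y , key w₂ y) E

      pts# : Unique pts
      pts# = AllPairsₚ.map⁺ (AllPairs-∈ E# λ y∈ y′∈ y≢ e → y≢ (coordinates-injective w₁ w₂ w₁₂ (E< y∈) (E< y′∈) (cong proj₁ e) (cong proj₂ e)))

      pts⊆ : ∀ {e} → e ∈ pts → proj₁ e ∈ D w₁ × proj₂ e ∈ D w₂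
      pts⊆ e∈ with ∈ₚ.∈-map⁻ (λ y → key w₁ y , key w₂ y) e∈
      ... | y , y∈ , refl = D∋ y∈ , D∋ y∈

      S : List ℕ
      S = map slope W

      -- By the Plücker relation, equal slopes would make the product of `det w₁ w₂` and `det w w′`
      -- vanish.
      distinct-slopes : ∀ {w w′} → w ∈ W → w′ ∈ W → det w w′ ≉0 → slope w ≢ slope w′
      distinct-slopes {w@(x , y)} {w′@(u , v)} w∈ w′∈ ww′ e = *≉0 w₁₂ ww′ (lin₁
        (slope-identity (det w₁ w) (det w w₂) (reciprocal (det w w₂)) (det w₁ w′) (det w′ w₂) (reciprocal (det w′ w₂))
          (res-injective {slopeℤ w} {slopeℤ w′} e) (reciprocal-spec (det w w₂) (W₂ w∈)) (reciprocal-spec (det w′ w₂) (W₂ w′∈)))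
        (- 1ℤ) (sign-change (det w₁ w₂) (det w w′) (det w₁ w * det w′ w₂ - det w₁ w′ * det w w₂) (det w′ w)
          (plücker (+ proj₁ w₁) (+ proj₂ w₁) (+ proj₁ w₂) (+ proj₂ w₂) (+ x) (+ y) (+ u) (+ v)) (antisym (+ x) (+ y) (+ u) (+ v))))
        where
        antisym : ∀ x y u v → u * y - v * x ≡ - (x * v - y * u)
        antisym = solve-∀
        sign-change : ∀ D a b c → b ≡ D * c → c ≡ - a → D * a ≡ - 1ℤ * b
        sign-change D a .(D * - a) .(- a) refl refl = eq D a
          where eq : ∀ D a → D * a ≡ - 1ℤ * (D * - a)
                eq = solve-∀

      S# : Unique S
      S# = AllPairsₚ.map⁺ (AllPairs-∈ W# distinct-slopes)

      -- Inverts `slope` on `S`; the default `w₁` is returned only outside `S`.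
      pick : ℕ → ℕ × ℕ
      pick s = by-cases (Any.any? (λ w → slope w ℕ.≟ s) W) (λ a → proj₁ (find a)) (λ _ → w₁)

      pick-spec : ∀ {s} → s ∈ S → pick s ∈ W × slope (pick s) ≡ s
      pick-spec {s} s∈ = go (Any.any? (λ w → slope w ℕ.≟ s) W)
        where
        go : (a? : Dec (Any (λ w → slope w ≡ s) W)) →
             by-cases a? (λ a → proj₁ (find a)) (λ _ → w₁) ∈ W × slope (by-cases a? (λ a → proj₁ (find a)) (λ _ → w₁)) ≡ s
        go (yes a) = proj₂ (find a)
        go (no ¬a) = let w , w∈ , s≡ = ∈ₚ.∈-map⁻ slope s∈ in contradiction (lose w∈ (sym s≡)) ¬a

      rescale : ℕ × ℕ → ℕ → ℕ
      rescale w t = res (reciprocal (det w w₂) * det w₁ w₂ * + t)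

      T : ℕ → List ℕ
      T s = map (rescale (pick s)) (D (pick s))

      T∋′ : ∀ {w y} → w ∈ W → y ∈ E → intercept (slope w) (key w₁ y , key w₂ y) ∈ map (rescale w) (D w)
      T∋′ {w@(x , z)} {y@(u , v)} w∈ y∈ = subst (_∈ map (rescale w) (D w)) (sym (res-cong {+ key w₁ y - + slope w * + key w₂ y} {reciprocal (det w w₂) * det w₁ w₂ * + key w y}
        (intercept-identity (dot w₁ y) (dot w₂ y) (dot w y) (+ key w₁ y) (+ key w₂ y) (+ slope w) (+ key w y)
          (det w₁ w) (det w w₂) (reciprocal (det w w₂)) (det w₁ w₂) (x≈res (dot w₁ y)) (x≈res (dot w₂ y)) (x≈res (slopeℤ w)) (reciprocal-spec (det w w₂) (W₂ w∈)) (x≈res (dot w y))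
          (expansion (+ proj₁ w₁) (+ proj₂ w₁) (+ proj₁ w₂) (+ proj₂ w₂) (+ x) (+ z) (+ u) (+ v)))))
        (∈ₚ.∈-map⁺ (rescale w) (D∋ y∈))

      T∋ : ∀ {e s} → e ∈ pts → s ∈ S → intercept s e ∈ T s
      T∋ {e} {s} e∈ s∈ =
        let y , y∈ , e≡ = ∈ₚ.∈-map⁻ (λ y → key w₁ y , key w₂ y) e∈
            w∈ , s≡ = pick-spec s∈
        in subst₂ (λ s′ e → intercept s′ e ∈ T s) s≡ (sym e≡) (T∋′ w∈ y∈)

      S<p : ∀ {s} → s ∈ S → s ℕ.< p
      S<p s∈ with ∈ₚ.∈-map⁻ slope s∈
      ... | w , _ , refl = res<p (slopeℤ w)

    grid-bound : 1 ℕ.≤ k → 1 ℕ.≤ d → k ℕ.≤ d → 2 ℕ.* d ℕ.≤ N → 120 ℕ.* (k ℕ.* d) ℕ.< p →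
      k ℕ.* (N ℕ.* N ℕ.* (N ℕ.* N)) ℕ.≤ 524288 ℕ.* (d ℕ.* d ℕ.* (d ℕ.* d) ℕ.* (d ℕ.* d ℕ.* (d ℕ.* d)))
    grid-bound 1≤k 1≤d k≤d 2d≤N 120kd<p = grid-arithmetic p k d N (length gp) 1≤k 1≤d k≤d 2d≤N 120kd<p
      (subst (λ n → n ℕ.* n ℕ.≤ d ℕ.* (length gp ℕ.+ n)) |pts|
        (goodPairs-many pts (D w₁) (D w₂) S T d pts# (D# w₂) S# D<p D<p S<p |D₁| |D₂| |T| pts⊆ T∋))
      λ h m a b c e f g → subst (ℕ._≤ 2 ℕ.* (m ℕ.* (2 ℕ.* (d ℕ.* (k ℕ.* d))))) |edges|
        (subst (λ j → length es ℕ.≤ 2 ℕ.* (m ℕ.* (2 ℕ.* (d ℕ.* (j ℕ.* d))))) |S|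
          (few-edges pts (D w₁) (D w₂) S T d pts# (D# w₂) S# D<p D<p S<p |D₁| |D₂| |T| pts⊆ T∋ h m
            (subst (λ j → 4 ℕ.* (j ℕ.* d) ℕ.≤ p) (sym |S|) a) b
            (subst (λ j → 2 ℕ.* (d ℕ.* (j ℕ.* d)) ℕ.* (h ℕ.+ (h ℕ.+ (h ℕ.+ 1))) ℕ.< h ℕ.* (h ℕ.* h)) (sym |S|) c) e f
            (subst (λ j → h ℕ.+ (h ℕ.+ (h ℕ.+ 1)) ℕ.+ (d ℕ.+ j) ℕ.< m) (sym |S|) g)))
      where
      |T| : ∀ {s} → s ∈ S → length (T s) ℕ.≤ d
      |T| {s} s∈ = ℕₚ.≤-trans (ℕₚ.≤-reflexive (Listₚ.length-map (rescale (pick s)) (D (pick s)))) (|D| (proj₁ (pick-spec s∈)))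
      |S| : length S ≡ k
      |S| = Listₚ.length-map slope W
      |pts| : length pts ≡ N
      |pts| = Listₚ.length-map (λ y → key w₁ y , key w₂ y) E
      gp = goodPairs pts (D w₁) (D w₂) S T d pts# (D# w₂) S# D<p D<p S<p |D₁| |D₂| |T| pts⊆ T∋
      es = edges pts (D w₁) (D w₂) S T d pts# (D# w₂) S# D<p D<p S<p |D₁| |D₂| |T| pts⊆ T∋
      |edges| : length es ≡ length gp ℕ.* (k ℕ.* k)
      |edges| = trans (length-cartesianProduct gp (cartesianProduct S S))
        (cong (length gp ℕ.*_) (trans (length-cartesianProduct S S) (cong₂ ℕ._*_ |S| |S|)))

-- Products in the Heisenberg group and values of the dot product.

count-sum : ∀ {A : Set} {P : A → Set} (P? : Decidable P) (f : A → ℕ) d → (∀ {x} → ¬ P x → d ℕ.≤ f x) → ∀ xs →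
            count (λ x → ¬? (P? x)) xs ℕ.* d ℕ.≤ sum (map f xs)
count-sum P? f d h [] = z≤n
count-sum P? f d h (x ∷ xs) with P? x
... | yes _  = ℕₚ.≤-trans (count-sum P? f d h xs) (ℕₚ.m≤n+m _ (f x))
... | no ¬px = ℕₚ.+-mono-≤ (h ¬px) (count-sum P? f d h xs)

module Products (p : ℕ) .{{_ : NonZero p}} (p-prime : Prime p) (E : List F2) (E# : Unique E) (E< : All (InField p) E) where
  open Modular p p-prime
  open Directions p p-prime

  bounded : ∀ {y} → y ∈ E → Bounded y
  bounded y∈ = All.lookup E< y∈

  values : F2 → List ℕ
  values x = deduplicate ℕ._≟_ (map (key x) E)

  values# : ∀ x → Unique (values x)
  values# x = deduplicate-! ℕ._≟_ (map (key x) E)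

  values∋ : ∀ {x y} → y ∈ E → key x y ∈ values x
  values∋ {x} y∈ = ∈ₚ.∈-deduplicate⁺ ℕ._≟_ (∈ₚ.∈-map⁺ (key x) y∈)

  values<p : ∀ {x t} → t ∈ values x → t ℕ.< p
  values<p {x} t∈ with ∈ₚ.∈-map⁻ (key x) (∈ₚ.∈-deduplicate⁻ ℕ._≟_ (map (key x) E) t∈)
  ... | y , _ , refl = res<p (dot x y)

  pinned : ℕ
  pinned = sum (map (λ x → length (values x)) E)

  dotF2≡key : ∀ x y → dotF2 p x y ≡ key x y
  dotF2≡key (a , b) (c , d) = cong res (trans (ℤₚ.pos-+ (a ℕ.* c) (b ℕ.* d)) (cong₂ _+_ (ℤₚ.pos-* a c) (ℤₚ.pos-* b d)))

  addF2-cancel : ∀ {x x′} y → Bounded x → Bounded x′ → addF2 p x y ≡ addF2 p x′ y → x ≡ x′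
  addF2-cancel {a , b} {a′ , b′} (c , d) (a< , b<) (a′< , b′<) e = cong₂ _,_ (cancel a a′ c a< a′< (cong proj₁ e)) (cancel b b′ d b< b′< (cong proj₂ e))
    where
    cancel : ∀ m n o → m ℕ.< p → n ℕ.< p → (m ℕ.+ o) ℕ.% p ≡ (n ℕ.+ o) ℕ.% p → m ≡ n
    cancel m n o m< n< e = ≈⇒≡ m< n< (lin₁ (res-injective {+ (m ℕ.+ o)} {+ (n ℕ.+ o)} e) 1ℤ
      (trans (eq (+ m) (+ n) (+ o)) (cong₂ (λ x y → 1ℤ * (x - y)) (sym (ℤₚ.pos-+ m o)) (sym (ℤₚ.pos-+ n o)))))
      where eq : ∀ m n o → m - n ≡ 1ℤ * ((m + o) - (n + o))
            eq = solve-∀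

  EE0-∈ : ∀ {x y} → x ∈ E → y ∈ E → (x , y , 0) ∈ EE0 p E
  EE0-∈ x∈ y∈ = ∈ₚ.∈-deduplicate⁺ _≟H_ (∈ₚ.∈-concatMap⁺ _ (lose x∈ (∈ₚ.∈-concatMap⁺ _ (lose y∈ (here refl)))))

  EE0EE0-∈ : ∀ {m m′} → m ∈ EE0 p E → m′ ∈ EE0 p E → mulH p m m′ ∈ EE0EE0 p E
  EE0EE0-∈ m∈ m′∈ = ∈ₚ.∈-deduplicate⁺ _≟H_ (∈ₚ.∈-concatMap⁺ _ (lose m∈ (∈ₚ.∈-concatMap⁺ _ (lose m′∈ (here refl)))))

  EE0-length : length (EE0 p E) ℕ.≤ length E ℕ.* length E
  EE0-length = ℕₚ.≤-trans (Listₚ.length-deduplicate _≟H_ (concatMap (λ x → concatMap (λ y → Data.List.[ (x , y , 0) ]) E) E)) (ℕₚ.≤-reflexive (outer E))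
    where
    inner : ∀ (x : F2) F → length (concatMap (λ y → Data.List.[ (x , y , 0) ]) F) ≡ length F
    inner x []      = refl
    inner x (_ ∷ F) = cong suc (inner x F)
    outer : ∀ F → length (concatMap (λ x → concatMap (λ y → Data.List.[ (x , y , 0) ]) E) F) ≡ length F ℕ.* length E
    outer []      = refl
    outer (x ∷ F) = trans (Listₚ.length-++ (concatMap (λ y → Data.List.[ (x , y , 0) ]) E)) (cong₂ ℕ._+_ (inner x E) (outer F))

  private
    -- Some point of `E` whose product with x is t; the default `x₀` occurs only if t is not such a
    -- value.
    representative : F2 → F2 → ℕ → F2
    representative x₀ x t = by-cases (Any.any? (λ y → key x y ℕ.≟ t) E) (λ a → proj₁ (find a)) (λ _ → x₀)

    representative-spec : ∀ x₀ x {t} → t ∈ values x → representative x₀ x t ∈ E × key x (representative x₀ x t) ≡ t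
    representative-spec x₀ x {t} t∈ = go (Any.any? (λ y → key x y ℕ.≟ t) E)
      where
      go : (a? : Dec (Any (λ y → key x y ≡ t) E)) →
           by-cases a? (λ a → proj₁ (find a)) (λ _ → x₀) ∈ E × key x (by-cases a? (λ a → proj₁ (find a)) (λ _ → x₀)) ≡ t
      go (yes a) = proj₂ (find a)
      go (no ¬a) = let y , y∈ , t≡ = ∈ₚ.∈-map⁻ (key x) (∈ₚ.∈-deduplicate⁻ ℕ._≟_ (map (key x) E) t∈) in contradiction (lose y∈ (sym t≡)) ¬a

  -- For fixed x₀ the elements [x, y, 0][x₀, y′, 0], with one y′ for each value of x · y′, are distinct.
  pinned-bound : ∀ {x₀} → x₀ ∈ E → length E ℕ.* pinned ℕ.≤ length (EE0EE0 p E)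
  pinned-bound {x₀} x₀∈ = ℕₚ.≤-trans (ℕₚ.≤-reflexive (sym size))
    (injective-length product (taggedPairs-unique fibre E E# (λ x → Uniqueₚ.cartesianProduct⁺ E# (values# x))) injective into)
    where
    fibre : F2 → List (F2 × ℕ)
    fibre x = cartesianProduct E (values x)
    rep = representative x₀
    product : F2 × (F2 × ℕ) → Heis
    product (x , (y , t)) = mulH p (x , y , 0) (x₀ , rep x t , 0)
    size : length (taggedPairs fibre E) ≡ length E ℕ.* pinned
    size = trans (taggedPairs-length fibre E) (go E)
      where
      go : ∀ F → sum (map (λ x → length (fibre x)) F) ≡ length E ℕ.* sum (map (λ x → length (values x)) F)
      go []      = sym (ℕₚ.*-zeroʳ (length E))
      go (x ∷ F) = trans (cong₂ ℕ._+_ (length-cartesianProduct E (values x)) (go F)) (sym (ℕₚ.*-distribˡ-+ (length E) (length (values x)) (sum (map (λ x → length (values x)) F))))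
    index⁻ : ∀ {x y t} → (x , (y , t)) ∈ taggedPairs fibre E → x ∈ E × y ∈ E × t ∈ values x
    index⁻ {x} i∈ = let x∈ , yt∈ = taggedPairs⁻ fibre E i∈ in x∈ , ∈ₚ.∈-cartesianProduct⁻ E (values x) yt∈
    into : ∀ {i} → i ∈ taggedPairs fibre E → product i ∈ EE0EE0 p E
    into {x , (y , t)} i∈ = let x∈ , y∈ , t∈ = index⁻ i∈ in EE0EE0-∈ (EE0-∈ x∈ y∈) (EE0-∈ x₀∈ (proj₁ (representative-spec x₀ x t∈)))
    third : ∀ x {t} → t ∈ values x → (0 ℕ.+ 0 ℕ.+ dotF2 p x (rep x t)) ℕ.% p ≡ t
    third x {t} t∈ = trans (ℕᵐ.m<n⇒m%n≡m (subst (ℕ._< p) (sym (dotF2≡key x (rep x t))) (res<p (dot x (rep x t)))))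
      (trans (dotF2≡key x (rep x t)) (proj₂ (representative-spec x₀ x t∈)))
    injective : ∀ {i j} → i ∈ taggedPairs fibre E → j ∈ taggedPairs fibre E → product i ≡ product j → i ≡ j
    injective {x , (y , t)} {x′ , (y′ , t′)} i∈ j∈ e = go (index⁻ i∈) (index⁻ j∈)
        (addF2-cancel x₀ (bounded (proj₁ (index⁻ i∈))) (bounded (proj₁ (index⁻ j∈))) (cong proj₁ e))
        (trans (sym (third x (proj₂ (proj₂ (index⁻ i∈))))) (trans (cong (λ z → proj₂ (proj₂ z)) e) (third x′ (proj₂ (proj₂ (index⁻ j∈))))))
        (cong (λ z → proj₁ (proj₂ z)) e)
      where
      go : x ∈ E × y ∈ E × t ∈ values x → x′ ∈ E × y′ ∈ E × t′ ∈ values x′ → x ≡ x′ → t ≡ t′ →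
           addF2 p y (rep x t) ≡ addF2 p y′ (rep x′ t′) → (x , (y , t)) ≡ (x′ , (y′ , t′))
      go (_ , y∈ , _) (_ , y′∈ , _) refl refl e = cong (λ y → x , (y , t)) (addF2-cancel (rep x t) (bounded y∈) (bounded y′∈) e)

-- Independent directions with few values.

module Rich (p : ℕ) .{{_ : NonZero p}} (p-prime : Prime p) (p≡3 : p ℕ.% 4 ≡ 3) (E : List F2) (E# : Unique E) (E< : All (InField p) E) where
  open Modular p p-prime
  open Directions p p-prime
  open Anisotropy p p-prime p≡3
  open Products p p-prime E E# E<

  private
    N = length E

    det? : ∀ x y → Dec (det x y ≈0)
    det? x y = det x y ≈0?

    nonzero? : Decidable (λ (x : F2) → (+ proj₁ x) ≉0 ⊎ (+ proj₂ x) ≉0)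
    nonzero? (a , b) = ¬? ((+ a) ≈0?) ⊎-dec ¬? ((+ b) ≈0?)

  Nonzero : F2 → Set
  Nonzero x = (+ proj₁ x) ≉0 ⊎ (+ proj₂ x) ≉0

  independent : List F2 → List F2
  independent []       = []
  independent (x ∷ xs) = x ∷ filter (λ y → ¬? (det? x y)) (independent xs)

  independent# : ∀ xs → AllPairs (λ w w′ → det w w′ ≉0) (independent xs)
  independent# []       = []
  independent# (x ∷ xs) = Allₚ.all-filter (λ y → ¬? (det? x y)) (independent xs) ∷ AllPairsₚ.filter⁺ (λ y → ¬? (det? x y)) (independent# xs)

  independent⊆ : ∀ xs {w} → w ∈ independent xs → w ∈ xs
  independent⊆ (x ∷ xs) (here refl) = here refl
  independent⊆ (x ∷ xs) (there w∈)  = there (independent⊆ xs (proj₁ (∈ₚ.∈-filter⁻ (λ y → ¬? (det? x y)) {xs = independent xs} w∈)))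

  private
    parallel-trans : ∀ a b c d x y → (c ≉0 ⊎ d ≉0) → (a * d - b * c) ≈0 → (c * y - d * x) ≈0 → (a * y - b * x) ≈0
    parallel-trans a b c d x y (inj₁ c≉0) u v = cancelˡ c c≉0 (lin₂ u v x a (eq a b c d x y))
      where eq : ∀ a b c d x y → c * (a * y - b * x) ≡ x * (a * d - b * c) + a * (c * y - d * x)
            eq = solve-∀
    parallel-trans a b c d x y (inj₂ d≉0) u v = cancelˡ d d≉0 (lin₂ u v y b (eq a b c d x y))
      where eq : ∀ a b c d x y → d * (a * y - b * x) ≡ y * (a * d - b * c) + b * (c * y - d * x)
            eq = solve-∀

    det-self : ∀ a b → a * b - b * a ≡ 0ℤ
    det-self = solve-∀

  -- If the vector representing y is discarded in favour of a new head, it is parallel to that head;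
  -- parallelism passes on to y because the discarded vector is nonzero.
  independent-covers : ∀ xs → (∀ {x} → x ∈ xs → Nonzero x) → ∀ {y} → y ∈ xs → Any (λ w → det w y ≈0) (independent xs)
  independent-covers (x ∷ xs) nz {y} (here refl) = here (≡0⇒≈0 (det-self (+ proj₁ x) (+ proj₂ x)))
  independent-covers (x ∷ xs) nz {y} (there y∈) with find (independent-covers xs (λ x∈ → nz (there x∈)) y∈)
  ... | w , w∈ , wy with det? x w
  ...   | yes xw = here (parallel-trans (+ proj₁ x) (+ proj₂ x) (+ proj₁ w) (+ proj₂ w) (+ proj₁ y) (+ proj₂ y) (nz (there (independent⊆ xs w∈))) xw wy)
  ...   | no ¬xw = there (lose (∈ₚ.∈-filter⁺ (λ y → ¬? (det? x y)) w∈ ¬xw) wy)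

  private
    -- A point on the line spanned by w is determined by its product with w, since w · w ≠ 0.
    on-line₁ : ∀ a b x y x′ y′ → ((a * x + b * y) - (a * x′ + b * y′)) ≈0 → (a * y - b * x) ≈0 → (a * y′ - b * x′) ≈0 → (a * a + b * b) ≉0 → (x - x′) ≈0
    on-line₁ a b x y x′ y′ u v w nz = cancelˡ (a * a + b * b) nz (lin₃ u v w a (- b) b (eq a b x y x′ y′))
      where eq : ∀ a b x y x′ y′ → (a * a + b * b) * (x - x′) ≡ a * ((a * x + b * y) - (a * x′ + b * y′)) + - b * (a * y - b * x) + b * (a * y′ - b * x′)
            eq = solve-∀

    on-line₂ : ∀ a b x y x′ y′ → ((a * x + b * y) - (a * x′ + b * y′)) ≈0 → (a * y - b * x) ≈0 → (a * y′ - b * x′) ≈0 → (a * a + b * b) ≉0 → (y - y′) ≈0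
    on-line₂ a b x y x′ y′ u v w nz = cancelˡ (a * a + b * b) nz (lin₃ u v w b a (- a) (eq a b x y x′ y′))
      where eq : ∀ a b x y x′ y′ → (a * a + b * b) * (y - y′) ≡ b * ((a * x + b * y) - (a * x′ + b * y′)) + a * (a * y - b * x) + - a * (a * y′ - b * x′)
            eq = solve-∀

  few-on-line : ∀ {w F} → Nonzero w → Unique F → (∀ {y} → y ∈ F → y ∈ E) → count (λ y → det? w y) F ℕ.≤ length (values w)
  few-on-line {w@(a , b)} {F} nz F# F⊆ = injective-length (key w) (Uniqueₚ.filter⁺ (det? w) F#)
    (λ {y} {y′} y∈ y′∈ e →
      let i  , u = ∈ₚ.∈-filter⁻ (det? w) {xs = F} y∈
          i′ , v = ∈ₚ.∈-filter⁻ (det? w) {xs = F} y′∈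
          y₁ , y₂ = bounded (F⊆ i)
          y₁′ , y₂′ = bounded (F⊆ i′)
      in cong₂ _,_ (≈⇒≡ y₁ y₁′ (on-line₁ (+ a) (+ b) (+ proj₁ y) (+ proj₂ y) (+ proj₁ y′) (+ proj₂ y′) (res-injective {dot w y} {dot w y′} e) u v (anisotropic (+ a) (+ b) nz)))
                   (≈⇒≡ y₂ y₂′ (on-line₂ (+ a) (+ b) (+ proj₁ y) (+ proj₂ y) (+ proj₁ y′) (+ proj₂ y′) (res-injective {dot w y} {dot w y′} e) u v (anisotropic (+ a) (+ b) nz))))
    (λ y∈ → values∋ {w} (F⊆ (proj₁ (∈ₚ.∈-filter⁻ (det? w) {xs = F} y∈))))

  module Poor (d : ℕ) where

    poor? : Decidable (λ x → length (values x) ℕ.≤ d)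
    poor? x = length (values x) ℕ.≤? d

    poor : List F2
    poor = filter nonzero? (filter poor? E)

    directions : List F2
    directions = independent poor

    poor⁻ : ∀ {x} → x ∈ poor → x ∈ E × length (values x) ℕ.≤ d × Nonzero x
    poor⁻ x∈ = let i , nz = ∈ₚ.∈-filter⁻ nonzero? {xs = filter poor? E} x∈
                   j , le = ∈ₚ.∈-filter⁻ poor? {xs = E} i
               in j , le , nz

    directions⁻ : ∀ {w} → w ∈ directions → length (values w) ℕ.≤ d × Nonzero w
    directions⁻ w∈ = proj₂ (poor⁻ (independent⊆ poor w∈))

    -- A line through the origin spanned by a chosen w carries at most d points of `E`, as w · w ≠ 0
    -- lets the product with w separate them, and these lines cover the poor points.
    few-poor : length poor ℕ.≤ length directions ℕ.* d
    few-poor = ℕₚ.≤-trans (ℕₚ.≤-reflexive (cong length (sym (Listₚ.filter-all (λ y → Any.any? (λ w → det? w y) directions)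
        (All.tabulate (independent-covers poor (λ x∈ → proj₂ (proj₂ (poor⁻ x∈)))))))))
      (count-Any (λ y w → det? w y) directions poor d λ w∈ →
        ℕₚ.≤-trans (few-on-line (proj₂ (directions⁻ w∈)) (Uniqueₚ.filter⁺ nonzero? (Uniqueₚ.filter⁺ poor? E#)) (λ y∈ → proj₁ (poor⁻ y∈)))
          (proj₁ (directions⁻ w∈)))

    few-zero : length (filter poor? E) ℕ.≤ length poor ℕ.+ 1
    few-zero = ℕₚ.≤-trans (ℕₚ.≤-reflexive (count-split nonzero? (filter poor? E))) (ℕₚ.+-monoʳ-≤ (length poor)
      (at-most-one (Uniqueₚ.filter⁺ (λ x → ¬? (nonzero? x)) (Uniqueₚ.filter⁺ poor? E#)) λ {x} {y} x∈ y∈ →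
        let i , zx = ∈ₚ.∈-filter⁻ (λ x → ¬? (nonzero? x)) {xs = filter poor? E} x∈
            j , zy = ∈ₚ.∈-filter⁻ (λ x → ¬? (nonzero? x)) {xs = filter poor? E} y∈
        in trans (zero-point x (bounded (proj₁ (∈ₚ.∈-filter⁻ poor? {xs = E} i))) zx) (sym (zero-point y (bounded (proj₁ (∈ₚ.∈-filter⁻ poor? {xs = E} j))) zy))))
      where
      zero-coordinate : ∀ a → a ℕ.< p → ¬ ((+ a) ≉0) → a ≡ 0
      zero-coordinate zero    _   _ = refl
      zero-coordinate (suc a) a<p h = contradiction (small≉0 (s≤s z≤n) a<p) h
      zero-point : ∀ x → Bounded x → ¬ Nonzero x → x ≡ (0 , 0)
      zero-point (a , b) (a< , b<) h = cong₂ _,_ (zero-coordinate a a< (λ n → h (inj₁ n))) (zero-coordinate b b< (λ n → h (inj₂ n)))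

    -- Markov's inequality leaves fewer than half of `E` with more than d values; the summand 1
    -- accounts for the origin, which spans no direction.
    many-poor : 2 ℕ.* pinned ℕ.< N ℕ.* suc d → N ℕ.≤ 2 ℕ.* (length directions ℕ.* d ℕ.+ 1)
    many-poor lt = ℕₚ.≤-trans (halve (length (filter poor? E)) rest (count-split poor? E) (ℕₚ.*-cancelʳ-< (suc d) (2 ℕ.* rest) N
        (ℕₚ.≤-<-trans (ℕₚ.≤-trans (ℕₚ.≤-reflexive (ℕₚ.*-assoc 2 rest (suc d))) (ℕₚ.*-monoʳ-≤ 2 (count-sum poor? (λ x → length (values x)) (suc d) ℕₚ.≰⇒> E))) lt)))
      (ℕₚ.*-monoʳ-≤ 2 (ℕₚ.≤-trans few-zero (ℕₚ.+-monoˡ-≤ 1 few-poor)))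
      where
      rest = count (λ x → ¬? (poor? x)) E
      halve : ∀ e c {n} → n ≡ e ℕ.+ c → 2 ℕ.* c ℕ.< n → n ℕ.≤ 2 ℕ.* e
      halve e c refl lt = ℕₚ.≤-trans (ℕₚ.+-monoʳ-≤ e (ℕₚ.<⇒≤ (ℕₚ.+-cancelʳ-< c c e (subst (ℕ._< e ℕ.+ c) (cong (c ℕ.+_) (ℕₚ.+-identityʳ c)) lt))))
        (ℕₚ.≤-reflexive (cong (e ℕ.+_) (sym (ℕₚ.+-identityʳ e))))

    collisions-bound : 0 ℕ.< N → length directions ℕ.≤ p → 2 ℕ.* d ℕ.≤ p → length directions ℕ.* N ℕ.≤ 2 ℕ.* (d ℕ.* p)
    collisions-bound 0<N |Φ|≤p 2d≤p = few-poor-directions E E# bounded directions (independent# poor) (λ w∈ → proj₂ (directions⁻ w∈)) |Φ|≤p d 2d≤p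
      values (λ w∈ → proj₁ (directions⁻ w∈)) (λ {w} _ y∈ → values∋ {w} y∈) 0<N

    -- There may be p + 1 independent directions, too many for the count. Any p of them already
    -- force N ≤ 2d, which the final case distinction excludes.
    collisions-bound′ : 0 ℕ.< N → p ℕ.≤ length directions → 2 ℕ.* d ℕ.≤ p → p ℕ.* N ℕ.≤ 2 ℕ.* (d ℕ.* p)
    collisions-bound′ 0<N p≤|Φ| 2d≤p = subst (λ n → n ℕ.* N ℕ.≤ 2 ℕ.* (d ℕ.* p)) |Φ|
      (few-poor-directions E E# bounded (take p directions) (AllPairsₚ.take⁺ p (independent# poor)) (λ w∈ → proj₂ (directions⁻ (take⊆ w∈))) (ℕₚ.≤-reflexive |Φ|) d 2d≤p
        values (λ w∈ → proj₁ (directions⁻ (take⊆ w∈))) (λ {w} _ y∈ → values∋ {w} y∈) 0<N)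
      where
      |Φ| : length (take p directions) ≡ p
      |Φ| = trans (Listₚ.length-take p directions) (ℕₚ.m≤n⇒m⊓n≡m p≤|Φ|)
      take⊆ : ∀ {w} → w ∈ take p directions → w ∈ directions
      take⊆ w∈ = All.lookup (Allₚ.take⁺ p (All.tabulate {xs = directions} id)) w∈

    two-directions : ∀ {w₁ w₂ W} → directions ≡ w₁ ∷ w₂ ∷ W → N ℕ.≤ d ℕ.* d
    two-directions {w₁} {w₂} {W} Φ≡ = ℕₚ.≤-trans (injective-length (λ y → key w₁ y , key w₂ y) E#
        (λ y∈ y′∈ e → coordinates-injective w₁ w₂ w₁₂ (bounded y∈) (bounded y′∈) (cong proj₁ e) (cong proj₂ e))
        (λ y∈ → ∈ₚ.∈-cartesianProduct⁺ (values∋ {w₁} y∈) (values∋ {w₂} y∈)))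
      (ℕₚ.≤-trans (ℕₚ.≤-reflexive (length-cartesianProduct (values w₁) (values w₂)))
        (ℕₚ.*-mono-≤ (proj₁ (directions⁻ (subst (w₁ ∈_) (sym Φ≡) (here refl)))) (proj₁ (directions⁻ (subst (w₂ ∈_) (sym Φ≡) (there (here refl)))))))
      where
      w₁₂ : det w₁ w₂ ≉0
      w₁₂ = All.head (AllPairs.head (subst (AllPairs (λ w w′ → det w w′ ≉0)) Φ≡ (independent# poor)))

    directions-bound : ∀ {w₁ w₂ W} → directions ≡ w₁ ∷ w₂ ∷ W → ∀ k → k ℕ.≤ length W → 1 ℕ.≤ k → 1 ℕ.≤ d → k ℕ.≤ d → 2 ℕ.* d ℕ.≤ N → 120 ℕ.* (k ℕ.* d) ℕ.< p →
      k ℕ.* (N ℕ.* N ℕ.* (N ℕ.* N)) ℕ.≤ 524288 ℕ.* (d ℕ.* d ℕ.* (d ℕ.* d) ℕ.* (d ℕ.* d ℕ.* (d ℕ.* d)))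
    directions-bound {w₁} {w₂} {W} Φ≡ k k≤W = subst (λ j → 1 ℕ.≤ j → 1 ℕ.≤ d → j ℕ.≤ d → 2 ℕ.* d ℕ.≤ N → 120 ℕ.* (j ℕ.* d) ℕ.< p →
        j ℕ.* (N ℕ.* N ℕ.* (N ℕ.* N)) ℕ.≤ 524288 ℕ.* (d ℕ.* d ℕ.* (d ℕ.* d) ℕ.* (d ℕ.* d ℕ.* (d ℕ.* d)))) |W′|
      (Slopes.grid-bound p p-prime E E# bounded w₁ w₂ W′ (All.head (AllPairs.head Φ#))
        (λ {w} w∈ z → All.lookup (AllPairs.head (AllPairs.tail Φ#)) (W′⊆ w∈) (lin₁ z (- 1ℤ) (antisym (+ proj₁ w) (+ proj₂ w) (+ proj₁ w₂) (+ proj₂ w₂))))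
        (AllPairsₚ.take⁺ k (AllPairs.tail (AllPairs.tail Φ#))) d values values# (λ {w} → values<p {w}) (λ {w} → values∋ {w})
        (small {w₁} (here refl)) (small {w₂} (there (here refl))) (λ {w} w∈ → small {w} (there (there (W′⊆ w∈)))))
      where
      Φ# : AllPairs (λ w w′ → det w w′ ≉0) (w₁ ∷ w₂ ∷ W)
      Φ# = subst (AllPairs (λ w w′ → det w w′ ≉0)) Φ≡ (independent# poor)
      W′ : List F2
      W′ = take k W
      |W′| : length W′ ≡ k
      |W′| = trans (Listₚ.length-take k W) (ℕₚ.m≤n⇒m⊓n≡m k≤W)
      W′⊆ : ∀ {w} → w ∈ W′ → w ∈ W
      W′⊆ w∈ = All.lookup (Allₚ.take⁺ k (All.tabulate {xs = W} id)) w∈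
      small : ∀ {w} → w ∈ w₁ ∷ w₂ ∷ W → length (values w) ℕ.≤ d
      small {w} w∈ = proj₁ (directions⁻ (subst (w ∈_) (sym Φ≡) w∈))
      antisym : ∀ a b c d → c * b - d * a ≡ - 1ℤ * (a * d - b * c)
      antisym = solve-∀

-- Exponents and the case distinction.

private
  ^-distribʳ-* : ∀ a b n → (a ℕ.* b) ℕ.^ n ≡ a ℕ.^ n ℕ.* b ℕ.^ n
  ^-distribʳ-* a b zero    = refl
  ^-distribʳ-* a b (suc n) = trans (cong (a ℕ.* b ℕ.*_) (^-distribʳ-* a b n)) (eq a b (a ℕ.^ n) (b ℕ.^ n))
    where eq : ∀ a b c d → a ℕ.* b ℕ.* (c ℕ.* d) ≡ a ℕ.* c ℕ.* (b ℕ.* d)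
          eq = NatSolver.solve-∀

  ^-cancelˡ-≤ : ∀ n .{{_ : NonZero n}} {a b} → a ℕ.^ n ℕ.≤ b ℕ.^ n → a ℕ.≤ b
  ^-cancelˡ-≤ n le = ℕₚ.≮⇒≥ λ b<a → ℕₚ.<⇒≱ (ℕₚ.^-monoˡ-< n b<a) le

  1≤^ : ∀ {a} n → 1 ℕ.≤ a → 1 ℕ.≤ a ℕ.^ n
  1≤^ {a} n 1≤a = ℕₚ.≤-trans (ℕₚ.≤-reflexive (sym (ℕₚ.^-zeroˡ n))) (ℕₚ.^-monoˡ-≤ n 1≤a)

  ^-mono : ∀ {a i j} → 1 ℕ.≤ a → i ℕ.≤ j → a ℕ.^ i ℕ.≤ a ℕ.^ j
  ^-mono {a} 1≤a = ℕₚ.^-monoʳ-≤ a ⦃ ℕ.>-nonZero 1≤a ⦄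

  -- The hypothesis is raised to the power 8 and an i-th root is taken: 8j/i is at most 15, and 8 ≤
  -- 2i controls the power of C. It is applied with (i, j) equal to (5, 8) and (6, 11), whose ratios
  -- 8/5 and 11/6 lie below 15/8.
  rescale-exponents : ∀ N d C i j → 1 ℕ.≤ N → 1 ℕ.≤ d → 4 ℕ.≤ i → j ℕ.* 8 ℕ.≤ 15 ℕ.* i →
    N ℕ.^ i ℕ.≤ C ℕ.* d ℕ.^ j → N ℕ.^ 8 ℕ.≤ C ℕ.^ 2 ℕ.* d ℕ.^ 15
  rescale-exponents N d zero i j 1≤N _ _ _ le = contradiction (ℕₚ.≤-trans (1≤^ i 1≤N) le) λ ()
  rescale-exponents N d C@(suc _) i j 1≤N 1≤d 4≤i 8j≤15i le = ^-cancelˡ-≤ i ⦃ ℕ.>-nonZero (ℕₚ.≤-trans (s≤s z≤n) 4≤i) ⦄ (begin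
    (N ℕ.^ 8) ℕ.^ i                          ≡⟨ ℕₚ.^-*-assoc N 8 i ⟩
    N ℕ.^ (8 ℕ.* i)                          ≡⟨ cong (N ℕ.^_) (ℕₚ.*-comm 8 i) ⟩
    N ℕ.^ (i ℕ.* 8)                          ≡⟨ sym (ℕₚ.^-*-assoc N i 8) ⟩
    (N ℕ.^ i) ℕ.^ 8                          ≤⟨ ℕₚ.^-monoˡ-≤ 8 le ⟩
    (C ℕ.* d ℕ.^ j) ℕ.^ 8                    ≡⟨ ^-distribʳ-* C (d ℕ.^ j) 8 ⟩
    C ℕ.^ 8 ℕ.* (d ℕ.^ j) ℕ.^ 8              ≡⟨ cong (C ℕ.^ 8 ℕ.*_) (ℕₚ.^-*-assoc d j 8) ⟩
    C ℕ.^ 8 ℕ.* d ℕ.^ (j ℕ.* 8)              ≤⟨ ℕₚ.*-mono-≤ (^-mono {C} (s≤s z≤n) (ℕₚ.*-monoʳ-≤ 2 4≤i)) (^-mono 1≤d 8j≤15i) ⟩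
    C ℕ.^ (2 ℕ.* i) ℕ.* d ℕ.^ (15 ℕ.* i)     ≡⟨ cong₂ ℕ._*_ (sym (ℕₚ.^-*-assoc C 2 i)) (sym (ℕₚ.^-*-assoc d 15 i)) ⟩
    (C ℕ.^ 2) ℕ.^ i ℕ.* (d ℕ.^ 15) ℕ.^ i     ≡⟨ sym (^-distribʳ-* (C ℕ.^ 2) (d ℕ.^ 15) i) ⟩
    (C ℕ.^ 2 ℕ.* d ℕ.^ 15) ℕ.^ i             ∎)
    where open ℕₚ.≤-Reasoning

  fourth : ∀ x → x ℕ.* x ℕ.* (x ℕ.* x) ≡ x ℕ.^ 4
  fourth x = eq x
    where eq : ∀ x → x ℕ.* x ℕ.* (x ℕ.* x) ≡ x ℕ.* (x ℕ.* (x ℕ.* (x ℕ.* 1)))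
          eq = NatSolver.solve-∀

  eighth : ∀ x → x ℕ.* x ℕ.* (x ℕ.* x) ℕ.* (x ℕ.* x ℕ.* (x ℕ.* x)) ≡ x ℕ.^ 8
  eighth x = trans (cong₂ ℕ._*_ (fourth x) (fourth x)) (sym (ℕₚ.^-distribˡ-+-* x 4 4))

  -- c = 968 makes 120kd < p for k = ⌊N²/(cd³)⌋; the four summands of the constant correspond to
  -- N ≤ 8d, N² < cd³, the incidence bound, and 2d > p.
  abstract
    small-constant medium-constant incidence-constant : ℕ
    small-constant     = 8 ℕ.^ 8
    medium-constant    = 968 ℕ.^ 4
    incidence-constant = 524288

    small-constant≡ : 8 ℕ.^ 8 ≡ small-constant
    small-constant≡ = refl

    medium-constant≡ : 968 ℕ.^ 4 ≡ medium-constant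
    medium-constant≡ = refl

    incidence-constant≡ : 524288 ≡ incidence-constant
    incidence-constant≡ = refl

  core-constant : ℕ
  core-constant = 2 ℕ.* 968 ℕ.* incidence-constant

  constant : ℕ → ℕ
  constant C₁ = small-constant ℕ.+ (medium-constant ℕ.+ (core-constant ℕ.^ 2 ℕ.+ (C₁ ℕ.* 2 ℕ.^ 8) ℕ.^ 2))

  arith1 : ∀ φ d → 2 ℕ.* (φ ℕ.* d ℕ.+ 1) ℕ.+ 2 ℕ.* (φ ℕ.* d ℕ.+ 1) ≡ 4 ℕ.* φ ℕ.* d ℕ.+ 4
  arith1 = NatSolver.solve-∀

  arith2 : ∀ d p → 2 ℕ.* (d ℕ.* p) ≡ p ℕ.* (2 ℕ.* d)
  arith2 = NatSolver.solve-∀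

  arith3 : ∀ φ d N → 4 ℕ.* φ ℕ.* d ℕ.* N ≡ 4 ℕ.* d ℕ.* (φ ℕ.* N)
  arith3 = NatSolver.solve-∀

  arith4 : ∀ d p → 4 ℕ.* d ℕ.* (2 ℕ.* (d ℕ.* p)) ≡ 8 ℕ.* (d ℕ.* d) ℕ.* p
  arith4 = NatSolver.solve-∀

  arith5 : ∀ k d a b → a ℕ.* (d ℕ.* d) ℕ.* (b ℕ.* (k ℕ.* d)) ≡ k ℕ.* (a ℕ.* b ℕ.* (d ℕ.* (d ℕ.* d)))
  arith5 = NatSolver.solve-∀

  arith6 : ∀ k d x a c → a ℕ.* (k ℕ.* (c ℕ.* (d ℕ.* (d ℕ.* d)))) ℕ.* x ≡ a ℕ.* c ℕ.* (d ℕ.* (d ℕ.* d)) ℕ.* (k ℕ.* x)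
  arith6 = NatSolver.solve-∀

  arith7 : ∀ d x a c → a ℕ.* (d ℕ.* (d ℕ.* d)) ℕ.* (c ℕ.* x) ≡ a ℕ.* c ℕ.* (d ℕ.* (d ℕ.* (d ℕ.* 1)) ℕ.* x)
  arith7 = NatSolver.solve-∀

  module FinalArithmetic (C₁ p N d φ : ℕ) (1≤N : 1 ℕ.≤ N) (1≤d : 1 ℕ.≤ d) (1≤p : 1 ℕ.≤ p)
    (many-poor : N ℕ.≤ 2 ℕ.* (φ ℕ.* d ℕ.+ 1))
    (N⁵≤ : N ℕ.^ 5 ℕ.≤ C₁ ℕ.* p ℕ.^ 8)
    (collisions : φ ℕ.≤ p → 2 ℕ.* d ℕ.≤ p → φ ℕ.* N ℕ.≤ 2 ℕ.* (d ℕ.* p))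
    (collisions′ : p ℕ.≤ φ → 2 ℕ.* d ℕ.≤ p → p ℕ.* N ℕ.≤ 2 ℕ.* (d ℕ.* p))
    (N≤d² : 2 ℕ.< φ → N ℕ.≤ d ℕ.* d)
    (incidences : 2 ℕ.< φ → ∀ k → k ℕ.+ 2 ℕ.≤ φ → 1 ℕ.≤ k → 1 ℕ.≤ d → k ℕ.≤ d → 2 ℕ.* d ℕ.≤ N → 120 ℕ.* (k ℕ.* d) ℕ.< p →
      k ℕ.* (N ℕ.* N ℕ.* (N ℕ.* N)) ℕ.≤ incidence-constant ℕ.* (d ℕ.* d ℕ.* (d ℕ.* d) ℕ.* (d ℕ.* d ℕ.* (d ℕ.* d))))
    where
    open ℕₚ.≤-Reasoning

    private
      B₁ B₂ B₃ B₄ D : ℕ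
      B₁ = small-constant
      B₂ = medium-constant
      B₃ = core-constant ℕ.^ 2
      B₄ = (C₁ ℕ.* 2 ℕ.^ 8) ℕ.^ 2
      D  = d ℕ.^ 15

      instance
        d-nonZero : NonZero d
        d-nonZero = ℕ.>-nonZero 1≤d

      small-N : N ℕ.≤ 8 ℕ.* d → N ℕ.^ 8 ℕ.≤ B₁ ℕ.* D
      small-N le = begin
        N ℕ.^ 8              ≤⟨ ℕₚ.^-monoˡ-≤ 8 le ⟩
        (8 ℕ.* d) ℕ.^ 8      ≡⟨ trans (^-distribʳ-* 8 d 8) (cong (ℕ._* d ℕ.^ 8) small-constant≡) ⟩
        B₁ ℕ.* d ℕ.^ 8       ≤⟨ ℕₚ.*-monoʳ-≤ B₁ (^-mono {d} {8} {15} 1≤d (ℕₚ.m≤m+n 8 7)) ⟩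
        B₁ ℕ.* D             ∎

      small-N² : N ℕ.* N ℕ.≤ 968 ℕ.* (d ℕ.* (d ℕ.* d)) → N ℕ.^ 8 ℕ.≤ B₂ ℕ.* D
      small-N² le = begin
        N ℕ.^ 8                        ≡⟨ sym (ℕₚ.^-*-assoc N 2 4) ⟩
        (N ℕ.^ 2) ℕ.^ 4                ≤⟨ ℕₚ.^-monoˡ-≤ 4 (ℕₚ.≤-trans (ℕₚ.≤-reflexive (cong (N ℕ.*_) (ℕₚ.*-identityʳ N))) (ℕₚ.≤-trans le (ℕₚ.≤-reflexive (cong (968 ℕ.*_) (cube d))))) ⟩
        (968 ℕ.* d ℕ.^ 3) ℕ.^ 4        ≡⟨ trans (^-distribʳ-* 968 (d ℕ.^ 3) 4) (cong (ℕ._* (d ℕ.^ 3) ℕ.^ 4) medium-constant≡) ⟩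
        B₂ ℕ.* (d ℕ.^ 3) ℕ.^ 4         ≡⟨ cong (B₂ ℕ.*_) (ℕₚ.^-*-assoc d 3 4) ⟩
        B₂ ℕ.* d ℕ.^ 12                ≤⟨ ℕₚ.*-monoʳ-≤ B₂ (^-mono {d} {12} {15} 1≤d (ℕₚ.m≤m+n 12 3)) ⟩
        B₂ ℕ.* D                       ∎
        where
        cube : ∀ d → d ℕ.* (d ℕ.* d) ≡ d ℕ.^ 3
        cube d = cong (λ x → d ℕ.* (d ℕ.* x)) (sym (ℕₚ.*-identityʳ d))

      small-p : p ℕ.≤ 2 ℕ.* d → N ℕ.^ 8 ℕ.≤ B₄ ℕ.* D
      small-p p≤2d = rescale-exponents N d (C₁ ℕ.* 2 ℕ.^ 8) 5 8 1≤N 1≤d (ℕₚ.m≤m+n 4 1) (ℕₚ.m≤m+n 64 11) (begin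
        N ℕ.^ 5                            ≤⟨ N⁵≤ ⟩
        C₁ ℕ.* p ℕ.^ 8                     ≤⟨ ℕₚ.*-monoʳ-≤ C₁ (ℕₚ.^-monoˡ-≤ 8 p≤2d) ⟩
        C₁ ℕ.* (2 ℕ.* d) ℕ.^ 8             ≡⟨ cong (C₁ ℕ.*_) (^-distribʳ-* 2 d 8) ⟩
        C₁ ℕ.* (2 ℕ.^ 8 ℕ.* d ℕ.^ 8)       ≡⟨ sym (ℕₚ.*-assoc C₁ (2 ℕ.^ 8) (d ℕ.^ 8)) ⟩
        C₁ ℕ.* 2 ℕ.^ 8 ℕ.* d ℕ.^ 8         ∎)

      module Main (8d<N : 8 ℕ.* d ℕ.< N) (2d≤p : 2 ℕ.* d ℕ.≤ p) where

        N≤4φd : N ℕ.≤ 4 ℕ.* φ ℕ.* d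
        N≤4φd = ℕₚ.+-cancelʳ-≤ N N (4 ℕ.* φ ℕ.* d) (begin
          N ℕ.+ N                          ≤⟨ ℕₚ.+-mono-≤ many-poor many-poor ⟩
          2 ℕ.* (φ ℕ.* d ℕ.+ 1) ℕ.+ 2 ℕ.* (φ ℕ.* d ℕ.+ 1) ≡⟨ arith1 φ d ⟩
          4 ℕ.* φ ℕ.* d ℕ.+ 4              ≤⟨ ℕₚ.+-monoʳ-≤ (4 ℕ.* φ ℕ.* d) (ℕₚ.≤-trans (ℕₚ.≤-trans (ℕₚ.m≤m+n 4 4) (ℕₚ.*-monoʳ-≤ 8 1≤d)) (ℕₚ.<⇒≤ 8d<N)) ⟩
          4 ℕ.* φ ℕ.* d ℕ.+ N              ∎)

        2<φ : 2 ℕ.< φ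
        2<φ = ℕₚ.*-cancelˡ-< 4 2 φ (ℕₚ.*-cancelʳ-< d 8 (4 ℕ.* φ) (ℕₚ.<-≤-trans 8d<N N≤4φd))

        φN≤2dp : φ ℕ.* N ℕ.≤ 2 ℕ.* (d ℕ.* p)
        φN≤2dp = [ (λ φ≤p → collisions φ≤p 2d≤p) , (λ p≤φ → contradiction (ℕₚ.*-cancelˡ-≤ p ⦃ ℕ.>-nonZero 1≤p ⦄ (ℕₚ.≤-trans (collisions′ p≤φ 2d≤p) (ℕₚ.≤-reflexive (arith2 d p))))
                           (ℕₚ.<⇒≱ (ℕₚ.≤-<-trans (ℕₚ.*-monoˡ-≤ d {2} {8} (ℕₚ.m≤m+n 2 6)) 8d<N))) ]′ (ℕₚ.≤-total φ p)

        N²≤8d²p : N ℕ.* N ℕ.≤ 8 ℕ.* (d ℕ.* d) ℕ.* p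
        N²≤8d²p = begin
          N ℕ.* N                        ≤⟨ ℕₚ.*-monoˡ-≤ N N≤4φd ⟩
          4 ℕ.* φ ℕ.* d ℕ.* N            ≡⟨ arith3 φ d N ⟩
          4 ℕ.* d ℕ.* (φ ℕ.* N)          ≤⟨ ℕₚ.*-monoʳ-≤ (4 ℕ.* d) φN≤2dp ⟩
          4 ℕ.* d ℕ.* (2 ℕ.* (d ℕ.* p))  ≡⟨ arith4 d p ⟩
          8 ℕ.* (d ℕ.* d) ℕ.* p          ∎

        module WithSlopes (k : ℕ) (1≤k : 1 ℕ.≤ k) (lower : k ℕ.* (968 ℕ.* (d ℕ.* (d ℕ.* d))) ℕ.≤ N ℕ.* N)
          (upper : N ℕ.* N ℕ.≤ 2 ℕ.* (k ℕ.* (968 ℕ.* (d ℕ.* (d ℕ.* d))))) where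

          assoc : ∀ k c d → k ℕ.* (c ℕ.* (d ℕ.* (d ℕ.* d))) ≡ c ℕ.* k ℕ.* (d ℕ.* (d ℕ.* d))
          assoc = NatSolver.solve-∀

          ck≤d : 968 ℕ.* k ℕ.≤ d
          ck≤d = ℕₚ.*-cancelʳ-≤ (968 ℕ.* k) d (d ℕ.* (d ℕ.* d)) ⦃ ℕₚ.m*n≢0 d (d ℕ.* d) ⦃ d-nonZero ⦄ ⦃ ℕₚ.m*n≢0 d d ⦄ ⦄ (begin
            968 ℕ.* k ℕ.* (d ℕ.* (d ℕ.* d))    ≡⟨ sym (assoc k 968 d) ⟩
            k ℕ.* (968 ℕ.* (d ℕ.* (d ℕ.* d)))  ≤⟨ lower ⟩
            N ℕ.* N                            ≤⟨ ℕₚ.*-mono-≤ (N≤d² 2<φ) (N≤d² 2<φ) ⟩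
            d ℕ.* d ℕ.* (d ℕ.* d)              ≡⟨ ℕₚ.*-assoc d d (d ℕ.* d) ⟩
            d ℕ.* (d ℕ.* (d ℕ.* d))            ∎)

          k+2≤φ : k ℕ.+ 2 ℕ.≤ φ
          -- Two directions are reserved for the axes. From `968kd ≤ N ≤ 4φd` one gets `242k ≤ φ`,
          -- more than the 3k that suffices.
          k+2≤φ = ℕₚ.≤-trans (ℕₚ.≤-trans (ℕₚ.+-monoʳ-≤ k (ℕₚ.*-monoʳ-≤ 2 1≤k)) (ℕₚ.*-monoˡ-≤ k {3} {242} (ℕₚ.m≤m+n 3 239)))
            (ℕₚ.*-cancelˡ-≤ 4 (ℕₚ.≤-trans (ℕₚ.≤-reflexive (sym (ℕₚ.*-assoc 4 242 k))) (ℕₚ.*-cancelʳ-≤ (968 ℕ.* k) (4 ℕ.* φ) d (begin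
              968 ℕ.* k ℕ.* d   ≤⟨ ckd≤N ⟩
              N                 ≤⟨ N≤4φd ⟩
              4 ℕ.* φ ℕ.* d     ∎))))
            where
            ckd≤N : 968 ℕ.* k ℕ.* d ℕ.≤ N
            ckd≤N = ℕₚ.*-cancelʳ-≤ (968 ℕ.* k ℕ.* d) N (d ℕ.* d) ⦃ ℕₚ.m*n≢0 d d ⦄ (begin
              968 ℕ.* k ℕ.* d ℕ.* (d ℕ.* d)      ≡⟨ ℕₚ.*-assoc (968 ℕ.* k) d (d ℕ.* d) ⟩
              968 ℕ.* k ℕ.* (d ℕ.* (d ℕ.* d))    ≡⟨ sym (assoc k 968 d) ⟩
              k ℕ.* (968 ℕ.* (d ℕ.* (d ℕ.* d)))  ≤⟨ lower ⟩
              N ℕ.* N                            ≤⟨ ℕₚ.*-monoʳ-≤ N (N≤d² 2<φ) ⟩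
              N ℕ.* (d ℕ.* d)                    ∎)

          121kd≤p : 121 ℕ.* (k ℕ.* d) ℕ.≤ p
          -- 968 is 8 · 121, with the 8 taken from `N² ≤ 8d²p`; one spare kd makes the bound with
          -- 120 strict.
          121kd≤p = ℕₚ.*-cancelˡ-≤ (8 ℕ.* (d ℕ.* d)) ⦃ ℕₚ.m*n≢0 8 (d ℕ.* d) ⦃ _ ⦄ ⦃ ℕₚ.m*n≢0 d d ⦄ ⦄ (begin
            8 ℕ.* (d ℕ.* d) ℕ.* (121 ℕ.* (k ℕ.* d))   ≡⟨ arith5 k d 8 121 ⟩
            k ℕ.* (968 ℕ.* (d ℕ.* (d ℕ.* d)))         ≤⟨ ℕₚ.≤-trans lower N²≤8d²p ⟩
            8 ℕ.* (d ℕ.* d) ℕ.* p                     ∎)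

          120kd<p : 120 ℕ.* (k ℕ.* d) ℕ.< p
          120kd<p = ℕₚ.<-≤-trans (ℕₚ.+-monoˡ-≤ (120 ℕ.* (k ℕ.* d)) (ℕₚ.*-mono-≤ 1≤k 1≤d)) 121kd≤p

          core : N ℕ.^ 8 ℕ.≤ B₃ ℕ.* D
          -- Two of the six factors N are exchanged for `k d³` by the choice of k, and the incidence
          -- bound turns `k N⁴` into `d⁸`; in total `d¹¹`.
          core = rescale-exponents N d core-constant 6 11 1≤N 1≤d (ℕₚ.m≤m+n 4 2) (ℕₚ.m≤m+n 88 2) (begin
            N ℕ.^ 6                                                    ≡⟨ ℕₚ.^-distribˡ-+-* N 2 4 ⟩
            N ℕ.^ 2 ℕ.* N ℕ.^ 4                                        ≡⟨ cong (ℕ._* N ℕ.^ 4) (cong (N ℕ.*_) (ℕₚ.*-identityʳ N)) ⟩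
            N ℕ.* N ℕ.* N ℕ.^ 4                                        ≤⟨ ℕₚ.*-monoˡ-≤ (N ℕ.^ 4) upper ⟩
            2 ℕ.* (k ℕ.* (968 ℕ.* (d ℕ.* (d ℕ.* d)))) ℕ.* N ℕ.^ 4      ≡⟨ arith6 k d (N ℕ.^ 4) 2 968 ⟩
            2 ℕ.* 968 ℕ.* (d ℕ.* (d ℕ.* d)) ℕ.* (k ℕ.* N ℕ.^ 4)        ≤⟨ ℕₚ.*-monoʳ-≤ (2 ℕ.* 968 ℕ.* (d ℕ.* (d ℕ.* d))) kN⁴≤ ⟩
            2 ℕ.* 968 ℕ.* (d ℕ.* (d ℕ.* d)) ℕ.* (incidence-constant ℕ.* d ℕ.^ 8)   ≡⟨ arith7 d (d ℕ.^ 8) (2 ℕ.* 968) incidence-constant ⟩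
            core-constant ℕ.* (d ℕ.^ 3 ℕ.* d ℕ.^ 8)                    ≡⟨ cong (core-constant ℕ.*_) (sym (ℕₚ.^-distribˡ-+-* d 3 8)) ⟩
            core-constant ℕ.* d ℕ.^ 11                                 ∎)
            where
            k≤d : k ℕ.≤ d
            k≤d = ℕₚ.≤-trans (ℕₚ.m≤m+n k (967 ℕ.* k)) ck≤d
            kN⁴≤ : k ℕ.* N ℕ.^ 4 ℕ.≤ incidence-constant ℕ.* d ℕ.^ 8
            kN⁴≤ = subst₂ (λ x y → k ℕ.* x ℕ.≤ incidence-constant ℕ.* y) (fourth N) (eighth d)
              (incidences 2<φ k k+2≤φ 1≤k 1≤d k≤d (ℕₚ.≤-trans (ℕₚ.*-monoˡ-≤ d {2} {8} (ℕₚ.m≤m+n 2 6)) (ℕₚ.<⇒≤ 8d<N)) 120kd<p)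

      module Quotient (c : ℕ) .{{_ : NonZero c}} (c≤N² : c ℕ.≤ N ℕ.* N) where
        k : ℕ
        k = (N ℕ.* N) ℕ./ c
        1≤k : 1 ℕ.≤ k
        1≤k = ℕᵐ.m≥n⇒m/n>0 c≤N²
        lower : k ℕ.* c ℕ.≤ N ℕ.* N
        lower = ℕᵐ.m/n*n≤m (N ℕ.* N) c
        upper : N ℕ.* N ℕ.≤ 2 ℕ.* (k ℕ.* c)
        upper = begin
          N ℕ.* N                              ≡⟨ ℕᵐ.m≡m%n+[m/n]*n (N ℕ.* N) c ⟩
          (N ℕ.* N) ℕ.% c ℕ.+ k ℕ.* c          ≤⟨ ℕₚ.+-monoˡ-≤ (k ℕ.* c) (ℕₚ.<⇒≤ (ℕᵐ.m%n<n (N ℕ.* N) c)) ⟩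
          c ℕ.+ k ℕ.* c                        ≤⟨ ℕₚ.+-monoˡ-≤ (k ℕ.* c) (ℕₚ.≤-trans (ℕₚ.≤-reflexive (sym (ℕₚ.*-identityˡ c))) (ℕₚ.*-monoˡ-≤ c 1≤k)) ⟩
          k ℕ.* c ℕ.+ k ℕ.* c                  ≡⟨ cong (k ℕ.* c ℕ.+_) (sym (ℕₚ.+-identityʳ (k ℕ.* c))) ⟩
          2 ℕ.* (k ℕ.* c)                      ∎

      large-N² : 8 ℕ.* d ℕ.< N → 2 ℕ.* d ℕ.≤ p → 968 ℕ.* (d ℕ.* (d ℕ.* d)) ℕ.≤ N ℕ.* N → N ℕ.^ 8 ℕ.≤ B₃ ℕ.* D
      large-N² 8d<N 2d≤p c≤N² = Main.WithSlopes.core 8d<N 2d≤p Q.k Q.1≤k Q.lower Q.upper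
        where
        module Q = Quotient (968 ℕ.* (d ℕ.* (d ℕ.* d))) ⦃ ℕₚ.m*n≢0 968 (d ℕ.* (d ℕ.* d)) ⦃ _ ⦄ ⦃ ℕₚ.m*n≢0 d (d ℕ.* d) ⦃ d-nonZero ⦄ ⦃ ℕₚ.m*n≢0 d d ⦄ ⦄ ⦄ c≤N²

      weaken : ∀ {x b c} → x ℕ.≤ b ℕ.* D → b ℕ.≤ c → x ℕ.≤ c ℕ.* D
      weaken le b≤c = ℕₚ.≤-trans le (ℕₚ.*-monoˡ-≤ D b≤c)

    N⁸≤ : N ℕ.^ 8 ℕ.≤ constant C₁ ℕ.* d ℕ.^ 15
    N⁸≤ = by-cases (N ℕ.≤? 8 ℕ.* d) (λ le → weaken {b = B₁} (small-N le) (ℕₚ.m≤m+n B₁ (B₂ ℕ.+ (B₃ ℕ.+ B₄)))) λ N≰8d →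
          by-cases (p ℕ.≤? 2 ℕ.* d) (λ le → weaken {b = B₄} (small-p le) (ℕₚ.≤-trans (ℕₚ.≤-trans (ℕₚ.m≤n+m B₄ B₃) (ℕₚ.m≤n+m (B₃ ℕ.+ B₄) B₂)) (ℕₚ.m≤n+m (B₂ ℕ.+ (B₃ ℕ.+ B₄)) B₁))) λ p≰2d →
          by-cases (N ℕ.* N ℕ.≤? 968 ℕ.* (d ℕ.* (d ℕ.* d)))
            (λ le → weaken {b = B₂} (small-N² le) (ℕₚ.≤-trans (ℕₚ.m≤m+n B₂ (B₃ ℕ.+ B₄)) (ℕₚ.m≤n+m (B₂ ℕ.+ (B₃ ℕ.+ B₄)) B₁)))
            (λ N²≰ → weaken {b = B₃} (large-N² (ℕₚ.≰⇒> N≰8d) (ℕₚ.<⇒≤ (ℕₚ.≰⇒> p≰2d)) (ℕₚ.<⇒≤ (ℕₚ.≰⇒> N²≰)))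
              (ℕₚ.≤-trans (ℕₚ.≤-trans (ℕₚ.m≤m+n B₃ B₄) (ℕₚ.m≤n+m (B₃ ℕ.+ B₄) B₂)) (ℕₚ.m≤n+m (B₂ ℕ.+ (B₃ ℕ.+ B₄)) B₁)))

-- Assembly of the bound for the product set.

module _ (C₁ p : ℕ) .{{_ : NonZero p}} (p-prime : Prime p) (p≡3 : p ℕ.% 4 ≡ 3) (E : List F2) (E# : Unique E) (E< : All (InField p) E)
  (N⁵≤ : length E ℕ.^ 5 ℕ.≤ C₁ ℕ.* p ℕ.^ 8) where
  open Products p p-prime E E# E<
  open Rich p p-prime p≡3 E E# E<

  private
    N V : ℕ
    N = length E
    V = pinned

    module NonEmpty (1≤N : 1 ℕ.≤ N) where
      instance
        N-nonZero : NonZero N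
        N-nonZero = ℕ.>-nonZero 1≤N

      -- Twice the average of |x · E|, rounded down, so that fewer than half of the points exceed
      -- it.
      d : ℕ
      d = (2 ℕ.* V) ℕ./ N

      open Poor d

      Nd≤2V : N ℕ.* d ℕ.≤ 2 ℕ.* V
      Nd≤2V = ℕₚ.≤-trans (ℕₚ.≤-reflexive (ℕₚ.*-comm N d)) (ℕᵐ.m/n*n≤m (2 ℕ.* V) N)

      2V<N[d+1] : 2 ℕ.* V ℕ.< N ℕ.* suc d
      2V<N[d+1] = ℕₚ.<-≤-trans (ℕₚ.≤-<-trans (ℕₚ.≤-reflexive (ℕᵐ.m≡m%n+[m/n]*n (2 ℕ.* V) N)) (ℕₚ.+-monoˡ-< (d ℕ.* N) (ℕᵐ.m%n<n (2 ℕ.* V) N)))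
        (ℕₚ.≤-reflexive (trans (cong (N ℕ.+_) (ℕₚ.*-comm d N)) (sym (ℕₚ.*-suc N d))))

      N≤V : N ℕ.≤ V
      N≤V = ℕₚ.≤-trans (ℕₚ.≤-reflexive (sym (trans (sum-map-const 1 E) (ℕₚ.*-identityʳ N))))
        (sum-map-mono (λ _ → 1) (λ x → length (values x)) E λ {x} x∈ → ∈⇒1≤ (values∋ {x} x∈))
        where
        ∈⇒1≤ : ∀ {t} {ts : List ℕ} → t ∈ ts → 1 ℕ.≤ length ts
        ∈⇒1≤ (here _)  = s≤s z≤n
        ∈⇒1≤ (there _) = s≤s z≤n

      1≤d : 1 ℕ.≤ d
      1≤d = ℕᵐ.m≥n⇒m/n>0 (ℕₚ.≤-trans N≤V (ℕₚ.m≤m+n V (V ℕ.+ 0)))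

      split-directions : 2 ℕ.< length directions → ∃[ w₁ ] ∃[ w₂ ] ∃[ W ] directions ≡ w₁ ∷ w₂ ∷ W
      split-directions = go directions refl
        where
        go : ∀ Φ → directions ≡ Φ → 2 ℕ.< length Φ → ∃[ w₁ ] ∃[ w₂ ] ∃[ W ] directions ≡ w₁ ∷ w₂ ∷ W
        go (w₁ ∷ w₂ ∷ W) e _ = w₁ , w₂ , W , e
        go (_ ∷ []) _ (s≤s ())

      N⁸≤ : N ℕ.^ 8 ℕ.≤ constant C₁ ℕ.* d ℕ.^ 15
      N⁸≤ = FinalArithmetic.N⁸≤ C₁ p N d (length directions) 1≤N 1≤d (ℕₚ.<-trans (s≤s z≤n) (Modular.1<p p p-prime)) (many-poor 2V<N[d+1]) N⁵≤
        (collisions-bound 1≤N) (collisions-bound′ 1≤N)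
        (λ 2<φ → two-directions (proj₂ (proj₂ (proj₂ (split-directions 2<φ)))))
        (λ 2<φ k k+2≤φ → let _ , _ , W , Φ≡ = split-directions 2<φ in
          subst (λ c → 1 ℕ.≤ k → 1 ℕ.≤ d → k ℕ.≤ d → 2 ℕ.* d ℕ.≤ N → 120 ℕ.* (k ℕ.* d) ℕ.< p →
              k ℕ.* (N ℕ.* N ℕ.* (N ℕ.* N)) ℕ.≤ c ℕ.* (d ℕ.* d ℕ.* (d ℕ.* d) ℕ.* (d ℕ.* d ℕ.* (d ℕ.* d)))) incidence-constant≡
            (directions-bound Φ≡ k (ℕₚ.+-cancelʳ-≤ 2 k (length W) (ℕₚ.≤-trans k+2≤φ (ℕₚ.≤-reflexive (trans (cong length Φ≡) (ℕₚ.+-comm 2 (length W))))))))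

      -- The exponent 38 is 2 · 19, since |[E,E,0]| ≤ N². It splits as 15 + 15 + 8: the factor `N⁸`
      -- becomes `d¹⁵`, one `N¹⁵` joins it to be absorbed by `N d ≤ 2V`, and the other stays beside
      -- `V¹⁵`.
      bound : N ℕ.^ 38 ℕ.≤ constant C₁ ℕ.* 2 ℕ.^ 15 ℕ.* (N ℕ.* V) ℕ.^ 15
      bound = begin
        N ℕ.^ 38                                                       ≡⟨ ℕₚ.^-distribˡ-+-* N 15 23 ⟩
        N ℕ.^ 15 ℕ.* N ℕ.^ 23                                          ≡⟨ cong (N ℕ.^ 15 ℕ.*_) (ℕₚ.^-distribˡ-+-* N 15 8) ⟩
        N ℕ.^ 15 ℕ.* (N ℕ.^ 15 ℕ.* N ℕ.^ 8)                            ≤⟨ ℕₚ.*-monoʳ-≤ (N ℕ.^ 15) (ℕₚ.*-monoʳ-≤ (N ℕ.^ 15) N⁸≤) ⟩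
        N ℕ.^ 15 ℕ.* (N ℕ.^ 15 ℕ.* (constant C₁ ℕ.* d ℕ.^ 15))         ≡⟨ eq₁ (N ℕ.^ 15) (constant C₁) (d ℕ.^ 15) ⟩
        constant C₁ ℕ.* N ℕ.^ 15 ℕ.* (N ℕ.^ 15 ℕ.* d ℕ.^ 15)           ≡⟨ cong (constant C₁ ℕ.* N ℕ.^ 15 ℕ.*_) (sym (^-distribʳ-* N d 15)) ⟩
        constant C₁ ℕ.* N ℕ.^ 15 ℕ.* (N ℕ.* d) ℕ.^ 15                  ≤⟨ ℕₚ.*-monoʳ-≤ (constant C₁ ℕ.* N ℕ.^ 15) (ℕₚ.^-monoˡ-≤ 15 Nd≤2V) ⟩
        constant C₁ ℕ.* N ℕ.^ 15 ℕ.* (2 ℕ.* V) ℕ.^ 15                  ≡⟨ cong (constant C₁ ℕ.* N ℕ.^ 15 ℕ.*_) (^-distribʳ-* 2 V 15) ⟩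
        constant C₁ ℕ.* N ℕ.^ 15 ℕ.* (2 ℕ.^ 15 ℕ.* V ℕ.^ 15)           ≡⟨ eq₂ (constant C₁) (N ℕ.^ 15) (2 ℕ.^ 15) (V ℕ.^ 15) ⟩
        constant C₁ ℕ.* 2 ℕ.^ 15 ℕ.* (N ℕ.^ 15 ℕ.* V ℕ.^ 15)           ≡⟨ cong (constant C₁ ℕ.* 2 ℕ.^ 15 ℕ.*_) (sym (^-distribʳ-* N V 15)) ⟩
        constant C₁ ℕ.* 2 ℕ.^ 15 ℕ.* (N ℕ.* V) ℕ.^ 15                  ∎
        where
        open ℕₚ.≤-Reasoning
        eq₁ : ∀ a c b → a ℕ.* (a ℕ.* (c ℕ.* b)) ≡ c ℕ.* a ℕ.* (a ℕ.* b)
        eq₁ = NatSolver.solve-∀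
        eq₂ : ∀ c a t v → c ℕ.* a ℕ.* (t ℕ.* v) ≡ c ℕ.* t ℕ.* (a ℕ.* v)
        eq₂ = NatSolver.solve-∀

  product-set-bound : length (EE0 p E) ℕ.^ 19 ℕ.≤ constant C₁ ℕ.* 2 ℕ.^ 15 ℕ.* length (EE0EE0 p E) ℕ.^ 15
  product-set-bound = go E refl
    where
    open ℕₚ.≤-Reasoning
    sides : 1 ℕ.≤ N → N ℕ.* V ℕ.≤ length (EE0EE0 p E) → length (EE0 p E) ℕ.^ 19 ℕ.≤ constant C₁ ℕ.* 2 ℕ.^ 15 ℕ.* length (EE0EE0 p E) ℕ.^ 15
    sides 1≤N NV≤ = begin
      length (EE0 p E) ℕ.^ 19                                         ≤⟨ ℕₚ.^-monoˡ-≤ 19 EE0-length ⟩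
      (N ℕ.* N) ℕ.^ 19                                                ≡⟨ ^-distribʳ-* N N 19 ⟩
      N ℕ.^ 19 ℕ.* N ℕ.^ 19                                           ≡⟨ sym (ℕₚ.^-distribˡ-+-* N 19 19) ⟩
      N ℕ.^ 38                                                        ≤⟨ NonEmpty.bound 1≤N ⟩
      constant C₁ ℕ.* 2 ℕ.^ 15 ℕ.* (N ℕ.* V) ℕ.^ 15                   ≤⟨ ℕₚ.*-monoʳ-≤ (constant C₁ ℕ.* 2 ℕ.^ 15) (ℕₚ.^-monoˡ-≤ 15 NV≤) ⟩
      constant C₁ ℕ.* 2 ℕ.^ 15 ℕ.* length (EE0EE0 p E) ℕ.^ 15         ∎
    go : ∀ F → E ≡ F → length (EE0 p E) ℕ.^ 19 ℕ.≤ constant C₁ ℕ.* 2 ℕ.^ 15 ℕ.* length (EE0EE0 p E) ℕ.^ 15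
    go []      e = ℕₚ.≤-trans (ℕₚ.≤-reflexive (cong (λ F → length (EE0 p F) ℕ.^ 19) e)) z≤n
    go (x ∷ F) e = sides (subst (λ F → 1 ℕ.≤ length F) (sym e) (s≤s z≤n)) (pinned-bound (subst (x ∈_) (sym e) (here refl)))

theorem1p7 : (C₁ : ℕ) → ∃[ K ] ((p : ℕ) → .{{_ : NonZero p}} → Prime p → p ℕ.% 4 ≡ 3 →
    (E : List F2) → Unique E → All (InField p) E →
    length E ℕ.^ 5 ℕ.≤ C₁ ℕ.* p ℕ.^ 8 →
    length (EE0 p E) ℕ.^ 19 ℕ.≤ K ℕ.* length (EE0EE0 p E) ℕ.^ 15)
theorem1p7 C₁ = constant C₁ ℕ.* 2 ℕ.^ 15 , λ p p-prime p≡3 E E# E< N⁵≤ → product-set-bound C₁ p p-prime p≡3 E E# E< N⁵≤
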